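{- Let $n>6$ and let $G_n$ be a connected bicyclic graph of order $n$ (i.e., a connected simple graph with $n$ vertices and $n+1$ edges) that is not isomorphic to $B_n$. Then $Sz^*(G_n)<Sz^*(B_n)$.
   Context: All graphs are finite, simple and undirected. For a connected graph $G=(V,E)$ and an edge $e=uv\in E$, let $N_u(e)=\{w\in V: d(u,w)<d(v,w)\}$, $N_v(e)=\{w\in V: d(v,w)<d(u,w)\}$, $N_0(e)=\{w\in V: d(u,w)=d(v,w)\}$, where $d$ is the graph distance, and let $n_u(e),n_v(e),n_0(e)$ be their cardinalities. The revised Szeged index is $Sz^*(G)=\sum_{e=uv\in E}\left(n_u(e)+\frac{n_0(e)}{2}\right)\left(n_v(e)+\frac{n_0(e)}{2}\right)$. $B_n$ denotes the graph obtained from the cycle $C_{n-1}$ by duplicating a single vertex, i.e., adding a new vertex adjacent exactly to the two neighbours of a chosen vertex of $C_{n-1}$. -}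

module Defs where

open import Data.Nat as ℕ using (ℕ; zero; suc; _∸_)
open import Data.Bool using (Bool; true; false; _∧_; _∨_; if_then_else_; T)
open import Data.Fin using (Fin; toℕ)
open import Data.Fin.Permutation using (Permutation′; _⟨$⟩ʳ_)
open import Data.List using (List; []; _∷_; map; concatMap; filter; length; sum; foldr)
open import Data.Bool.ListAction using (any)
open import Data.List using (allFin)
open import Data.Product using (Σ; ∃; _×_; _,_)
open import Relation.Binary.PropositionalEquality using (_≡_)
open import Relation.Nullary using (¬_)
open import Data.Integer as ℤ using (ℤ)
open import Data.Rational as ℚ using (ℚ)

Graph : ℕ → Set
Graph n = Fin n → Fin n → Bool

IsSimple : ∀ {n} → Graph n → Set
IsSimple {n} G = (∀ (i j : Fin n) → G i j ≡ G j i) × (∀ (i : Fin n) → G i i ≡ false)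

pairs : ∀ n → List (Fin n × Fin n)
pairs n = concatMap (λ i → map (λ j → i , j)
            (filter (λ j → toℕ i ℕ.<? toℕ j) (allFin n))) (allFin n)

edges : ∀ {n} → Graph n → List (Fin n × Fin n)
edges {n} G = filter (λ p → T? (G (Data.Product.proj₁ p) (Data.Product.proj₂ p))) (pairs n)
  where
  open import Relation.Nullary.Decidable using () renaming (T? to T?)

numEdges : ∀ {n} → Graph n → ℕ
numEdges G = length (edges G)

reachIn : ∀ {n} → Graph n → ℕ → Fin n → Fin n → Bool
reachIn G zero i j = toℕ i ℕ.≡ᵇ toℕ j
reachIn {n} G (suc k) i j =
  reachIn G k i j ∨ any (λ w → reachIn G k i w ∧ G w j) (allFin n)

Connected : ∀ {n} → Graph n → Set
Connected {n} G = ∀ (i j : Fin n) → ∃ λ k → reachIn G k i j ≡ true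

-- graph distance: least k with a walk of length ≤ k (searching k < fuel);
-- for a connected graph on n vertices every distance is < n, so fuel n suffices.
distFrom : ∀ {n} → Graph n → ℕ → ℕ → Fin n → Fin n → ℕ
distFrom G k zero i j = k
distFrom G k (suc fuel) i j =
  if reachIn G k i j then k else distFrom G (suc k) fuel i j

dist : ∀ {n} → Graph n → Fin n → Fin n → ℕ
dist {n} G i j = distFrom G 0 n i j

count : ∀ {n} → (Fin n → Bool) → ℕ
count {n} P = length (filter (λ w → T? (P w)) (allFin n))
  where
  open import Relation.Nullary.Decidable using () renaming (T? to T?)

nU : ∀ {n} → Graph n → Fin n → Fin n → ℕ
nU G u v = count (λ w → dist G u w ℕ.<ᵇ dist G v w)

n0 : ∀ {n} → Graph n → Fin n → Fin n → ℕ
n0 G u v = count (λ w → dist G u w ℕ.≡ᵇ dist G v w)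

ℕtoℚ : ℕ → ℚ
ℕtoℚ m = ℤ.+ m ℚ./ 1

SzStar : ∀ {n} → Graph n → ℚ
SzStar G = foldr ℚ._+_ ℚ.0ℚ (map term (edges G))
  where
  term : _ → ℚ
  term (u , v) =
    (ℕtoℚ (nU G u v) ℚ.+ ℕtoℚ (n0 G u v) ℚ.* ℚ.½) ℚ.*
    (ℕtoℚ (nU G v u) ℚ.+ ℕtoℚ (n0 G u v) ℚ.* ℚ.½)

Isomorphic : ∀ {n} → Graph n → Graph n → Set
Isomorphic {n} G H = Σ (Permutation′ n) λ π →
  ∀ (i j : Fin n) → G i j ≡ H (π ⟨$⟩ʳ i) (π ⟨$⟩ʳ j)

-- B_n : cycle C_{n-1} on vertices 0,…,n-2 (edges a~a+1 and 0~(n-2)),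
-- plus vertex n-1 duplicating vertex 0, i.e. adjacent to 1 and n-2.
-- Bdir a b lists each edge once as an ordered pair with a < b.
Bdir : ℕ → ℕ → ℕ → Bool
Bdir n a b =
     ((suc a ℕ.≡ᵇ b) ∧ (b ℕ.<ᵇ (n ∸ 1)))
  ∨ ((a ℕ.≡ᵇ 0) ∧ (b ℕ.≡ᵇ (n ∸ 2)))
  ∨ ((b ℕ.≡ᵇ (n ∸ 1)) ∧ ((a ℕ.≡ᵇ 1) ∨ (a ℕ.≡ᵇ (n ∸ 2))))

B : ∀ n → Graph n
B n i j = Bdir n (toℕ i) (toℕ j) ∨ Bdir n (toℕ j) (toℕ i)

{-# OPTIONS --safe #-}

-- For an edge uv the numbers of vertices closer to u and closer to v differ by D(v) − D(u), where
-- D(w) is the sum of the distances from w. Hence 4 Sz* = n² (n + 1) − S with S = Σ (D(u) − D(v))²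
-- over the edges. In Bₙ a vertex v of the cycle has D(v) = C + d(v, t), with t the duplicate and C
-- independent of v, so that S ≤ n + 1; it remains to show S ≥ n + 2 for every other bicyclic graph.
-- A leaf contributes (n − 2)². A graph without leaves has a Hamiltonian path with one further edge
-- at each end: a maximal path has one, and Σ (deg − 2) = 2 leaves no room for anything else. These
-- two edges yield either two disjoint cycles (up to a vertex), whose edges at the attaching vertex
-- have large differences, or three paths with common ends. In the latter case a Lipschitz function
-- bounds D from below at the midpoint of a path, walks bound D from above at its end, and summing
-- 2κx ≤ x² + κ² over the edges in between turns the difference into a lower bound for S.
module Submission where

open import Defs
open import Data.Nat as ℕ using (ℕ; zero; suc; _+_; _*_; _∸_; _⊓_; _≤_; _<_; z≤n; s≤s; ∣_-_∣)
import Data.Nat.Properties as ℕP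
open import Data.Nat.Properties using (≤-trans; ≤-refl; ≤-reflexive; ≤-pred; +-identityʳ; *-identityʳ; +-mono-≤; +-monoʳ-≤; +-monoˡ-≤; <⇒≤; m≤n⇒m≤1+n; m≤m+n; +-suc; m+[n∸m]≡n; +-comm; +-assoc; m∸n≤m; n≤1+n)
import Data.Nat.ListAction as LA
import Data.Nat.ListAction.Properties as LAP
open import Data.Nat.Tactic.RingSolver using (solve-∀)
open import Algebra.Properties.CommutativeMonoid.Sum ℕP.+-0-commutativeMonoid using (sum; sum-cong-≗; ∑-distrib-+; ∑-comm)
import Data.Integer as ℤ
import Data.Integer.Properties as ℤP
open import Data.Rational as ℚ using (ℚ; ½; 0ℚ; toℚᵘ) renaming (_<_ to _<ℚ_)
import Data.Rational.Properties as ℚP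
import Data.Rational.Solver as ℚSolver
open import Data.Rational.Unnormalised as ℚᵘ using (mkℚᵘ; *≡*; *<*)
import Data.Rational.Unnormalised.Properties as ℚᵘP
open import Data.Bool using (Bool; true; false; _∧_; _∨_; if_then_else_; T; not)
open import Data.Bool.ListAction using (any)
import Data.Bool.Properties as BP
open import Data.Fin as F using (Fin; zero; suc; toℕ)
open import Data.Fin.Permutation using (permutation)
import Data.Fin.Properties as FP
open import Data.List as L using (List; []; _∷_; _++_; concatMap)
import Data.List.Properties as LP
open import Data.List.Membership.Propositional using (lose; find)
open import Data.List.Membership.Propositional.Properties using (∈-allFin)
open import Data.List.Relation.Unary.Any.Properties using (any⁺; any⁻)
open import Data.Product using (Σ; ∃; _×_; _,_; proj₁; proj₂; uncurry)
open import Data.Sum using (_⊎_; inj₁; inj₂)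
open import Data.Empty using (⊥; ⊥-elim)
open import Data.Unit using (tt)
open import Data.Vec as V using ([]; _∷_)
open import Function using (_∘_; id)
open import Function.Bundles using (Equivalence; mk⇔)
open import Relation.Binary using (tri<; tri≈; tri>)
open import Relation.Binary.PropositionalEquality using (_≡_; _≢_; refl; sym; trans; cong; cong₂; subst; subst₂; module ≡-Reasoning)
open import Relation.Nullary using (¬_; Dec; yes; no; does)
open import Relation.Nullary.Decidable using (T?; dec-true; dec-false; _×-dec_; ¬?)


-- Finite sums

-- The margin is a single unit, `S ≤ n + 1` for the extremal graph against `S ≥ n + 2` elsewhere,
-- yet no formula for the distances in a general bicyclic graph is available. In such a graph
-- distances are therefore only bounded, above by explicit walks and below by functions that grow by
-- at most one along each edge. The choice of the midpoint makes these crude bounds sharp enough.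
-- Its distances to the two ends of its path differ by at most one, so a detour through the third
-- path never helps: the cycle formed by the other two paths keeps its cyclic distances, however
-- short the third path is. For the end of the path upper bounds suffice, and by rotation the same
-- sum over the cycle bounds both sides and cancels. What remains is a count over the interior of
-- the third path. The constant κ is the expected mean of the differences: 2 where a gain of about
-- twice the number of edges is available, 1 where the gain equals the number of edges. One family,
-- a triangle sharing an edge with a long cycle, needs both values.

𝟙 : Bool → ℕ
𝟙 b = if b then 1 else 0

sum-mono : ∀ {n} {f g : Fin n → ℕ} → (∀ i → f i ≤ g i) → sum f ≤ sum g
sum-mono {zero}  f≤g = z≤n
sum-mono {suc n} f≤g = +-mono-≤ (f≤g zero) (sum-mono (f≤g ∘ suc))

sum-const : ∀ n c → sum {n} (λ _ → c) ≡ n * c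
sum-const zero    c = refl
sum-const (suc n) c = cong (c +_) (sum-const n c)

term≤sum : ∀ {n} (f : Fin n → ℕ) i → f i ≤ sum f
term≤sum f zero    = m≤m+n _ _
term≤sum f (suc i) = ≤-trans (term≤sum (f ∘ suc) i) (ℕP.m≤n+m _ _)

∑< : ℕ → (ℕ → ℕ) → ℕ
∑< zero    f = 0
∑< (suc n) f = f 0 + ∑< n (f ∘ suc)

sum-toℕ : ∀ n f → sum {n} (f ∘ toℕ) ≡ ∑< n f
sum-toℕ zero    f = refl
sum-toℕ (suc n) f = cong (f 0 +_) (sum-toℕ n (f ∘ suc))

∑<-cong : ∀ n {f g : ℕ → ℕ} → (∀ k → k < n → f k ≡ g k) → ∑< n f ≡ ∑< n g
∑<-cong zero    h = refl
∑<-cong (suc n) h = cong₂ _+_ (h 0 (s≤s z≤n)) (∑<-cong n (λ k k<n → h (suc k) (s≤s k<n)))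

∑<-mono : ∀ n {f g : ℕ → ℕ} → (∀ k → k < n → f k ≤ g k) → ∑< n f ≤ ∑< n g
∑<-mono zero    h = z≤n
∑<-mono (suc n) h = +-mono-≤ (h 0 (s≤s z≤n)) (∑<-mono n (λ k k<n → h (suc k) (s≤s k<n)))

∑<-+ : ∀ n (f g : ℕ → ℕ) → ∑< n (λ k → f k + g k) ≡ ∑< n f + ∑< n g
∑<-+ zero    f g = refl
∑<-+ (suc n) f g = trans (cong (f 0 + g 0 +_) (∑<-+ n (f ∘ suc) (g ∘ suc))) (lemma (f 0) (g 0) (∑< n (f ∘ suc)) (∑< n (g ∘ suc)))
  where
  lemma : ∀ a b c d → a + b + (c + d) ≡ (a + c) + (b + d)
  lemma = solve-∀

∑<-const : ∀ n c → ∑< n (λ _ → c) ≡ n * c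
∑<-const zero    c = refl
∑<-const (suc n) c = cong (c +_) (∑<-const n c)

∑<-term : ∀ n (f : ℕ → ℕ) k → k < n → f k ≤ ∑< n f
∑<-term (suc n) f zero    _  = m≤m+n _ _
∑<-term (suc n) f (suc k) (s≤s k<n) = ≤-trans (∑<-term n (f ∘ suc) k k<n) (ℕP.m≤n+m _ _)

∑<-comm : ∀ m n (f : ℕ → ℕ → ℕ) → ∑< m (λ i → ∑< n (f i)) ≡ ∑< n (λ j → ∑< m (λ i → f i j))
∑<-comm zero    n f = sym (trans (∑<-const n 0) (ℕP.*-zeroʳ n))
∑<-comm (suc m) n f = trans (cong (∑< n (f 0) +_) (∑<-comm m n (f ∘ suc))) (sym (∑<-+ n (f 0) (λ j → ∑< m (λ i → f (suc i) j))))

∑²< : ℕ → (ℕ → ℕ → ℕ) → ℕ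
∑²< n f = ∑< n (λ k → ∑< n (f k))

∑²<-+ : ∀ n f g → ∑²< n (λ k l → f k l + g k l) ≡ ∑²< n f + ∑²< n g
∑²<-+ n f g = trans (∑<-cong n (λ k _ → ∑<-+ n (f k) (g k))) (∑<-+ n (λ k → ∑< n (f k)) (λ k → ∑< n (g k)))

∑²<-cong : ∀ n {f g : ℕ → ℕ → ℕ} → (∀ k l → f k l ≡ g k l) → ∑²< n f ≡ ∑²< n g
∑²<-cong n h = ∑<-cong n (λ k _ → ∑<-cong n (λ l _ → h k l))

∑<-mono-< : ∀ n {f g : ℕ → ℕ} → (∀ k → k < n → f k ≤ g k) → ∀ j → j < n → f j < g j → ∑< n f < ∑< n g
∑<-mono-< (suc n) h zero    _  lt = ℕP.+-mono-<-≤ lt (∑<-mono n (λ k k<n → h (suc k) (s≤s k<n)))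
∑<-mono-< (suc n) h (suc j) (s≤s j<n) lt = ℕP.+-mono-≤-< (h 0 (s≤s z≤n)) (∑<-mono-< n (λ k k<n → h (suc k) (s≤s k<n)) j j<n lt)

∑<-mono-≡ : ∀ n {f g : ℕ → ℕ} → (∀ k → k < n → f k ≤ g k) → ∑< n g ≤ ∑< n f → ∀ k → k < n → f k ≡ g k
∑<-mono-≡ n h le k k<n = ℕP.≤-antisym (h k k<n) (ℕP.≮⇒≥ λ lt → ℕP.<⇒≱ (∑<-mono-< n h k k<n lt) le)

∑<-split : ∀ m n (f : ℕ → ℕ) → ∑< (m + n) f ≡ ∑< m f + ∑< n (λ k → f (m + k))
∑<-split zero    n f = refl
∑<-split (suc m) n f = trans (cong (f 0 +_) (∑<-split m n (f ∘ suc))) (sym (+-assoc (f 0) _ _))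

∑<-last : ∀ n (f : ℕ → ℕ) → ∑< (suc n) f ≡ ∑< n f + f n
∑<-last zero    f = +-comm (f 0) 0
∑<-last (suc n) f = trans (cong (f 0 +_) (∑<-last n (f ∘ suc))) (sym (+-assoc (f 0) _ _))

∑<-reverse : ∀ n (f : ℕ → ℕ) → ∑< n f ≡ ∑< n (λ k → f (n ∸ suc k))
∑<-reverse zero    f = refl
∑<-reverse (suc n) f = begin
  ∑< (suc n) f  ≡⟨ ∑<-last n f ⟩
  ∑< n f + f n  ≡⟨ +-comm (∑< n f) (f n) ⟩
  f n + ∑< n f  ≡⟨ cong (f n +_) (∑<-reverse n f) ⟩
  f n + ∑< n (λ k → f (n ∸ suc k))  ∎
  where open ≡-Reasoning

sum-without : ∀ {n} (f : Fin n → ℕ) x → sum f ≡ f x + sum (λ v → if does (v F.≟ x) then 0 else f v)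
sum-without {suc n} f zero    = cong (f zero +_) (sum-cong-≗ {n} (λ v → refl))
sum-without {suc n} f (suc x) = trans (cong (f zero +_) (sum-without (f ∘ suc) x))
  (lemma (f zero) (f (suc x)) (sum (λ v → if does (v F.≟ x) then 0 else f (suc v))))
  where
  lemma : ∀ a b c → a + (b + c) ≡ b + (a + c)
  lemma = solve-∀

InjectiveBelow : ∀ {n} → ℕ → (ℕ → Fin n) → Set
InjectiveBelow m w = ∀ k l → k < m → l < m → w k ≡ w l → k ≡ l

-- Setting `f` to zero at `w 0` leaves the later terms unchanged, by injectivity, and removes
-- exactly `f (w 0)` from the full sum. Together with `sum-injective-≤` this gives the change of
-- variables `vertex-sum` along a spanning path.
∑<-injective-≤ : ∀ {n} m (w : ℕ → Fin n) → InjectiveBelow m w → ∀ f → ∑< m (f ∘ w) ≤ sum f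
∑<-injective-≤ zero    w inj f = z≤n
∑<-injective-≤ (suc m) w inj f = begin
  f (w 0) + ∑< m (f ∘ w ∘ suc)  ≡⟨ cong (f (w 0) +_) (∑<-cong m unchanged) ⟩
  f (w 0) + ∑< m (f′ ∘ w ∘ suc)  ≤⟨ +-monoʳ-≤ (f (w 0)) (∑<-injective-≤ m (w ∘ suc) inj′ f′) ⟩
  f (w 0) + sum f′  ≡⟨ sum-without f (w 0) ⟨
  sum f  ∎
  where
  open ℕP.≤-Reasoning
  f′ : Fin _ → ℕ
  f′ v = if does (v F.≟ w 0) then 0 else f v
  inj′ : InjectiveBelow m (w ∘ suc)
  inj′ k l k<m l<m eq = ℕP.suc-injective (inj (suc k) (suc l) (s≤s k<m) (s≤s l<m) eq)
  unchanged : ∀ k → k < m → f (w (suc k)) ≡ f′ (w (suc k))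
  unchanged k k<m with w (suc k) F.≟ w 0
  ... | yes eq with inj (suc k) 0 (s≤s k<m) (s≤s z≤n) eq
  ...   | ()
  unchanged k k<m | no _ = refl

∑<-without : ∀ m (f : ℕ → ℕ) x → x < m → ∑< m f ≡ f x + ∑< m (λ k → if does (k ℕ.≟ x) then 0 else f k)
∑<-without (suc m) f zero    _  = refl
∑<-without (suc m) f (suc x) (s≤s x<m) = trans (cong (f 0 +_) (∑<-without m (f ∘ suc) x x<m))
  (lemma (f 0) (f (suc x)) (∑< m (λ v → if does (v ℕ.≟ x) then 0 else f (suc v))))
  where
  lemma : ∀ a b c → a + (b + c) ≡ b + (a + c)
  lemma = solve-∀

sum-injective-≤ : ∀ {n} m (ix : Fin n → ℕ) → (∀ v → ix v < m) → (∀ u v → ix u ≡ ix v → u ≡ v) →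
  ∀ f → sum (f ∘ ix) ≤ ∑< m f
sum-injective-≤ {zero}  m ix bd inj f = z≤n
sum-injective-≤ {suc n} m ix bd inj f = begin
  f x + sum (f ∘ ix ∘ suc)    ≡⟨ cong (f x +_) (sum-cong-≗ unchanged) ⟩
  f x + sum (f′ ∘ ix ∘ suc)   ≤⟨ +-monoʳ-≤ (f x) (sum-injective-≤ m (ix ∘ suc) (bd ∘ suc) (λ u v eq → FP.suc-injective (inj (suc u) (suc v) eq)) f′) ⟩
  f x + ∑< m f′  ≡⟨ ∑<-without m f x (bd zero) ⟨
  ∑< m f  ∎
  where
  open ℕP.≤-Reasoning
  x = ix zero
  f′ : ℕ → ℕ
  f′ v = if does (v ℕ.≟ x) then 0 else f v
  unchanged : ∀ v → f (ix (suc v)) ≡ f′ (ix (suc v))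
  unchanged v = cong (if_then 0 else f (ix (suc v))) (sym (dec-false (ix (suc v) ℕ.≟ x) λ eq → FP.0≢1+n (sym (inj (suc v) zero eq))))

lsum-tabulate : ∀ {n} {A : Set} (g : Fin n → A) (h : A → ℕ) → LA.sum (L.map h (L.tabulate g)) ≡ sum (h ∘ g)
lsum-tabulate {zero}  g h = refl
lsum-tabulate {suc n} g h = cong (h (g zero) +_) (lsum-tabulate (g ∘ suc) h)

lsum-filter : ∀ {A : Set} {P : A → Set} (P? : ∀ x → Dec (P x)) (h : A → ℕ) xs →
  LA.sum (L.map h (L.filter P? xs)) ≡ LA.sum (L.map (λ x → 𝟙 (does (P? x)) * h x) xs)
lsum-filter P? h []  = refl
lsum-filter P? h (x ∷ xs) with does (P? x)
... | true  = cong₂ _+_ (sym (+-identityʳ (h x))) (lsum-filter P? h xs)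
... | false = lsum-filter P? h xs

lsum-concatMap : ∀ {A B : Set} (h : B → ℕ) (g : A → List B) xs →
  LA.sum (L.map h (concatMap g xs)) ≡ LA.sum (L.map (λ a → LA.sum (L.map h (g a))) xs)
lsum-concatMap h g []  = refl
lsum-concatMap h g (x ∷ xs) = trans (trans (cong LA.sum (LP.map-++ h (g x) (concatMap g xs))) (LAP.sum-++ (L.map h (g x)) (L.map h (concatMap g xs)))) (cong (LA.sum (L.map h (g x)) +_) (lsum-concatMap h g xs))

length-lsum : ∀ {A : Set} (xs : List A) → L.length xs ≡ LA.sum (L.map (λ _ → 1) xs)
length-lsum []  = refl
length-lsum (x ∷ xs) = cong suc (length-lsum xs)

count-sum : ∀ {n} (P : Fin n → Bool) → count P ≡ sum (𝟙 ∘ P)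
count-sum {n} P = begin
  count P  ≡⟨ length-lsum (L.filter (λ w → T? (P w)) (L.allFin n)) ⟩
  LA.sum (L.map (λ _ → 1) (L.filter (λ w → T? (P w)) (L.allFin n)))  ≡⟨ lsum-filter (λ w → T? (P w)) (λ _ → 1) (L.allFin n) ⟩
  LA.sum (L.map (λ w → 𝟙 (P w) * 1) (L.allFin n))  ≡⟨ lsum-tabulate id (λ w → 𝟙 (P w) * 1) ⟩
  sum (λ w → 𝟙 (P w) * 1)  ≡⟨ sum-cong-≗ (λ w → *-identityʳ (𝟙 (P w))) ⟩
  sum (𝟙 ∘ P)  ∎
  where open ≡-Reasoning

edgeSum : ∀ {n} → Graph n → (Fin n → Fin n → ℕ) → ℕ
edgeSum G F = LA.sum (L.map (uncurry F) (edges G))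

numEdges-edgeSum : ∀ {n} (G : Graph n) → numEdges G ≡ edgeSum G (λ _ _ → 1)
numEdges-edgeSum G = length-lsum (edges G)

edgeSum-ordered : ∀ {n} (G : Graph n) F →
  edgeSum G F ≡ sum (λ i → sum (λ j → 𝟙 (does (toℕ i ℕ.<? toℕ j)) * (𝟙 (G i j) * F i j)))
edgeSum-ordered {n} G F = begin
  edgeSum G F
    ≡⟨ lsum-filter (λ p → T? (G (proj₁ p) (proj₂ p))) (uncurry F) (pairs n) ⟩
  LA.sum (L.map h (pairs n))
    ≡⟨ lsum-concatMap h row (L.allFin n) ⟩
  LA.sum (L.map (λ i → LA.sum (L.map h (row i))) (L.allFin n))
    ≡⟨ lsum-tabulate id (λ i → LA.sum (L.map h (row i))) ⟩
  sum (λ i → LA.sum (L.map h (row i)))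
    ≡⟨ sum-cong-≗ inner ⟩
  sum (λ i → sum (λ j → 𝟙 (does (toℕ i ℕ.<? toℕ j)) * (𝟙 (G i j) * F i j))) ∎
  where
  open ≡-Reasoning
  h : Fin n × Fin n → ℕ
  h p = 𝟙 (G (proj₁ p) (proj₂ p)) * uncurry F p
  row : Fin n → List (Fin n × Fin n)
  row i = L.map (λ j → i , j) (L.filter (λ j → toℕ i ℕ.<? toℕ j) (L.allFin n))
  inner : ∀ i → LA.sum (L.map h (row i)) ≡ sum (λ j → 𝟙 (does (toℕ i ℕ.<? toℕ j)) * (𝟙 (G i j) * F i j))
  inner i = begin
    LA.sum (L.map h (row i))
      ≡⟨ cong LA.sum (LP.map-∘ (L.filter (λ j → toℕ i ℕ.<? toℕ j) (L.allFin n))) ⟨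
    LA.sum (L.map (λ j → h (i , j)) (L.filter (λ j → toℕ i ℕ.<? toℕ j) (L.allFin n)))
      ≡⟨ lsum-filter (λ j → toℕ i ℕ.<? toℕ j) (λ j → h (i , j)) (L.allFin n) ⟩
    LA.sum (L.map (λ j → 𝟙 (does (toℕ i ℕ.<? toℕ j)) * h (i , j)) (L.allFin n))
      ≡⟨ lsum-tabulate id (λ j → 𝟙 (does (toℕ i ℕ.<? toℕ j)) * h (i , j)) ⟩
    sum (λ j → 𝟙 (does (toℕ i ℕ.<? toℕ j)) * h (i , j)) ∎

module _ {n} (G : Graph n) (simple : IsSimple G) where

  -- The edge list keeps each edge in the order of `Fin n`, which is unrelated to the numbering
  -- along a path. The sum over all ordered pairs is indifferent to the numbering, so edge sums are
  -- compared in this doubled form.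
  double-edgeSum : ∀ F → (∀ u v → F u v ≡ F v u) →
    sum (λ i → sum (λ j → 𝟙 (G i j) * F i j)) ≡ edgeSum G F + edgeSum G F
  double-edgeSum F F-sym = begin
    sum (λ i → sum (λ j → 𝟙 (G i j) * F i j))
      ≡⟨ sum-cong-≗ (λ i → trans (sum-cong-≗ (split i)) (∑-distrib-+ (E i) (λ j → E j i))) ⟩
    sum (λ i → sum (E i) + sum (λ j → E j i))
      ≡⟨ ∑-distrib-+ (λ i → sum (E i)) (λ i → sum (λ j → E j i)) ⟩
    sum (λ i → sum (E i)) + sum (λ i → sum (λ j → E j i))
      ≡⟨ cong (sum (λ i → sum (E i)) +_) (∑-comm (λ i j → E j i)) ⟩
    sum (λ i → sum (E i)) + sum (λ i → sum (E i))
      ≡⟨ cong₂ _+_ (edgeSum-ordered G F) (edgeSum-ordered G F) ⟨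
    edgeSum G F + edgeSum G F ∎
    where
    open ≡-Reasoning
    E : Fin n → Fin n → ℕ
    E i j = 𝟙 (does (toℕ i ℕ.<? toℕ j)) * (𝟙 (G i j) * F i j)
    split : ∀ i j → 𝟙 (G i j) * F i j ≡ E i j + E j i
    split i j with ℕP.<-cmp (toℕ i) (toℕ j)
    ... | tri< i<j _ j≮i rewrite dec-true (toℕ i ℕ.<? toℕ j) i<j | dec-false (toℕ j ℕ.<? toℕ i) j≮i =
          lemma (𝟙 (G i j) * F i j)
      where
      lemma : ∀ x → x ≡ x + 0 + 0
      lemma = solve-∀
    ... | tri> i≮j _ j<i rewrite dec-true (toℕ j ℕ.<? toℕ i) j<i | dec-false (toℕ i ℕ.<? toℕ j) i≮j =
          trans (cong₂ (λ b x → 𝟙 b * x) (proj₁ simple i j) (F-sym i j)) (sym (+-identityʳ _))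
    ... | tri≈ i≮j i≡j j≮i rewrite dec-false (toℕ j ℕ.<? toℕ i) j≮i | dec-false (toℕ i ℕ.<? toℕ j) i≮j
                                 | FP.toℕ-injective i≡j | proj₂ simple j = refl

-- The index as a quarter of a sum of natural numbers

ℕtoℚᵘ : ∀ m → toℚᵘ (ℕtoℚ m) ℚᵘ.≃ mkℚᵘ (ℤ.+ m) 0
ℕtoℚᵘ m = ℚP.toℚᵘ-fromℚᵘ (mkℚᵘ (ℤ.+ m) 0)

ℕtoℚ-+ : ∀ a b → ℕtoℚ (a + b) ≡ ℕtoℚ a ℚ.+ ℕtoℚ b
ℕtoℚ-+ a b = ℚP.toℚᵘ-injective (begin
  toℚᵘ (ℕtoℚ (a + b))  ≈⟨ ℕtoℚᵘ (a + b) ⟩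
  mkℚᵘ (ℤ.+ (a + b)) 0  ≈⟨ *≡* (cong (ℤ._* ℤ.+ 1) (cong₂ ℤ._+_ (sym (ℤP.*-identityʳ (ℤ.+ a))) (sym (ℤP.*-identityʳ (ℤ.+ b))))) ⟩
  mkℚᵘ (ℤ.+ a) 0 ℚᵘ.+ mkℚᵘ (ℤ.+ b) 0   ≈⟨ ℚᵘP.+-cong (ℕtoℚᵘ a) (ℕtoℚᵘ b) ⟨
  toℚᵘ (ℕtoℚ a) ℚᵘ.+ toℚᵘ (ℕtoℚ b)     ≈⟨ ℚP.toℚᵘ-homo-+ (ℕtoℚ a) (ℕtoℚ b) ⟨
  toℚᵘ (ℕtoℚ a ℚ.+ ℕtoℚ b)  ∎)
  where open ℚᵘP.≃-Reasoning

ℕtoℚ-* : ∀ a b → ℕtoℚ (a * b) ≡ ℕtoℚ a ℚ.* ℕtoℚ b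
ℕtoℚ-* a b = ℚP.toℚᵘ-injective (begin
  toℚᵘ (ℕtoℚ (a * b))  ≈⟨ ℕtoℚᵘ (a * b) ⟩
  mkℚᵘ (ℤ.+ (a * b)) 0  ≈⟨ *≡* (cong (ℤ._* ℤ.+ 1) (ℤP.pos-* a b)) ⟩
  mkℚᵘ (ℤ.+ a) 0 ℚᵘ.* mkℚᵘ (ℤ.+ b) 0   ≈⟨ ℚᵘP.*-cong (ℕtoℚᵘ a) (ℕtoℚᵘ b) ⟨
  toℚᵘ (ℕtoℚ a) ℚᵘ.* toℚᵘ (ℕtoℚ b)     ≈⟨ ℚP.toℚᵘ-homo-* (ℕtoℚ a) (ℕtoℚ b) ⟨
  toℚᵘ (ℕtoℚ a ℚ.* ℕtoℚ b)  ∎)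
  where open ℚᵘP.≃-Reasoning

ℕtoℚ-< : ∀ {a b} → a < b → ℕtoℚ a ℚ.< ℕtoℚ b
ℕtoℚ-< {a} {b} a<b = ℚP.toℚᵘ-cancel-< (ℚᵘP.<-respˡ-≃ (ℚᵘP.≃-sym (ℕtoℚᵘ a)) (ℚᵘP.<-respʳ-≃ (ℚᵘP.≃-sym (ℕtoℚᵘ b))
  (*<* (subst₂ ℤ._<_ (sym (ℤP.*-identityʳ (ℤ.+ a))) (sym (ℤP.*-identityʳ (ℤ.+ b))) (ℤ.+<+ a<b)))))

¼ : ℚ
¼ = ½ ℚ.* ½

-- Four times the summand of the index, which is a natural number.
szTerm : ∀ {n} → Graph n → Fin n → Fin n → ℕ
szTerm G u v = (nU G u v + nU G u v + n0 G u v) * (nU G v u + nU G v u + n0 G u v)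

halves : ∀ a b z → (ℕtoℚ a ℚ.+ ℕtoℚ z ℚ.* ½) ℚ.* (ℕtoℚ b ℚ.+ ℕtoℚ z ℚ.* ½) ≡ ℕtoℚ ((a + a + z) * (b + b + z)) ℚ.* ¼
halves a b z = begin
  (A ℚ.+ Z ℚ.* ½) ℚ.* (C ℚ.+ Z ℚ.* ½)
    ≡⟨ solve 3 (λ a c z → (a :+ z :* con ½) :* (c :+ z :* con ½) :=
                          (a :+ a :+ z) :* (c :+ c :+ z) :* (con ½ :* con ½)) refl A C Z ⟩
  (A ℚ.+ A ℚ.+ Z) ℚ.* (C ℚ.+ C ℚ.+ Z) ℚ.* ¼
    ≡⟨ cong (ℚ._* ¼) (cong₂ ℚ._*_ (double a) (double b)) ⟨
  ℕtoℚ (a + a + z) ℚ.* ℕtoℚ (b + b + z) ℚ.* ¼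
    ≡⟨ cong (ℚ._* ¼) (ℕtoℚ-* (a + a + z) (b + b + z)) ⟨
  ℕtoℚ ((a + a + z) * (b + b + z)) ℚ.* ¼ ∎
  where
  open ≡-Reasoning
  open ℚSolver.+-*-Solver using (solve; _:=_; _:+_; _:*_; con)
  A = ℕtoℚ a
  C = ℕtoℚ b
  Z = ℕtoℚ z
  double : ∀ x → ℕtoℚ (x + x + z) ≡ ℕtoℚ x ℚ.+ ℕtoℚ x ℚ.+ Z
  double x = trans (ℕtoℚ-+ (x + x) z) (cong (ℚ._+ Z) (ℕtoℚ-+ x x))

foldr-scaled : ∀ {A : Set} (f : A → ℚ) (g : A → ℕ) → (∀ a → f a ≡ ℕtoℚ (g a) ℚ.* ¼) → ∀ xs →
  L.foldr ℚ._+_ 0ℚ (L.map f xs) ≡ ℕtoℚ (LA.sum (L.map g xs)) ℚ.* ¼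
foldr-scaled f g h []  = refl
foldr-scaled f g h (x ∷ xs) = begin
  f x ℚ.+ L.foldr ℚ._+_ 0ℚ (L.map f xs)  ≡⟨ cong₂ ℚ._+_ (h x) (foldr-scaled f g h xs) ⟩
  ℕtoℚ (g x) ℚ.* ¼ ℚ.+ ℕtoℚ s ℚ.* ¼      ≡⟨ ℚP.*-distribʳ-+ ¼ (ℕtoℚ (g x)) (ℕtoℚ s) ⟨
  (ℕtoℚ (g x) ℚ.+ ℕtoℚ s) ℚ.* ¼  ≡⟨ cong (ℚ._* ¼) (ℕtoℚ-+ (g x) s) ⟨
  ℕtoℚ (g x + s) ℚ.* ¼  ∎
  where
  open ≡-Reasoning
  s = LA.sum (L.map g xs)

SzStar-edgeSum : ∀ {n} (G : Graph n) → SzStar G ≡ ℕtoℚ (edgeSum G (szTerm G)) ℚ.* ¼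
SzStar-edgeSum G = foldr-scaled _ (uncurry (szTerm G)) (λ { (u , v) → halves (nU G u v) (nU G v u) (n0 G u v) }) (edges G)

SzStar-< : ∀ {n} {G H : Graph n} → edgeSum G (szTerm G) < edgeSum H (szTerm H) → SzStar G ℚ.< SzStar H
SzStar-< {G = G} {H} lt = subst₂ ℚ._<_ (sym (SzStar-edgeSum G)) (sym (SzStar-edgeSum H)) (ℚP.*-monoˡ-<-pos ¼ (ℕtoℚ-< lt))

-- Linear arithmetic over ℕ with truncated subtraction and minimum, by Fourier–Motzkin elimination.
-- `lia` takes the values of the variables and a formula of the form h₁ :⇒ … :⇒ hₖ :⇒ goal.
module LinearArithmetic where

  open import Data.Integer as ℤ using (ℤ; +_; -[1+_])
  import Data.Integer.Properties as ℤP
  open import Data.Integer.Tactic.RingSolver renaming (solve-∀ to ℤ-solve-∀)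
  open import Data.List.Relation.Unary.All as All using (All; []; _∷_)
  import Data.List.Relation.Unary.All.Properties as AllP
  open import Data.List.Relation.Unary.Any using (Any; here; there)
  import Data.List.Relation.Unary.Any.Properties as AnyP
  open import Data.Vec using (Vec; lookup)
  import Data.Vec.Properties as VP
  open import Data.Vec.N-ary using (N-ary; _$ⁿ_)

  Lin : ℕ → Set
  Lin = Vec ℤ

  dot : ∀ {n} → Lin n → Vec ℤ n → ℤ
  dot []  []  = + 0
  dot (c ∷ cs) (x ∷ xs) = c ℤ.* x ℤ.+ dot cs xs

  combine : ∀ {n} → ℕ → ℕ → Lin n → Lin n → Lin n
  combine s t = V.zipWith (λ a b → + s ℤ.* a ℤ.+ + t ℤ.* b)

  dot-combine : ∀ {n} s t (a b : Lin n) ρ →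
    dot (combine s t a b) ρ ≡ + s ℤ.* dot a ρ ℤ.+ + t ℤ.* dot b ρ
  dot-combine s t []  []  []      = lemma (+ s) (+ t)
    where
    lemma : ∀ s t → + 0 ≡ s ℤ.* + 0 ℤ.+ t ℤ.* + 0
    lemma = ℤ-solve-∀
  dot-combine s t (a ∷ as) (b ∷ bs) (x ∷ ρ) =
    trans (cong (λ z → (+ s ℤ.* a ℤ.+ + t ℤ.* b) ℤ.* x ℤ.+ z) (dot-combine s t as bs ρ))
          (lemma (+ s) (+ t) a b x (dot as ρ) (dot bs ρ))
    where
    lemma : ∀ s t a b x p q →
      (s ℤ.* a ℤ.+ t ℤ.* b) ℤ.* x ℤ.+ (s ℤ.* p ℤ.+ t ℤ.* q) ≡ s ℤ.* (a ℤ.* x ℤ.+ p) ℤ.+ t ℤ.* (b ℤ.* x ℤ.+ q)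
    lemma = ℤ-solve-∀

  Sat : ∀ {n} → Vec ℤ n → Lin n → Set
  Sat ρ l = + 0 ℤ.≤ dot l ρ

  *-nonneg : ∀ s {z} → + 0 ℤ.≤ z → + 0 ℤ.≤ + s ℤ.* z
  *-nonneg s {+ m} _ = subst (+ 0 ℤ.≤_) (ℤP.pos-* s m) (ℤ.+≤+ z≤n)

  combine-sat : ∀ {n} s t {a b : Lin n} {ρ} → Sat ρ a → Sat ρ b → Sat ρ (combine s t a b)
  combine-sat s t {a} {b} {ρ} p q =
    subst (+ 0 ℤ.≤_) (sym (dot-combine s t a b ρ)) (ℤP.+-mono-≤ (*-nonneg s p) (*-nonneg t q))

  record Split (n : ℕ) : Set where
    constructor split
    field pos neg nil : List (Lin n)

  classify : ∀ {n} → Fin n → List (Lin n) → Split n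
  classify i []  = split [] [] []
  classify i (l ∷ ls) with lookup l i | classify i ls
  ... | + 0  | split ps ns zs = split ps ns (l ∷ zs)
  ... | + (suc _) | split ps ns zs = split (l ∷ ps) ns zs
  ... | -[1+ _ ]  | split ps ns zs = split ps (l ∷ ns) zs

  -- For `p` positive and `q` negative at `i` these multipliers cancel the variable. Soundness rests
  -- only on their being natural numbers, since nonnegative combinations preserve satisfaction.
  resolve : ∀ {n} → Fin n → Lin n → Lin n → Lin n
  resolve i p q = combine ℤ.∣ lookup q i ∣ ℤ.∣ lookup p i ∣ p q

  eliminate : ∀ {n} → Fin n → List (Lin n) → List (Lin n)
  eliminate i ls = go (classify i ls)
    where
    go : Split _ → List (Lin _)
    go (split ps ns zs) = zs ++ concatMap (λ p → L.map (resolve i p) ns) ps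

  record SplitSat {n} (ρ : Vec ℤ n) (s : Split n) : Set where
    constructor splitSat
    field
      pos : All (Sat ρ) (Split.pos s)
      neg : All (Sat ρ) (Split.neg s)
      nil : All (Sat ρ) (Split.nil s)

  classify-sat : ∀ {n} {ρ} (i : Fin n) ls → All (Sat ρ) ls → SplitSat ρ (classify i ls)
  classify-sat i []  []  = splitSat [] [] []
  classify-sat i (l ∷ ls) (x ∷ xs) with lookup l i | classify i ls | classify-sat i ls xs
  ... | + 0  | _ | splitSat ps ns zs = splitSat ps ns (x ∷ zs)
  ... | + (suc _) | _ | splitSat ps ns zs = splitSat (x ∷ ps) ns zs
  ... | -[1+ _ ]  | _ | splitSat ps ns zs = splitSat ps (x ∷ ns) zs

  eliminate-sat : ∀ {n} {ρ} (i : Fin n) ls → All (Sat ρ) ls → All (Sat ρ) (eliminate i ls)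
  eliminate-sat {ρ = ρ} i ls xs with classify i ls | classify-sat i ls xs
  ... | split ps ns zs | splitSat sp sn sz = AllP.++⁺ sz (go ps sp)
    where
    row : ∀ p → Sat ρ p → ∀ ns → All (Sat ρ) ns → All (Sat ρ) (L.map (resolve i p) ns)
    row p x []  []  = []
    row p x (q ∷ qs) (y ∷ ys) = combine-sat ℤ.∣ lookup q i ∣ ℤ.∣ lookup p i ∣ {p} {q} {ρ} x y ∷ row p x qs ys
    go : ∀ ps → All (Sat ρ) ps → All (Sat ρ) (concatMap (λ p → L.map (resolve i p) ns) ps)
    go []  []  = []
    go (p ∷ ps) (x ∷ xs) = AllP.++⁺ (row p x ns sn) (go ps xs)

  isZero : ℤ → Bool
  isZero (+ 0) = true
  isZero _     = false

  -- Coordinate `0` holds the constant term, because `Env` puts the value `1` there.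
  absurd : ∀ {n} → Lin (suc n) → Bool
  absurd (-[1+ _ ] ∷ cs) = V.foldr′ (λ c b → isZero c ∧ b) true cs
  absurd (_ ∷ cs)  = false

  dot-zero : ∀ {n} (cs : Lin n) ρ → T (V.foldr′ (λ c b → isZero c ∧ b) true cs) → dot cs ρ ≡ + 0
  dot-zero []  []      _ = refl
  dot-zero (+ 0 ∷ cs)      (x ∷ ρ) t = trans (cong (λ z → + 0 ℤ.* x ℤ.+ z) (dot-zero cs ρ t)) (lemma x)
    where
    lemma : ∀ x → + 0 ℤ.* x ℤ.+ + 0 ≡ + 0
    lemma = ℤ-solve-∀

  absurd-sound : ∀ {n} (l : Lin (suc n)) ρ → T (absurd l) → Sat (+ 1 ∷ ρ) l → ⊥
  absurd-sound (-[1+ k ] ∷ cs) ρ t s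
    with subst (+ 0 ℤ.≤_) (trans (cong (λ z → -[1+ k ] ℤ.* + 1 ℤ.+ z) (dot-zero cs ρ t)) (lemma -[1+ k ])) s
    where
    lemma : ∀ x → x ℤ.* + 1 ℤ.+ + 0 ≡ x
    lemma = ℤ-solve-∀
  ... | ()

  -- The number of resolvents that eliminating `i` creates. Choosing the least one at each stage
  -- curbs the growth of Fourier-Motzkin elimination.
  weight : ∀ {n} → Fin n → List (Lin n) → ℕ
  weight i ls = go (classify i ls)
    where
    go : Split _ → ℕ
    go (split ps ns zs) = L.length ps ℕ.* L.length ns

  cheapest : ∀ {n} → Fin n → List (Fin n) → List (Lin n) → Fin n × List (Fin n)
  cheapest i []  ls = i , []
  cheapest i (j ∷ js) ls with cheapest j js ls
  ... | k , rest = if weight i ls ℕ.≤ᵇ weight k ls then (i , k ∷ rest) else (k , i ∷ rest)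

  refute : ∀ {n} → ℕ → List (Fin n) → List (Lin (suc n)) → Bool
  refute zero  is ls = L.foldr (λ l b → absurd l ∨ b) false ls
  refute (suc fuel) [] ls = L.foldr (λ l b → absurd l ∨ b) false ls
  refute (suc fuel) (i ∷ is) ls with cheapest (suc i) (L.map suc is) ls
  ... | k , _ with L.filter (λ j → ¬? (suc j F.≟ k)) (i ∷ is)
  ... | rest = refute fuel rest (eliminate k ls)

  any-absurd-sound : ∀ {n} (ls : List (Lin (suc n))) ρ →
    T (L.foldr (λ l b → absurd l ∨ b) false ls) → All (Sat (+ 1 ∷ ρ)) ls → ⊥
  any-absurd-sound (l ∷ ls) ρ t (x ∷ xs) with absurd l in eq
  ... | true  = absurd-sound l ρ (subst T (sym eq) tt) x
  ... | false = any-absurd-sound ls ρ t xs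

  refute-sound : ∀ {n} fuel is (ls : List (Lin (suc n))) ρ → T (refute fuel is ls) → All (Sat (+ 1 ∷ ρ)) ls → ⊥
  refute-sound zero  is ls ρ t xs = any-absurd-sound ls ρ t xs
  refute-sound (suc fuel) [] ls ρ t xs = any-absurd-sound ls ρ t xs
  refute-sound (suc fuel) (i ∷ is) ls ρ t xs =
    refute-sound fuel _ (eliminate _ ls) ρ t (eliminate-sat _ ls xs)

  -- Expressions, formulas and their translation into linear constraints

  infixl 7 _:*_ _:⊓_
  infixl 6 _:+_ _:∸_
  infix  4 _:≤_ _:<_ _:≡_
  infixr 2 _:⇒_

  data Expr (n : ℕ) : Set where
    var  : Fin n → Expr n
    con  : ℕ → Expr n
    _:+_ _:∸_ _:⊓_ : Expr n → Expr n → Expr n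
    _:*_ : ℕ → Expr n → Expr n

  ⟦_⟧ᵉ : ∀ {n} → Expr n → Vec ℕ n → ℕ
  ⟦ var i ⟧ᵉ ρ  = lookup ρ i
  ⟦ con k ⟧ᵉ ρ  = k
  ⟦ a :+ b ⟧ᵉ ρ = ⟦ a ⟧ᵉ ρ ℕ.+ ⟦ b ⟧ᵉ ρ
  ⟦ a :∸ b ⟧ᵉ ρ = ⟦ a ⟧ᵉ ρ ∸ ⟦ b ⟧ᵉ ρ
  ⟦ a :⊓ b ⟧ᵉ ρ = ⟦ a ⟧ᵉ ρ ⊓ ⟦ b ⟧ᵉ ρ
  ⟦ k :* a ⟧ᵉ ρ = k ℕ.* ⟦ a ⟧ᵉ ρ

  data Formula (n : ℕ) : Set where
    _:≤_ _:<_ _:≡_ : Expr n → Expr n → Formula n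
    :⊥   : Formula n
    _:⇒_ : Formula n → Formula n → Formula n

  ⟦_⟧ᶠ : ∀ {n} → Formula n → Vec ℕ n → Set
  ⟦ a :≤ b ⟧ᶠ ρ = ⟦ a ⟧ᵉ ρ ≤ ⟦ b ⟧ᵉ ρ
  ⟦ a :< b ⟧ᶠ ρ = ⟦ a ⟧ᵉ ρ < ⟦ b ⟧ᵉ ρ
  ⟦ a :≡ b ⟧ᶠ ρ = ⟦ a ⟧ᵉ ρ ≡ ⟦ b ⟧ᵉ ρ
  ⟦ :⊥ ⟧ᶠ ρ     = ⊥
  ⟦ φ :⇒ ψ ⟧ᶠ ρ = ⟦ φ ⟧ᶠ ρ → ⟦ ψ ⟧ᶠ ρ

  Env : ∀ {n} → Vec ℕ n → Vec ℤ (suc n)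
  Env ρ = + 1 ∷ V.map +_ ρ

  constant : ∀ {n} → ℤ → Lin (suc n)
  constant c = c ∷ V.replicate _ (+ 0)

  unit : ∀ {n} → Fin n → Lin n
  unit zero    = + 1 ∷ V.replicate _ (+ 0)
  unit (suc i) = + 0 ∷ unit i

  add sub : ∀ {n} → Lin n → Lin n → Lin n
  add = V.zipWith ℤ._+_
  sub = V.zipWith ℤ._-_

  scale : ∀ {n} → ℕ → Lin n → Lin n
  scale k = V.map (+ k ℤ.*_)

  dot-replicate : ∀ {n} (ρ : Vec ℤ n) → dot (V.replicate n (+ 0)) ρ ≡ + 0
  dot-replicate []      = refl
  dot-replicate (x ∷ ρ) = trans (cong (λ z → + 0 ℤ.* x ℤ.+ z) (dot-replicate ρ)) (lemma x)
    where
    lemma : ∀ x → + 0 ℤ.* x ℤ.+ + 0 ≡ + 0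
    lemma = ℤ-solve-∀

  dot-constant : ∀ {n} c (ρ : Vec ℕ n) → dot (constant c) (Env ρ) ≡ c
  dot-constant c ρ = trans (cong (λ z → c ℤ.* + 1 ℤ.+ z) (dot-replicate (V.map +_ ρ))) (lemma c)
    where
    lemma : ∀ x → x ℤ.* + 1 ℤ.+ + 0 ≡ x
    lemma = ℤ-solve-∀

  dot-unit : ∀ {n} (i : Fin n) ρ → dot (unit i) ρ ≡ lookup ρ i
  dot-unit zero    (x ∷ ρ) = trans (cong (λ z → + 1 ℤ.* x ℤ.+ z) (dot-replicate ρ)) (lemma x)
    where
    lemma : ∀ x → + 1 ℤ.* x ℤ.+ + 0 ≡ x
    lemma = ℤ-solve-∀
  dot-unit (suc i) (x ∷ ρ) = trans (cong (λ z → + 0 ℤ.* x ℤ.+ z) (dot-unit i ρ)) (lemma x (lookup ρ i))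
    where
    lemma : ∀ x y → + 0 ℤ.* x ℤ.+ y ≡ y
    lemma = ℤ-solve-∀

  dot-add : ∀ {n} (a b : Lin n) ρ → dot (add a b) ρ ≡ dot a ρ ℤ.+ dot b ρ
  dot-add []  []  []      = refl
  dot-add (a ∷ as) (b ∷ bs) (x ∷ ρ) =
    trans (cong (λ z → (a ℤ.+ b) ℤ.* x ℤ.+ z) (dot-add as bs ρ)) (lemma a b x (dot as ρ) (dot bs ρ))
    where
    lemma : ∀ a b x p q → (a ℤ.+ b) ℤ.* x ℤ.+ (p ℤ.+ q) ≡ (a ℤ.* x ℤ.+ p) ℤ.+ (b ℤ.* x ℤ.+ q)
    lemma = ℤ-solve-∀

  dot-sub : ∀ {n} (a b : Lin n) ρ → dot (sub a b) ρ ≡ dot a ρ ℤ.- dot b ρ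
  dot-sub []  []  []      = refl
  dot-sub (a ∷ as) (b ∷ bs) (x ∷ ρ) =
    trans (cong (λ z → (a ℤ.- b) ℤ.* x ℤ.+ z) (dot-sub as bs ρ)) (lemma a b x (dot as ρ) (dot bs ρ))
    where
    lemma : ∀ a b x p q → (a ℤ.- b) ℤ.* x ℤ.+ (p ℤ.- q) ≡ (a ℤ.* x ℤ.+ p) ℤ.- (b ℤ.* x ℤ.+ q)
    lemma = ℤ-solve-∀

  dot-scale : ∀ {n} k (a : Lin n) ρ → dot (scale k a) ρ ≡ + k ℤ.* dot a ρ
  dot-scale k []  []      = lemma (+ k)
    where
    lemma : ∀ k → + 0 ≡ k ℤ.* + 0
    lemma = ℤ-solve-∀
  dot-scale k (a ∷ as) (x ∷ ρ) =
    trans (cong (λ z → + k ℤ.* a ℤ.* x ℤ.+ z) (dot-scale k as ρ)) (lemma (+ k) a x (dot as ρ))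
    where
    lemma : ∀ k a x p → k ℤ.* a ℤ.* x ℤ.+ k ℤ.* p ≡ k ℤ.* (a ℤ.* x ℤ.+ p)
    lemma = ℤ-solve-∀

  -- An expression with ⊓ and ∸ is piecewise linear: a branch is a linear form and the
  -- inequalities under which it is the value.
  Branch : ℕ → Set
  Branch n = Lin n × List (Lin n)

  leq : ∀ {n} → Lin n → Lin n → Lin n
  leq a b = sub b a

  splitMin splitMonus splitAdd : ∀ {n} → Branch (suc n) → Branch (suc n) → List (Branch (suc n))
  splitMin   (a , as) (b , bs) = (a , leq a b ∷ as ++ bs) ∷ (b , leq b a ∷ as ++ bs) ∷ []
  splitMonus (a , as) (b , bs) = (sub a b , leq b a ∷ as ++ bs) ∷ (constant (+ 0) , leq a b ∷ as ++ bs) ∷ []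
  splitAdd   (a , as) (b , bs) = (add a b , as ++ bs) ∷ []

  cross : ∀ {A B C : Set} → (A → B → List C) → List A → List B → List C
  cross f as bs = concatMap (λ a → concatMap (f a) bs) as

  branches : ∀ {n} → Expr n → List (Branch (suc n))
  branches (var i)  = (unit (suc i) , []) ∷ []
  branches (con k)  = (constant (+ k) , []) ∷ []
  branches (a :+ b) = cross splitAdd (branches a) (branches b)
  branches (a :∸ b) = cross splitMonus (branches a) (branches b)
  branches (a :⊓ b) = cross splitMin (branches a) (branches b)
  branches (k :* a) = L.map (λ { (l , gs) → scale k l , gs }) (branches a)

  Valid : ∀ {n} → Vec ℤ n → ℕ → Branch n → Set
  Valid ρ v (l , gs) = dot l ρ ≡ + v × All (Sat ρ) gs

  any-concatMap : ∀ {A B : Set} {P : A → Set} {Q : B → Set} (f : A → List B) →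
    (∀ a → P a → Any Q (f a)) → ∀ {as} → Any P as → Any Q (concatMap f as)
  any-concatMap f h (here {x = a} p) = AnyP.++⁺ˡ (h a p)
  any-concatMap f h {a ∷ _} (there p) = AnyP.++⁺ʳ (f a) (any-concatMap f h p)

  any-cross : ∀ {A B C : Set} {P : A → Set} {Q : B → Set} {R : C → Set} (f : A → B → List C) →
    (∀ a b → P a → Q b → Any R (f a b)) → ∀ {as bs} → Any P as → Any Q bs → Any R (cross f as bs)
  any-cross f h p q = any-concatMap _ (λ a pa → any-concatMap (f a) (λ b → h a b pa) q) p

  leq-sat : ∀ {n} {a b : Lin n} {ρ x y} → dot a ρ ≡ + x → dot b ρ ≡ + y → x ≤ y → Sat ρ (leq a b)
  leq-sat {a = a} {b} {ρ} p q x≤y = subst (+ 0 ℤ.≤_)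
    (sym (trans (dot-sub b a ρ) (cong₂ ℤ._-_ q p))) (ℤP.i≤j⇒0≤j-i (ℤ.+≤+ x≤y))

  pos-∸ : ∀ {x y} → y ≤ x → + x ℤ.- + y ≡ + (x ∸ y)
  pos-∸ {x} {y} y≤x = trans (ℤP.m-n≡m⊖n x y) (ℤP.⊖-≥ y≤x)

  branches-sound : ∀ {n} (e : Expr n) ρ → Any (Valid (Env ρ) (⟦ e ⟧ᵉ ρ)) (branches e)
  branches-sound (var i)  ρ = here (trans (dot-unit (suc i) (Env ρ)) (VP.lookup-map i +_ ρ) , [])
  branches-sound (con k)  ρ = here (dot-constant (+ k) ρ , [])
  branches-sound (a :+ b) ρ = any-cross splitAdd
    (λ { (l , _) (m , _) (p , ps) (q , qs) → here (trans (dot-add l m (Env ρ)) (cong₂ ℤ._+_ p q) , AllP.++⁺ ps qs) })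
    (branches-sound a ρ) (branches-sound b ρ)
  branches-sound (a :∸ b) ρ = any-cross splitMonus go (branches-sound a ρ) (branches-sound b ρ)
    where
    go : ∀ x y → _ → _ → _
    go (l , ls) (m , ms) (p , ps) (q , qs) with ℕP.≤-total (⟦ b ⟧ᵉ ρ) (⟦ a ⟧ᵉ ρ)
    ... | inj₁ b≤a = here (trans (dot-sub l m (Env ρ)) (trans (cong₂ ℤ._-_ p q) (pos-∸ b≤a)) ,
                           leq-sat {a = m} {l} {Env ρ} q p b≤a ∷ AllP.++⁺ ps qs)
    ... | inj₂ a≤b = there (here (trans (dot-constant (+ 0) ρ) (cong +_ (sym (ℕP.m≤n⇒m∸n≡0 a≤b))) ,
                           leq-sat {a = l} {m} {Env ρ} p q a≤b ∷ AllP.++⁺ ps qs))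
  branches-sound (a :⊓ b) ρ = any-cross splitMin go (branches-sound a ρ) (branches-sound b ρ)
    where
    go : ∀ x y → _ → _ → _
    go (l , ls) (m , ms) (p , ps) (q , qs) with ℕP.≤-total (⟦ a ⟧ᵉ ρ) (⟦ b ⟧ᵉ ρ)
    ... | inj₁ a≤b = here (trans p (cong +_ (sym (ℕP.m≤n⇒m⊓n≡m a≤b))) ,
                           leq-sat {a = l} {m} {Env ρ} p q a≤b ∷ AllP.++⁺ ps qs)
    ... | inj₂ b≤a = there (here (trans q (cong +_ (sym (ℕP.m≥n⇒m⊓n≡n b≤a))) ,
                           leq-sat {a = m} {l} {Env ρ} q p b≤a ∷ AllP.++⁺ ps qs))
  branches-sound (k :* a) ρ = go (branches-sound a ρ)
    where
    go : ∀ {bs} → Any (Valid (Env ρ) (⟦ a ⟧ᵉ ρ)) bs →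
         Any (Valid (Env ρ) (k ℕ.* ⟦ a ⟧ᵉ ρ)) (L.map (λ { (l , gs) → scale k l , gs }) bs)
    go (here {x = l , _} (p , ps)) = here (trans (dot-scale k l (Env ρ))
      (trans (cong (+ k ℤ.*_) p) (sym (ℤP.pos-* k (⟦ a ⟧ᵉ ρ)))) , ps)
    go (there p) = there (go p)

  DNF : ℕ → Set
  DNF n = List (List (Lin n))

  Holds : ∀ {n} → Vec ℤ n → DNF n → Set
  Holds ρ = Any (All (Sat ρ))

  lessEq equal : ∀ {n} → Expr n → Expr n → DNF (suc n)
  lessEq a b = cross (λ { (l , ls) (m , ms) → (leq l m ∷ ls ++ ms) ∷ [] }) (branches a) (branches b)
  equal a b = cross (λ { (l , ls) (m , ms) → (leq l m ∷ leq m l ∷ ls ++ ms) ∷ [] }) (branches a) (branches b)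

  lessEq-sound : ∀ {n} (a b : Expr n) ρ → ⟦ a ⟧ᵉ ρ ≤ ⟦ b ⟧ᵉ ρ → Holds (Env ρ) (lessEq a b)
  lessEq-sound a b ρ a≤b = any-cross _
    (λ { (l , _) (m , _) (p , ps) (q , qs) → here (leq-sat {a = l} {m} {Env ρ} p q a≤b ∷ AllP.++⁺ ps qs) })
    (branches-sound a ρ) (branches-sound b ρ)

  equal-sound : ∀ {n} (a b : Expr n) ρ → ⟦ a ⟧ᵉ ρ ≡ ⟦ b ⟧ᵉ ρ → Holds (Env ρ) (equal a b)
  equal-sound a b ρ a≡b = any-cross _
    (λ { (l , _) (m , _) (p , ps) (q , qs) →
         here (leq-sat {a = l} {m} {Env ρ} p q (≤-reflexive a≡b) ∷
               leq-sat {a = m} {l} {Env ρ} q p (≤-reflexive (sym a≡b)) ∷ AllP.++⁺ ps qs) })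
    (branches-sound a ρ) (branches-sound b ρ)

  -- an implication used as a hypothesis carries no linear information
  hypothesis : ∀ {n} → Formula n → DNF (suc n)
  hypothesis (a :≤ b) = lessEq a b
  hypothesis (a :< b) = lessEq (con 1 :+ a) b
  hypothesis (a :≡ b) = equal a b
  hypothesis :⊥  = []
  hypothesis (φ :⇒ ψ) = [] ∷ []

  hypothesis-sound : ∀ {n} (φ : Formula n) ρ → ⟦ φ ⟧ᶠ ρ → Holds (Env ρ) (hypothesis φ)
  hypothesis-sound (a :≤ b) ρ h = lessEq-sound a b ρ h
  hypothesis-sound (a :< b) ρ h = lessEq-sound (con 1 :+ a) b ρ h
  hypothesis-sound (a :≡ b) ρ h = equal-sound a b ρ h
  hypothesis-sound (φ :⇒ ψ) ρ h = here []

  conj : ∀ {n} → DNF n → DNF n → DNF n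
  conj = cross (λ xs ys → (xs ++ ys) ∷ [])

  conj-sound : ∀ {n} {ρ : Vec ℤ n} {d e} → Holds ρ d → Holds ρ e → Holds ρ (conj d e)
  conj-sound = any-cross _ (λ _ _ p q → here (AllP.++⁺ p q))

  refuteAll : ∀ {n} → DNF (suc n) → Bool
  refuteAll {n} []  = true
  refuteAll {n} (c ∷ cs) = refute n (L.allFin n) c ∧ refuteAll cs

  refuteAll-sound : ∀ {n} (d : DNF (suc n)) ρ → T (refuteAll d) → Holds (Env ρ) d → ⊥
  refuteAll-sound {n} (c ∷ cs) ρ t h with refute n (L.allFin n) c in eq
  refuteAll-sound {n} (c ∷ cs) ρ t (here p)  | true = refute-sound n (L.allFin n) c (V.map +_ ρ) (subst T (sym eq) tt) p
  refuteAll-sound {n} (c ∷ cs) ρ t (there p) | true = refuteAll-sound cs ρ t p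

  -- The negated goal is refuted together with the hypotheses. Integrality enters only in turning
  -- strict inequalities into `1 + a ≤ b`; the elimination itself is rational.
  prove : ∀ {n} → DNF (suc n) → Formula n → Bool
  prove d (a :≤ b) = refuteAll (conj (lessEq (con 1 :+ b) a) d)
  prove d (a :< b) = refuteAll (conj (lessEq b a) d)
  prove d (a :≡ b) = refuteAll (conj (lessEq (con 1 :+ b) a) d) ∧ refuteAll (conj (lessEq (con 1 :+ a) b) d)
  prove d :⊥  = refuteAll d
  prove d (φ :⇒ ψ) = prove (conj (hypothesis φ) d) ψ

  T-∧ : ∀ {a b} → T (a ∧ b) → T a × T b
  T-∧ {true} t = tt , t

  refute-> : ∀ {n} (d : DNF (suc n)) a b ρ → T (refuteAll (conj (lessEq (con 1 :+ b) a) d)) →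
    Holds (Env ρ) d → ⟦ a ⟧ᵉ ρ ≤ ⟦ b ⟧ᵉ ρ
  refute-> d a b ρ t h = ℕP.≮⇒≥ λ b<a →
    refuteAll-sound (conj (lessEq (con 1 :+ b) a) d) ρ t (conj-sound (lessEq-sound (con 1 :+ b) a ρ b<a) h)

  prove-sound : ∀ {n} d (φ : Formula n) ρ → T (prove d φ) → Holds (Env ρ) d → ⟦ φ ⟧ᶠ ρ
  prove-sound d (a :≤ b) ρ t h = refute-> d a b ρ t h
  prove-sound d (a :< b) ρ t h = ℕP.≰⇒> λ b≤a →
    refuteAll-sound (conj (lessEq b a) d) ρ t (conj-sound (lessEq-sound b a ρ b≤a) h)
  prove-sound d (a :≡ b) ρ t h with T-∧ {refuteAll (conj (lessEq (con 1 :+ b) a) d)} t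
  ... | t₁ , t₂ = ℕP.≤-antisym (refute-> d a b ρ t₁ h) (refute-> d b a ρ t₂ h)
  prove-sound d :⊥  ρ t h = refuteAll-sound d ρ t h
  prove-sound d (φ :⇒ ψ) ρ t h x = prove-sound _ ψ ρ t (conj-sound (hypothesis-sound φ ρ x) h)

  nonNegative : ∀ {n} → List (Lin (suc n))
  nonNegative {n} = L.map (λ i → unit (suc i)) (L.allFin n)

  nonNegative-sound : ∀ {n} (ρ : Vec ℕ n) → All (Sat (Env ρ)) nonNegative
  nonNegative-sound {n} ρ = AllP.map⁺ (All.universal (λ i → go i) (L.allFin n))
    where
    go : ∀ i → Sat (Env ρ) (unit (suc i))
    go i = subst (+ 0 ℤ.≤_) (sym (trans (dot-unit (suc i) (Env ρ)) (VP.lookup-map i +_ ρ))) (ℤ.+≤+ z≤n)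

  vars : ∀ n → Vec (Expr n) n
  vars n = V.tabulate var

  -- The hidden argument is inhabited as soon as `prove` evaluates to `true`, so every use is
  -- settled by computation. Terms that are not linear, such as sums, are passed as further
  -- variables.
  lia : ∀ {n} (ρ : Vec ℕ n) (f : N-ary n (Expr n) (Formula n)) →
    {_ : T (prove (nonNegative ∷ []) (f $ⁿ vars n))} → ⟦ f $ⁿ vars n ⟧ᶠ ρ
  lia {n} ρ f {t} = prove-sound _ (f $ⁿ vars n) ρ t (here (nonNegative-sound ρ))

open LinearArithmetic using (lia; con; _:+_; _:*_; _:∸_; _:⊓_; _:≤_; _:<_; _:≡_; :⊥; _:⇒_)

-- Distances and transmissions

sum-mono-< : ∀ {n} {f g : Fin n → ℕ} → (∀ i → f i ≤ g i) → ∀ j → f j < g j → sum f < sum g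
sum-mono-< f≤g zero    lt = ℕP.+-mono-<-≤ lt (sum-mono (f≤g ∘ suc))
sum-mono-< f≤g (suc j) lt = ℕP.+-mono-≤-< (f≤g zero) (sum-mono-< (f≤g ∘ suc) j lt)

true≢false : true ≢ false
true≢false ()

𝟙≤1 : ∀ b → 𝟙 b ≤ 1
𝟙≤1 true  = s≤s z≤n
𝟙≤1 false = z≤n

any-intro : ∀ {n} (p : Fin n → Bool) w → p w ≡ true → any p (L.allFin n) ≡ true
any-intro p w pw = Equivalence.to BP.T-≡ (any⁺ p (lose (∈-allFin w) (Equivalence.from BP.T-≡ pw)))

any-elim : ∀ {n} (p : Fin n → Bool) → any p (L.allFin n) ≡ true → ∃ λ w → p w ≡ true
any-elim {n} p h with find (any⁻ p (L.allFin n) (Equivalence.from BP.T-≡ h))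
... | w , _ , pw = w , Equivalence.to BP.T-≡ pw

module _ {n} (G : Graph n) where

  reach-refl : ∀ i → reachIn G 0 i i ≡ true
  reach-refl i = Equivalence.to BP.T-≡ (ℕP.≡⇒≡ᵇ (toℕ i) (toℕ i) refl)

  reach-zero : ∀ i j → reachIn G 0 i j ≡ true → i ≡ j
  reach-zero i j h = FP.toℕ-injective (ℕP.≡ᵇ⇒≡ (toℕ i) (toℕ j) (Equivalence.from BP.T-≡ h))

  reach-weaken : ∀ k {i j} → reachIn G k i j ≡ true → reachIn G (suc k) i j ≡ true
  reach-weaken k h rewrite h = refl

  reach-step : ∀ k {i} w {j} → reachIn G k i w ≡ true → G w j ≡ true → reachIn G (suc k) i j ≡ true
  reach-step k {i} w {j} h e
    rewrite any-intro (λ w → reachIn G k i w ∧ G w j) w (cong₂ _∧_ h e) = BP.∨-zeroʳ (reachIn G k i j)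

  reach-unstep : ∀ k {i j} → reachIn G (suc k) i j ≡ true →
    reachIn G k i j ≡ true ⊎ ∃ λ w → reachIn G k i w ≡ true × G w j ≡ true
  reach-unstep k {i} {j} h with reachIn G k i j
  ... | true  = inj₁ refl
  ... | false with any-elim (λ w → reachIn G k i w ∧ G w j) h
  ...   | w , p with reachIn G k i w in eq | G w j in eq′
  ...     | true | true = inj₂ (w , eq , eq′)

  reach-lipschitz : ∀ {f : Fin n → ℕ} → (∀ u v → G u v ≡ true → f v ≤ suc (f u)) →
    ∀ k {u v} → reachIn G k u v ≡ true → f v ≤ k + f u
  reach-lipschitz lip zero {u} {v} h rewrite reach-zero u v h = ≤-refl
  reach-lipschitz lip (suc k) {u} {v} h with reach-unstep k h
  ... | inj₁ h′  = m≤n⇒m≤1+n (reach-lipschitz lip k h′)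
  ... | inj₂ (w , h′ , e) = ≤-trans (lip w v e) (s≤s (reach-lipschitz lip k h′))

  reach-prepend : ∀ k {u} v {w} → G u v ≡ true → reachIn G k v w ≡ true → reachIn G (suc k) u w ≡ true
  reach-prepend zero    {u} v {w} e h rewrite reach-zero v w h = reach-step 0 {u} u (reach-refl u) e
  reach-prepend (suc k) {u} v {w} e h with reach-unstep k h
  ... | inj₁ h′  = reach-weaken (suc k) (reach-prepend k v e h′)
  ... | inj₂ (x , h′ , e′) = reach-step (suc k) x (reach-prepend k v e h′) e′

  reach-closed : (P : Fin n → Set) → (∀ u v → G u v ≡ true → P u → P v) → ∀ k {u v} → reachIn G k u v ≡ true → P u → P v
  reach-closed P cl zero    {u} {v} h pu rewrite reach-zero u v h = pu
  reach-closed P cl (suc k) {u} {v} h pu with reach-unstep k h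
  ... | inj₁ h′  = reach-closed P cl k h′ pu
  ... | inj₂ (w , h′ , e) = cl w v e (reach-closed P cl k h′ pu)

  distFrom-reach : ∀ {i j} m → reachIn G m i j ≡ true → ∀ k fuel → k ≤ m → m < k + fuel →
    reachIn G (distFrom G k fuel i j) i j ≡ true
  distFrom-reach m h k zero k≤m m<k = ⊥-elim (lia (k ∷ m ∷ []) (λ k m → k :≤ m :⇒ m :< k :+ con 0 :⇒ :⊥) k≤m m<k)
  distFrom-reach {i} {j} m h k (suc fuel) k≤m m<k with reachIn G k i j in eq
  ... | true  = eq
  ... | false = distFrom-reach m h (suc k) fuel (ℕP.≤∧≢⇒< k≤m λ { refl → true≢false (trans (sym h) eq) })
                  (subst (m <_) (+-suc k fuel) m<k)

  distFrom-min : ∀ {i j} m → reachIn G m i j ≡ true → ∀ k fuel → k ≤ m → distFrom G k fuel i j ≤ m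
  distFrom-min m h k zero k≤m = k≤m
  distFrom-min {i} {j} m h k (suc fuel) k≤m with reachIn G k i j in eq
  ... | true  = k≤m
  ... | false = distFrom-min m h (suc k) fuel (ℕP.≤∧≢⇒< k≤m λ { refl → true≢false (trans (sym h) eq) })

edgeSum-mono : ∀ {n} (G : Graph n) {F F′ : Fin n → Fin n → ℕ} → (∀ u v → G u v ≡ true → F u v ≤ F′ u v) →
  edgeSum G F ≤ edgeSum G F′
edgeSum-mono G {F} {F′} h rewrite edgeSum-ordered G F | edgeSum-ordered G F′ =
  sum-mono λ i → sum-mono λ j → ℕP.*-monoʳ-≤ (𝟙 (does (toℕ i ℕ.<? toℕ j))) (go i j)
  where
  go : ∀ i j → 𝟙 (G i j) * F i j ≤ 𝟙 (G i j) * F′ i j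
  go i j with G i j in eq
  ... | true  = +-monoˡ-≤ 0 (h i j eq)
  ... | false = z≤n

edgeSum-cong : ∀ {n} (G : Graph n) {F F′ : Fin n → Fin n → ℕ} → (∀ u v → G u v ≡ true → F u v ≡ F′ u v) →
  edgeSum G F ≡ edgeSum G F′
edgeSum-cong G h = ℕP.≤-antisym (edgeSum-mono G λ u v e → ≤-reflexive (h u v e))
                                (edgeSum-mono G λ u v e → ≤-reflexive (sym (h u v e)))

edgeSum-+ : ∀ {n} (G : Graph n) (F F′ : Fin n → Fin n → ℕ) →
  edgeSum G (λ u v → F u v + F′ u v) ≡ edgeSum G F + edgeSum G F′
edgeSum-+ G F F′ = go (edges G)
  where
  lemma : ∀ a b c d → a + b + (c + d) ≡ (a + c) + (b + d)
  lemma = solve-∀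
  go : ∀ es → LA.sum (L.map (uncurry λ u v → F u v + F′ u v) es) ≡ LA.sum (L.map (uncurry F) es) + LA.sum (L.map (uncurry F′) es)
  go []  = refl
  go ((u , v) ∷ es) = trans (cong (F u v + F′ u v +_) (go es)) (lemma (F u v) (F′ u v) _ _)

edgeSum-const : ∀ {n} (G : Graph n) c → edgeSum G (λ _ _ → c) ≡ numEdges G * c
edgeSum-const G c = go (edges G)
  where
  go : ∀ es → LA.sum (L.map (uncurry λ _ _ → c) es) ≡ L.length es * c
  go []  = refl
  go (_ ∷ es) = cong (c +_) (go es)

module Metric {n} (G : Graph n) (simple : IsSimple G) (conn : Connected G) where

  d : Fin n → Fin n → ℕ
  d = dist G

  G-sym : ∀ {u v} → G u v ≡ true → G v u ≡ true
  G-sym {u} {v} e = trans (proj₁ simple v u) e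

  -- The ball around `i` gains a vertex with every increase of the radius until it is everything.
  -- Hence radius `n − 1` suffices and the search in `dist` never runs out of fuel.
  reach-count : ∀ i k → (∀ j → reachIn G k i j ≡ true) ⊎ suc k ≤ sum (λ j → 𝟙 (reachIn G k i j))
  reach-count i zero = inj₂ (≤-trans (≤-reflexive (sym (cong 𝟙 (reach-refl G i)))) (term≤sum (λ j → 𝟙 (reachIn G 0 i j)) i))
  reach-count i (suc k) with reach-count i k
  ... | inj₁ all = inj₁ (λ j → reach-weaken G k (all j))
  ... | inj₂ lb with FP.any? (λ j → T? (reachIn G (suc k) i j ∧ not (reachIn G k i j)))
  ...   | yes (j , new) = inj₂ (≤-trans (s≤s lb) (sum-mono-< grow j (strict j new)))
    where
    grow : ∀ j → 𝟙 (reachIn G k i j) ≤ 𝟙 (reachIn G (suc k) i j)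
    grow j with reachIn G k i j
    ... | true  = s≤s z≤n
    ... | false = z≤n
    strict : ∀ j → T (reachIn G (suc k) i j ∧ not (reachIn G k i j)) → 𝟙 (reachIn G k i j) < 𝟙 (reachIn G (suc k) i j)
    strict j = gain (reachIn G (suc k) i j) (reachIn G k i j)
      where
      gain : ∀ a b → T (a ∧ not b) → 𝟙 b < 𝟙 a
      gain true false _ = s≤s z≤n
  -- A ball that does not grow is closed under adjacency, so by connectedness it contains every
  -- vertex.
  ...   | no none = inj₁ (λ j → reach-weaken G k (stable (proj₁ (conn i j)) (proj₂ (conn i j))))
    where
    shrink : ∀ j → reachIn G (suc k) i j ≡ true → reachIn G k i j ≡ true
    shrink j h = lemma (reachIn G k i j) refl
      where
      lemma : ∀ b → reachIn G k i j ≡ b → b ≡ true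
      lemma true  _  = refl
      lemma false eq = ⊥-elim (none (j , subst T (sym (cong₂ (λ a b → a ∧ not b) h eq)) tt))
    start : ∀ k → reachIn G k i i ≡ true
    start zero    = reach-refl G i
    start (suc k) = reach-weaken G k (start k)
    stable : ∀ m {j} → reachIn G m i j ≡ true → reachIn G k i j ≡ true
    stable m h = reach-closed G (λ j → reachIn G k i j ≡ true) (λ u v e r → shrink v (reach-step G k u r e)) m h (start k)

  reach-bounded : ∀ i j → ∃ λ k → k < n × reachIn G k i j ≡ true
  reach-bounded i j = go n refl
    where
    go : ∀ m → m ≡ n → ∃ λ k → k < n × reachIn G k i j ≡ true
    go zero    m≡n = ⊥-elim (FP.¬Fin0 (subst Fin (sym m≡n) i))
    go (suc m) m≡n with reach-count i m
    ... | inj₁ all = m , ≤-reflexive m≡n , all j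
    ... | inj₂ lb with reachIn G m i j in eq
    ...   | true  = m , ≤-reflexive m≡n , eq
    ...   | false = ⊥-elim (ℕP.<⇒≱ (subst (sum (λ j → 𝟙 (reachIn G m i j)) <_) (trans (sum-const n 1) (*-identityʳ n))
              (sum-mono-< (λ j → 𝟙≤1 (reachIn G m i j)) j (subst (λ b → 𝟙 b < 1) (sym eq) (s≤s z≤n))))
              (≤-trans (≤-reflexive (sym m≡n)) lb))

  d-reach : ∀ u v → reachIn G (d u v) u v ≡ true
  d-reach u v with reach-bounded u v
  ... | k , k<n , h = distFrom-reach G k h 0 n z≤n k<n

  d-min : ∀ {u v} k → reachIn G k u v ≡ true → d u v ≤ k
  d-min k h = distFrom-min G k h 0 n z≤n

  d-refl : ∀ u → d u u ≡ 0
  d-refl u = ℕP.n≤0⇒n≡0 (d-min 0 (reach-refl G u))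

  Lipschitz : (Fin n → ℕ) → Set
  Lipschitz f = ∀ u v → G u v ≡ true → f v ≤ suc (f u)

  -- The source of the lower bounds on distances: a function that vanishes at `u` and grows by at
  -- most one along each edge stays below `d u`.
  d-lower : ∀ {f} → Lipschitz f → ∀ u v → f v ≤ d u v + f u
  d-lower lip u v = reach-lipschitz G lip (d u v) (d-reach u v)

  d-lipschitz : ∀ u → Lipschitz (d u)
  d-lipschitz u v w e = d-min (suc (d u v)) (reach-step G (d u v) v (d-reach u v) e)

  d-triangle : ∀ u v w → d u w ≤ d u v + d v w
  d-triangle u v w = ≤-trans (d-lower (d-lipschitz u) v w) (≤-reflexive (+-comm (d v w) (d u v)))

  d-prepend : ∀ u v w → G u v ≡ true → d u w ≤ suc (d v w)
  d-prepend u v w e = d-min (suc (d v w)) (reach-prepend G (d v w) v e (d-reach v w))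

  d-edge : ∀ {u v} → G u v ≡ true → d u v ≤ 1
  d-edge {u} {v} e = ≤-trans (d-prepend u v v e) (≤-reflexive (cong suc (d-refl v)))

  d-walk : ∀ {m} (p : ℕ → Fin n) → (∀ k → k < m → G (p k) (p (suc k)) ≡ true) → ∀ k t → k + t ≤ m → d (p k) (p (k + t)) ≤ t
  d-walk p adj k zero    h = ≤-reflexive (trans (cong (λ x → d (p k) (p x)) (+-identityʳ k)) (d-refl (p k)))
  d-walk p adj k (suc t) h = subst (λ x → d (p k) (p x) ≤ suc t) (sym (+-suc k t))
    (≤-trans (d-lipschitz (p k) (p (k + t)) (p (suc (k + t))) (adj (k + t) k+t<m)) (s≤s (d-walk p adj k t (<⇒≤ k+t<m))))
    where
    k+t<m : k + t < _
    k+t<m = ≤-trans (≤-reflexive (sym (+-suc k t))) h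

  d-sym : ∀ u v → d u v ≡ d v u
  d-sym u v = ℕP.≤-antisym (half u v) (half v u)
    where
    half : ∀ u v → d u v ≤ d v u
    half u v = subst (d u v ≤_) (trans (cong (d v u +_) (d-refl v)) (+-identityʳ _))
      (d-lower {λ x → d x v} (λ x y e → d-prepend y x v (G-sym e)) v u)

  closed : (P : Fin n → Set) → (∀ u v → G u v ≡ true → P u → P v) → ∀ {u} → P u → ∀ v → P v
  closed P cl {u} pu v = reach-closed G P cl (d u v) (d-reach u v) pu

  D : Fin n → ℕ
  D u = sum (d u)

  gap : Fin n → Fin n → ℕ
  gap u v = ∣ D u - D v ∣

  gap-sym : ∀ u v → gap u v ≡ gap v u
  gap-sym u v = ℕP.∣-∣-comm (D u) (D v)

  -- The distances from `u` and from `v` to a vertex differ by at most one, so `D u − D v` just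
  -- counts the vertices closer to `v` minus those closer to `u`. Both counts stand on the additive
  -- side to avoid subtraction.
  D-balance : ∀ u v → G u v ≡ true → D u + nU G u v ≡ D v + nU G v u
  D-balance u v e = begin
    D u + nU G u v  ≡⟨ cong (D u +_) (count-sum (λ w → d u w ℕ.<ᵇ d v w)) ⟩
    D u + sum (λ w → 𝟙 (d u w ℕ.<ᵇ d v w))  ≡⟨ ∑-distrib-+ (d u) (λ w → 𝟙 (d u w ℕ.<ᵇ d v w)) ⟨
    sum (λ w → d u w + 𝟙 (d u w ℕ.<ᵇ d v w))      ≡⟨ sum-cong-≗ pointwise ⟩
    sum (λ w → d v w + 𝟙 (d v w ℕ.<ᵇ d u w))      ≡⟨ ∑-distrib-+ (d v) (λ w → 𝟙 (d v w ℕ.<ᵇ d u w)) ⟩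
    D v + sum (λ w → 𝟙 (d v w ℕ.<ᵇ d u w))  ≡⟨ cong (D v +_) (count-sum (λ w → d v w ℕ.<ᵇ d u w)) ⟨
    D v + nU G v u  ∎
    where
    open ≡-Reasoning
    compare : ∀ a b → a ≤ suc b → b ≤ suc a → a + 𝟙 (a ℕ.<ᵇ b) ≡ b + 𝟙 (b ℕ.<ᵇ a)
    compare zero  zero  p q = refl
    compare zero  (suc zero)    p q = refl
    compare (suc zero)    zero  p q = refl
    compare (suc a)  (suc b)  (s≤s p) (s≤s q) = cong suc (compare a b p q)
    compare zero  (suc (suc b)) p (s≤s ())
    compare (suc (suc a)) zero  (s≤s ()) q
    pointwise : ∀ w → d u w + 𝟙 (d u w ℕ.<ᵇ d v w) ≡ d v w + 𝟙 (d v w ℕ.<ᵇ d u w)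
    pointwise w = compare (d u w) (d v w) (d-prepend u v w e) (d-prepend v u w (G-sym e))

  trichotomy-count : ∀ u v → nU G u v + nU G v u + n0 G u v ≡ n
  trichotomy-count u v = begin
    nU G u v + nU G v u + n0 G u v
      ≡⟨ cong₂ _+_ (cong₂ _+_ (count-sum (λ w → d u w ℕ.<ᵇ d v w)) (count-sum (λ w → d v w ℕ.<ᵇ d u w)))
                   (count-sum (λ w → d u w ℕ.≡ᵇ d v w)) ⟩
    sum a + sum b + sum c  ≡⟨ cong (_+ sum c) (∑-distrib-+ a b) ⟨
    sum (λ w → a w + b w) + sum c  ≡⟨ ∑-distrib-+ (λ w → a w + b w) c ⟨
    sum (λ w → a w + b w + c w)  ≡⟨ sum-cong-≗ (λ w → one (d u w) (d v w)) ⟩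
    sum {n} (λ _ → 1)  ≡⟨ sum-const n 1 ⟩
    n * 1  ≡⟨ *-identityʳ n ⟩
    n  ∎
    where
    open ≡-Reasoning
    a b c : Fin n → ℕ
    a w = 𝟙 (d u w ℕ.<ᵇ d v w)
    b w = 𝟙 (d v w ℕ.<ᵇ d u w)
    c w = 𝟙 (d u w ℕ.≡ᵇ d v w)
    one : ∀ x y → 𝟙 (x ℕ.<ᵇ y) + 𝟙 (y ℕ.<ᵇ x) + 𝟙 (x ℕ.≡ᵇ y) ≡ 1
    one zero    zero    = refl
    one zero    (suc y) = refl
    one (suc x) zero    = refl
    one (suc x) (suc y) = one x y

  -- The two factors of `szTerm` have sum `2n` and, by `D-balance`, difference `± 2 gap u v`; their
  -- product is therefore `n²` minus the square of the gap.
  szTerm-gap : ∀ u v → G u v ≡ true → szTerm G u v + gap u v * gap u v ≡ n * n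
  szTerm-gap u v e = subst (λ m → szTerm G u v + gap u v * gap u v ≡ m * m) (trichotomy-count u v)
    (go (D u) (D v) (nU G u v) (nU G v u) (n0 G u v) (D-balance u v e))
    where
    go : ∀ x y a b z → x + a ≡ y + b →
      (a + a + z) * (b + b + z) + ∣ x - y ∣ * ∣ x - y ∣ ≡ (a + b + z) * (a + b + z)
    go zero y a b z refl = lemma y b z
      where
      lemma : ∀ y b z → (y + b + (y + b) + z) * (b + b + z) + y * y ≡ (y + b + b + z) * (y + b + b + z)
      lemma = solve-∀
    go (suc x) zero a b z refl = lemma (suc x) a z
      where
      lemma : ∀ x a z → (a + a + z) * (x + a + (x + a) + z) + x * x ≡ (a + (x + a) + z) * (a + (x + a) + z)
      lemma = solve-∀
    go (suc x) (suc y) a b z eq = go x y a b z (ℕP.suc-injective eq)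

  S : ℕ
  S = edgeSum G (λ u v → gap u v * gap u v)

  szTerm-S : edgeSum G (szTerm G) + S ≡ numEdges G * (n * n)
  szTerm-S = begin
    edgeSum G (szTerm G) + S  ≡⟨ edgeSum-+ G (szTerm G) (λ u v → gap u v * gap u v) ⟨
    edgeSum G (λ u v → szTerm G u v + gap u v * gap u v)     ≡⟨ edgeSum-cong G szTerm-gap ⟩
    edgeSum G (λ _ _ → n * n)  ≡⟨ edgeSum-const G (n * n) ⟩
    numEdges G * (n * n)  ∎
    where open ≡-Reasoning

-- Degrees and leaves

two≤sum : ∀ {n} (f : Fin n → ℕ) {u v} → u ≢ v → f u + f v ≤ sum f
two≤sum f {u} {v} u≢v = begin
  f u + f v  ≡⟨ cong (λ b → f u + (if b then 0 else f v)) (sym (dec-false (v F.≟ u) (u≢v ∘ sym))) ⟩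
  f u + (if does (v F.≟ u) then 0 else f v)  ≤⟨ +-monoʳ-≤ (f u) (term≤sum (λ x → if does (x F.≟ u) then 0 else f x) v) ⟩
  f u + sum (λ x → if does (x F.≟ u) then 0 else f x)    ≡⟨ sum-without f u ⟨
  sum f  ∎
  where open ℕP.≤-Reasoning

sum-≡0 : ∀ {n} {f : Fin n → ℕ} → (∀ i → f i ≡ 0) → sum f ≡ 0
sum-≡0 {n} h = trans (sum-cong-≗ h) (trans (sum-const n 0) (ℕP.*-zeroʳ n))

sum-indicator : ∀ {n} (a : Fin n) → sum (λ u → 𝟙 (does (u F.≟ a))) ≡ 1
sum-indicator a = trans (sum-without (λ u → 𝟙 (does (u F.≟ a))) a)
  (cong₂ _+_ (cong 𝟙 (dec-true (a F.≟ a) refl)) (sum-≡0 vanish))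
  where
  vanish : ∀ u → (if does (u F.≟ a) then 0 else 𝟙 (does (u F.≟ a))) ≡ 0
  vanish u with does (u F.≟ a)
  ... | true  = refl
  ... | false = refl

deg : ∀ {n} → Graph n → Fin n → ℕ
deg G v = sum (λ u → 𝟙 (G v u))

module _ {n} (G : Graph n) where

  other-neighbour : ∀ {v} → 2 ≤ deg G v → ∀ a → ∃ λ u → u ≢ a × G v u ≡ true
  other-neighbour {v} 2≤deg a with FP.any? (λ u → T? (not (does (u F.≟ a)) ∧ G v u))
  ... | yes (u , t) = u , split (u F.≟ a) (G v u) t
    where
    split : (p : Dec (u ≡ a)) (b : Bool) → T (not (does p) ∧ b) → u ≢ a × b ≡ true
    split (no u≢a) true _ = u≢a , refl
  ... | no none = ⊥-elim (ℕP.<⇒≱ 2≤deg (begin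
    deg G v  ≡⟨ sum-without (λ u → 𝟙 (G v u)) a ⟩
    𝟙 (G v a) + sum (λ u → if does (u F.≟ a) then 0 else 𝟙 (G v u))  ≡⟨ cong (𝟙 (G v a) +_) (sum-≡0 vanish) ⟩
    𝟙 (G v a) + 0  ≤⟨ +-monoˡ-≤ 0 (𝟙≤1 (G v a)) ⟩
    1  ∎))
    where
    open ℕP.≤-Reasoning
    vanish : ∀ u → (if does (u F.≟ a) then 0 else 𝟙 (G v u)) ≡ 0
    vanish u = go (does (u F.≟ a)) (G v u) (λ t → none (u , t))
      where
      go : ∀ p b → ¬ T (not p ∧ b) → (if p then 0 else 𝟙 b) ≡ 0
      go true  b     _ = refl
      go false false _ = refl
      go false true  h = ⊥-elim (h tt)

  deg≤2 : ∀ {v} a b → (∀ u → G v u ≡ true → u ≡ a ⊎ u ≡ b) → deg G v ≤ 2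
  deg≤2 {v} a b h = begin
    deg G v  ≤⟨ sum-mono pointwise ⟩
    sum (λ u → 𝟙 (does (u F.≟ a)) + 𝟙 (does (u F.≟ b)))  ≡⟨ ∑-distrib-+ (λ u → 𝟙 (does (u F.≟ a))) (λ u → 𝟙 (does (u F.≟ b))) ⟩
    sum (λ u → 𝟙 (does (u F.≟ a))) + sum (λ u → 𝟙 (does (u F.≟ b)))  ≡⟨ cong₂ _+_ (sum-indicator a) (sum-indicator b) ⟩
    2  ∎
    where
    open ℕP.≤-Reasoning
    pointwise : ∀ u → 𝟙 (G v u) ≤ 𝟙 (does (u F.≟ a)) + 𝟙 (does (u F.≟ b))
    pointwise u with G v u in eq
    ... | false = z≤n
    ... | true with h u eq
    ...   | inj₁ refl rewrite dec-true (u F.≟ u) refl = s≤s z≤n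
    ...   | inj₂ refl rewrite dec-true (u F.≟ u) refl = ℕP.m≤n+m 1 (𝟙 (does (u F.≟ a)))

  deg≤1-unique : ∀ {v u x} → deg G v ≤ 1 → G v u ≡ true → G v x ≡ true → x ≡ u
  deg≤1-unique {v} {u} {x} deg≤1 e e′ with x F.≟ u
  ... | yes eq  = eq
  ... | no  x≢u = ⊥-elim (ℕP.<⇒≱ (≤-trans (≤-reflexive (cong₂ (λ a b → 𝟙 a + 𝟙 b) (sym e′) (sym e)))
                                     (two≤sum (λ w → 𝟙 (G v w)) x≢u)) deg≤1)

module _ {n} (G : Graph n) (simple : IsSimple G) where

  sum-deg : sum (deg G) ≡ numEdges G + numEdges G
  sum-deg = begin
    sum (deg G)  ≡⟨ sum-cong-≗ (λ v → sum-cong-≗ (λ u → sym (*-identityʳ (𝟙 (G v u))))) ⟩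
    sum (λ v → sum (λ u → 𝟙 (G v u) * 1))  ≡⟨ double-edgeSum G simple (λ _ _ → 1) (λ _ _ → refl) ⟩
    edgeSum G (λ _ _ → 1) + edgeSum G (λ _ _ → 1) ≡⟨ cong₂ _+_ (numEdges-edgeSum G) (numEdges-edgeSum G) ⟨
    numEdges G + numEdges G  ∎
    where open ≡-Reasoning

  edgeSum-edge : ∀ F → (∀ u v → F u v ≡ F v u) → ∀ {u v} → G u v ≡ true → F u v ≤ edgeSum G F
  edgeSum-edge F F-sym {u} {v} e = ℕP.≮⇒≥ λ lt → ℕP.<⇒≱ (ℕP.+-mono-< lt lt) (begin
    F u v + F u v  ≡⟨ cong (F u v +_) (F-sym u v) ⟩
    F u v + F v u  ≤⟨ +-mono-≤ (entry e) (entry (trans (proj₁ simple v u) e)) ⟩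
    sum (λ j → 𝟙 (G u j) * F u j) + sum (λ j → 𝟙 (G v j) * F v j)  ≤⟨ two≤sum (λ i → sum (λ j → 𝟙 (G i j) * F i j)) u≢v ⟩
    sum (λ i → sum (λ j → 𝟙 (G i j) * F i j))  ≡⟨ double-edgeSum G simple F F-sym ⟩
    edgeSum G F + edgeSum G F  ∎)
    where
    open ℕP.≤-Reasoning
    u≢v : u ≢ v
    u≢v refl with trans (sym e) (proj₂ simple u)
    ... | ()
    entry : ∀ {u v} → G u v ≡ true → F u v ≤ sum (λ j → 𝟙 (G u j) * F u j)
    entry {u} {v} e = ≤-trans (≤-reflexive (trans (sym (ℕP.*-identityˡ (F u v))) (cong (λ b → 𝟙 b * F u v) (sym e))))
      (term≤sum (λ j → 𝟙 (G u j) * F u j) v)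

square-bound : ∀ n x → 6 < n → n ≤ 2 + x → 2 + n ≤ x * x
square-bound n x 6<n n≤2+x = go x (lia (n ∷ x ∷ []) (λ n x → con 6 :< n :⇒ n :≤ con 2 :+ x :⇒ con 5 :≤ x) 6<n n≤2+x) n≤2+x
  where
  lemma : ∀ k → 9 + k + (16 + 9 * k + k * k) ≡ (5 + k) * (5 + k)
  lemma = solve-∀
  go : ∀ x → 5 ≤ x → n ≤ 2 + x → 2 + n ≤ x * x
  go x 5≤x n≤2+x with ℕP.m≤n⇒∃[o]m+o≡n 5≤x
  ... | k , refl = ≤-trans (+-monoʳ-≤ 2 n≤2+x) (≤-trans (m≤m+n (9 + k) (16 + 9 * k + k * k)) (≤-reflexive (lemma k)))

module Leaf {n} (G : Graph n) (simple : IsSimple G) (conn : Connected G) (6<n : 6 < n) where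
  open Metric G simple conn

  has-neighbour : ∀ v → ∃ λ u → G v u ≡ true
  has-neighbour v with FP.any? (λ u → G v u BP.≟ true)
  ... | yes h   = h
  ... | no none = ⊥-elim (two-vertices n 6<n v (closed (_≡ v) (λ { u x e refl → ⊥-elim (none (x , e)) }) refl))
    where
    two-vertices : ∀ n → 6 < n → (v : Fin n) → (∀ x → x ≡ v) → ⊥
    two-vertices (suc (suc n)) _ v h with trans (h zero) (sym (h (suc zero)))
    ... | ()
    two-vertices (suc zero) (s≤s ())

  -- Every walk that leaves the leaf `v` passes through its only neighbour `u`, so each vertex
  -- except `v` is farther from `v` than from `u` by at least one. The gap on `uv` is thus at least
  -- `n − 2`, and `6 < n` makes its square large enough.
  leaf-bound : ∀ v → deg G v ≤ 1 → 2 + n ≤ S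
  leaf-bound v deg≤1 with has-neighbour v
  ... | u , e = ≤-trans (square-bound n (gap v u) 6<n far) (edgeSum-edge G simple (λ x y → gap x y * gap x y)
                  (λ x y → cong₂ _*_ (gap-sym x y) (gap-sym x y)) e)
    where
    f : Fin n → ℕ
    f w = if does (w F.≟ v) then 0 else suc (d u w)
    f-lipschitz : Lipschitz f
    f-lipschitz a b e′ with b F.≟ v | a F.≟ v
    ... | yes _ | _  = z≤n
    ... | no _  | no _     = s≤s (d-lipschitz u a b e′)
    ... | no _  | yes refl rewrite deg≤1-unique G deg≤1 e e′ | d-refl u = s≤s z≤n
    f≤d : ∀ w → f w ≤ d v w
    f≤d w = ≤-trans (d-lower f-lipschitz v w)
      (≤-reflexive (trans (cong (λ b → d v w + (if b then 0 else suc (d u v))) (dec-true (v F.≟ v) refl)) (+-identityʳ _)))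
    drop : n + D u ≤ 2 + D v
    drop = begin
      n + D u  ≡⟨ cong (_+ D u) (trans (sum-const n 1) (*-identityʳ n)) ⟨
      sum {n} (λ _ → 1) + D u  ≡⟨ ∑-distrib-+ (λ _ → 1) (d u) ⟨
      -- The deficit of `2` comes from the leaf itself: its term is at most `2` here, while `f`
      -- vanishes there.
      sum (λ w → suc (d u w))  ≡⟨ sum-without (λ w → suc (d u w)) v ⟩
      suc (d u v) + sum f  ≤⟨ +-mono-≤ (s≤s (d-edge (G-sym e))) (sum-mono f≤d) ⟩
      2 + D v  ∎
      where open ℕP.≤-Reasoning
    far : n ≤ 2 + gap v u
    far = lia (n ∷ D u ∷ D v ∷ gap v u ∷ []) (λ n Du Dv g → n :+ Du :≤ con 2 :+ Dv :⇒ Dv :≤ Du :+ g :⇒ n :≤ con 2 :+ g)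
            drop (ℕP.m≤n+∣m-n∣ (D v) (D u))

-- Spanning paths

module Paths {n} (G : Graph n) (simple : IsSimple G) where

  -- A path with m edges: its vertices are w 0, …, w m, the other values of w are junk.
  record Path (m : ℕ) : Set where
    field
      w   : ℕ → Fin n
      inj : InjectiveBelow (suc m) w
      adj : ∀ k → k < m → G (w k) (w (suc k)) ≡ true

  open Path public

  adj-sym : ∀ {u v} → G u v ≡ true → G v u ≡ true
  adj-sym {u} {v} e = trans (proj₁ simple v u) e

  irreflexive : ∀ {u v} → G u v ≡ true → u ≢ v
  irreflexive {u} e refl with trans (sym e) (proj₂ simple u)
  ... | ()

  OnPath : ∀ {m} → Path m → Fin n → Set
  OnPath {m} p v = ∃ λ k → k < suc m × w p k ≡ v

  onPath? : ∀ {m} (p : Path m) v → Dec (OnPath p v)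
  onPath? {m} p v = ℕP.anyUpTo? (λ k → w p k F.≟ v) (suc m)

  prepend : Fin n → (ℕ → Fin n) → ℕ → Fin n
  prepend u w zero    = u
  prepend u w (suc k) = w k

  prepend-inj : ∀ {m} (p : Path m) u → ¬ OnPath p u → InjectiveBelow (suc (suc m)) (prepend u (w p))
  prepend-inj p u off zero    zero    _  _  _  = refl
  prepend-inj p u off zero    (suc l) _  (s≤s l<m) eq = ⊥-elim (off (l , l<m , sym eq))
  prepend-inj p u off (suc k) zero    (s≤s k<m) _  eq = ⊥-elim (off (k , k<m , eq))
  prepend-inj p u off (suc k) (suc l) (s≤s k<m) (s≤s l<m) eq = cong suc (inj p k l k<m l<m eq)

  extend : ∀ {m} (p : Path m) u → ¬ OnPath p u → G (w p 0) u ≡ true → Path (suc m)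
  extend {m} p u off e = record { w = prepend u (w p) ; inj = prepend-inj p u off ; adj = adj′ }
    where
    adj′ : ∀ k → k < suc m → G (prepend u (w p) k) (w p k) ≡ true
    adj′ zero    _  = adj-sym e
    adj′ (suc k) (s≤s k<m) = adj p k k<m

  reverse : ∀ {m} → Path m → Path m
  reverse {m} p = record
    { w   = λ k → w p (m ∸ k)
    ; inj = λ k l k≤m l≤m eq → lia (k ∷ l ∷ m ∷ []) (λ k l m → k :< con 1 :+ m :⇒ l :< con 1 :+ m :⇒ m :∸ k :≡ m :∸ l :⇒ k :≡ l) k≤m l≤m
              (inj p (m ∸ k) (m ∸ l) (s≤s (m∸n≤m m k)) (s≤s (m∸n≤m m l)) eq)
    ; adj = λ k k<m → adj-sym (subst (λ x → G (w p (m ∸ suc k)) (w p x) ≡ true)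
              (lia (k ∷ m ∷ []) (λ k m → k :< m :⇒ con 1 :+ (m :∸ (con 1 :+ k)) :≡ m :∸ k) k<m)
              (adj p (m ∸ suc k) (lia (k ∷ m ∷ []) (λ k m → k :< m :⇒ m :∸ (con 1 :+ k) :< m) k<m)))
    }

  path-length : ∀ {m} → Path m → m < n
  path-length {m} p = subst₂ _≤_ (trans (∑<-const (suc m) 1) (*-identityʳ (suc m))) (trans (sum-const n 1) (*-identityʳ n))
    (∑<-injective-≤ (suc m) (w p) (inj p) (λ _ → 1))

  -- A path with one chord at each end. The inequalities keep the chords from being steps of the
  -- path, and `distinct` excludes `i = m` together with `j = 0`, where both chords would be the
  -- same edge. For `i ≤ j` the two cycles share at most a vertex; for `j < i` the result is a theta
  -- graph.
  record Lasso {m} (p : Path m) : Set where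
    field
      i j      : ℕ
      2≤i      : 2 ≤ i
      i≤m      : i ≤ m
      j+2≤m    : 2 + j ≤ m
      startEdge : G (w p 0) (w p i) ≡ true
      endEdge   : G (w p j) (w p m) ≡ true
      distinct : i < m ⊎ 0 < j

  module LassoEdges {m} {p : Path m} (lasso : Lasso p) where
    open Lasso lasso

    -- Abstract, so that the three decisions stay intact as terms that a `with` can match.
    abstract
      step? : ∀ (k l : ℕ) → Dec (suc k ≡ l)
      step? k l = suc k ℕ.≟ l
      start? : ∀ (k l : ℕ) → Dec (k ≡ 0 × l ≡ i)
      start? k l = (k ℕ.≟ 0) ×-dec (l ℕ.≟ i)
      end? : ∀ (k l : ℕ) → Dec (k ≡ j × l ≡ m)
      end? k l = (k ℕ.≟ j) ×-dec (l ℕ.≟ m)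

    ι : ℕ → ℕ → ℕ
    ι k l = 𝟙 (does (step? k l)) + 𝟙 (does (start? k l)) + 𝟙 (does (end? k l))

    e : ℕ → ℕ → ℕ
    e k l = 𝟙 (G (w p k) (w p l))

    -- The side conditions of a lasso rule out every coincidence among steps and chords, so a pair
    -- is listed at most once, and only in increasing order.
    ι-edge : ∀ k l → k ≤ m → l ≤ m → ι k l ≤ e k l × (0 < ι k l → k < l)
    ι-edge k l k≤m l≤m with step? k l | start? k l | end? k l
    ... | no _ | no _ | no _ = z≤n , λ ()
    ... | yes refl | no _ | no _ = ≤-reflexive (cong 𝟙 (sym (adj p k l≤m))) , λ _ → ≤-refl
    ... | no _ | yes (refl , refl) | no _ = ≤-reflexive (cong 𝟙 (sym startEdge)) , λ _ → ≤-trans (s≤s z≤n) 2≤i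
    ... | no _ | no _ | yes (refl , refl) = ≤-reflexive (cong 𝟙 (sym endEdge)) , λ _ → ≤-trans (n≤1+n (suc j)) j+2≤m
    ... | yes refl | yes (refl , 1≡i) | _ = ⊥-elim (lia (i ∷ []) (λ i → con 2 :≤ i :⇒ con 1 :≡ i :⇒ :⊥) 2≤i 1≡i)
    ... | yes refl | no _ | yes (refl , m≡) = ⊥-elim (lia (j ∷ m ∷ []) (λ j m → con 2 :+ j :≤ m :⇒ con 1 :+ j :≡ m :⇒ :⊥) j+2≤m m≡)
    ... | no _ | yes (refl , refl) | yes (0≡j , i≡m) with distinct
    ...   | inj₁ i<m = ⊥-elim (ℕP.<⇒≢ i<m i≡m)
    ...   | inj₂ 0<j = ⊥-elim (ℕP.<⇒≢ 0<j 0≡j)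

    -- Only one direction of a pair can be listed, so symmetrising still counts no edge twice.
    ι-both : ∀ k l → k ≤ m → l ≤ m → ι k l + ι l k ≤ e k l
    ι-both k l k≤m l≤m with ι k l in eq | ι-edge k l k≤m l≤m | ι l k in eq′ | ι-edge l k l≤m k≤m
    ... | zero  | _  | b     | h , _ = ≤-trans h (≤-reflexive (cong 𝟙 (proj₁ simple (w p l) (w p k))))
    ... | suc a | h , _   | zero  | _     = ≤-trans (≤-reflexive (+-identityʳ (suc a))) h
    ... | suc a | _ , k<l | suc b | _ , l<k = ⊥-elim (ℕP.<-asym (k<l (s≤s z≤n)) (l<k (s≤s z≤n)))

    module Weighted (F : Fin n → Fin n → ℕ) (F-sym : ∀ u v → F u v ≡ F v u) where

      φ : ℕ → ℕ → ℕ
      φ k l = F (w p k) (w p l)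

      total : ℕ
      total = ∑< m (λ k → φ k (suc k)) + φ 0 i + φ j m

      pick : ∀ {P : ℕ → ℕ → Set} (P? : ∀ k l → Dec (P k l)) k l → P k l → k ≤ m → l ≤ m →
        φ k l ≤ ∑< (suc m) (λ l → 𝟙 (does (P? k l)) * φ k l)
      pick P? k l h k≤m l≤m = ≤-trans
        (≤-reflexive (trans (sym (ℕP.*-identityˡ (φ k l))) (cong (λ b → 𝟙 b * φ k l) (sym (dec-true (P? k l) h)))))
        (∑<-term (suc m) (λ l → 𝟙 (does (P? k l)) * φ k l) l (s≤s l≤m))

      indicator : ∀ {P : ℕ → ℕ → Set} (P? : ∀ k l → Dec (P k l)) → ℕ → ℕ → ℕ
      indicator P? k l = 𝟙 (does (P? k l)) * φ k l

      total≤ : total ≤ ∑²< (suc m) (λ k l → ι k l * φ k l)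
      total≤ = begin
        ∑< m (λ k → φ k (suc k)) + φ 0 i + φ j m  ≤⟨ +-mono-≤ (+-mono-≤ steps starts) ends ⟩
        ∑²< (suc m) (indicator step?) + ∑²< (suc m) (indicator start?) + ∑²< (suc m) (indicator end?)
          ≡⟨ cong (_+ ∑²< (suc m) (indicator end?)) (∑²<-+ (suc m) (indicator step?) (indicator start?)) ⟨
        ∑²< (suc m) (λ k l → indicator step? k l + indicator start? k l) + ∑²< (suc m) (indicator end?)
          ≡⟨ ∑²<-+ (suc m) (λ k l → indicator step? k l + indicator start? k l) (indicator end?) ⟨
        ∑²< (suc m) (λ k l → indicator step? k l + indicator start? k l + indicator end? k l)
          ≡⟨ ∑²<-cong (suc m) (λ k l → lemma (𝟙 (does (step? k l))) (𝟙 (does (start? k l))) (𝟙 (does (end? k l))) (φ k l)) ⟩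
        ∑²< (suc m) (λ k l → ι k l * φ k l) ∎
        where
        open ℕP.≤-Reasoning
        row : ∀ {P : ℕ → ℕ → Set} (P? : ∀ k l → Dec (P k l)) → ℕ → ℕ
        row P? k = ∑< (suc m) (indicator P? k)
        steps : ∑< m (λ k → φ k (suc k)) ≤ ∑²< (suc m) (indicator step?)
        steps = ≤-trans (∑<-mono m (λ k k<m → pick step? k (suc k) refl (<⇒≤ k<m) k<m))
          (≤-trans (m≤m+n (∑< m (row step?)) (row step? m)) (≤-reflexive (sym (∑<-last m (row step?)))))
        starts : φ 0 i ≤ ∑²< (suc m) (indicator start?)
        starts = ≤-trans (pick start? 0 i (refl , refl) z≤n i≤m) (∑<-term (suc m) (row start?) 0 (s≤s z≤n))
        ends : φ j m ≤ ∑²< (suc m) (indicator end?)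
        ends = ≤-trans (pick end? j m (refl , refl) j≤m ≤-refl) (∑<-term (suc m) (row end?) j (s≤s j≤m))
          where
          j≤m : j ≤ m
          j≤m = ≤-trans (ℕP.m≤n+m j 2) j+2≤m
        lemma : ∀ a b c x → a * x + b * x + c * x ≡ (a + b + c) * x
        lemma = solve-∀

      double-total≤ : total + total ≤ ∑²< (suc m) (λ k l → e k l * φ k l)
      double-total≤ = begin
        total + total
          ≤⟨ +-mono-≤ total≤ total≤ ⟩
        ∑²< (suc m) ιφ + ∑²< (suc m) ιφ
          ≡⟨ cong (∑²< (suc m) ιφ +_) (∑<-comm (suc m) (suc m) ιφ) ⟩
        ∑²< (suc m) ιφ + ∑²< (suc m) (λ k l → ιφ l k)
          ≡⟨ ∑²<-+ (suc m) ιφ (λ k l → ιφ l k) ⟨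
        ∑²< (suc m) (λ k l → ιφ k l + ιφ l k)
          ≡⟨ ∑²<-cong (suc m) (λ k l → trans (cong (λ x → ι k l * φ k l + ι l k * x) (F-sym (w p l) (w p k))) (sym (ℕP.*-distribʳ-+ (φ k l) (ι k l) (ι l k)))) ⟩
        ∑²< (suc m) (λ k l → (ι k l + ι l k) * φ k l)
          ≤⟨ ∑<-mono (suc m) (λ { k (s≤s k≤m) → ∑<-mono (suc m) (λ { l (s≤s l≤m) → ℕP.*-monoˡ-≤ (φ k l) (ι-both k l k≤m l≤m) }) }) ⟩
        ∑²< (suc m) (λ k l → e k l * φ k l) ∎
        where
        open ℕP.≤-Reasoning
        ιφ : ℕ → ℕ → ℕ
        ιφ k l = ι k l * φ k l

module Bicyclic {n} (G : Graph n) (simple : IsSimple G) (conn : Connected G)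
                (bicyclic : numEdges G ≡ suc n) (min-deg : ∀ v → 2 ≤ deg G v) where
  open Metric G simple conn
  open Paths G simple

  excess : sum (λ v → deg G v ∸ 2) ≡ 2
  excess = ℕP.+-cancelʳ-≡ (n * 2) _ _ (begin
    sum (λ v → deg G v ∸ 2) + n * 2  ≡⟨ cong (sum (λ v → deg G v ∸ 2) +_) (sum-const n 2) ⟨
    sum (λ v → deg G v ∸ 2) + sum {n} (λ _ → 2) ≡⟨ ∑-distrib-+ (λ v → deg G v ∸ 2) (λ _ → 2) ⟨
    sum (λ v → deg G v ∸ 2 + 2)  ≡⟨ sum-cong-≗ (λ v → ℕP.m∸n+n≡m (min-deg v)) ⟩
    sum (deg G)  ≡⟨ sum-deg G simple ⟩
    numEdges G + numEdges G  ≡⟨ cong₂ _+_ bicyclic bicyclic ⟩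
    suc n + suc n  ≡⟨ lemma n ⟩
    2 + n * 2  ∎)
    where
    open ≡-Reasoning
    lemma : ∀ n → suc n + suc n ≡ 2 + n * 2
    lemma = solve-∀

  -- The first vertex has a neighbour besides its successor. If it lies off the path, the path
  -- grows; otherwise it gives the chord at the front of a lasso.
  front : ∀ {m} (p : Path m) → Path (suc m) ⊎ ∃ λ i → 2 ≤ i × i ≤ m × G (w p 0) (w p i) ≡ true
  front {m} p with other-neighbour G (min-deg (w p 0)) (w p 1)
  ... | u , u≢w₁ , e with onPath? p u
  ...   | no off = inj₁ (extend p u off e)
  ...   | yes (zero , _ , eq) = ⊥-elim (irreflexive e eq)
  ...   | yes (suc zero , _ , eq) = ⊥-elim (u≢w₁ (sym eq))
  ...   | yes (suc (suc i) , s≤s i≤m , refl) = inj₂ (suc (suc i) , s≤s (s≤s z≤n) , i≤m , e)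

  path-deg : ∀ {m} (p : Path m) → ∑< (suc m) (deg G ∘ w p) ≤ 2 + suc m * 2
  path-deg {m} p = begin
    ∑< (suc m) (deg G ∘ w p)  ≡⟨ ∑<-cong (suc m) (λ k _ → ℕP.m∸n+n≡m (min-deg (w p k))) ⟨
    ∑< (suc m) (λ k → deg G (w p k) ∸ 2 + 2)  ≡⟨ ∑<-+ (suc m) (λ k → deg G (w p k) ∸ 2) (λ _ → 2) ⟩
    ∑< (suc m) (λ k → deg G (w p k) ∸ 2) + ∑< (suc m) (λ _ → 2)
      ≤⟨ +-mono-≤ (∑<-injective-≤ (suc m) (w p) (inj p) (λ v → deg G v ∸ 2)) (≤-reflexive (∑<-const (suc m) 2)) ⟩
    sum (λ v → deg G v ∸ 2) + suc m * 2  ≡⟨ cong (_+ suc m * 2) excess ⟩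
    2 + suc m * 2  ∎
    where open ℕP.≤-Reasoning

  -- The `m + 2` edges of the lasso already account for a degree sum of `2 (m + 2)` on its `m + 1`
  -- vertices, which is the maximum that `path-deg` allows. One more edge leaving the path would
  -- exceed it.
  lasso-closed : ∀ {m} {p : Path m} → Lasso p → ∀ u v → G u v ≡ true → OnPath p u → OnPath p v
  lasso-closed {m} {p} lasso u v uv (k , k<m , refl) with onPath? p v
  ... | yes on = on
  ... | no off = ⊥-elim (ℕP.<⇒≱ (begin-strict
      2 + suc m * 2  ≡⟨ lemma m ⟩
      m + 1 + 1 + (m + 1 + 1)  ≡⟨ cong (λ x → x + 1 + 1 + (x + 1 + 1)) (trans (∑<-const m 1) (*-identityʳ m)) ⟨
      total + total  ≤⟨ double-total≤ ⟩
      ∑< (suc m) (λ k → ∑< (suc m) (λ l → e k l * 1))     ≡⟨ ∑<-cong (suc m) (λ k _ → ∑<-cong (suc m) (λ l _ → *-identityʳ (e k l))) ⟩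
      ∑< (suc m) (λ k → ∑< (suc m) (e k))  <⟨ ∑<-mono-< (suc m) (λ k _ → ∑<-injective-≤ (suc m) (w p) (inj p) (λ u → 𝟙 (G (w p k) u))) k k<m extra ⟩
      ∑< (suc m) (deg G ∘ w p)  ∎) (path-deg p))
    where
    open LassoEdges lasso
    open Weighted (λ _ _ → 1) (λ _ _ → refl)
    open ℕP.≤-Reasoning
    lemma : ∀ m → 2 + suc m * 2 ≡ m + 1 + 1 + (m + 1 + 1)
    lemma = solve-∀
    extra : ∑< (suc m) (e k) < deg G (w p k)
    extra = ≤-trans (≤-reflexive (cong (λ b → 𝟙 b + ∑< (suc m) (e k)) (sym uv)))
      (∑<-injective-≤ (suc (suc m)) (prepend v (w p)) (prepend-inj p v off) (λ u → 𝟙 (G (w p k) u)))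

  record Cycle (m : ℕ) : Set where
    field
      path : Path m
      back : G (w path m) (w path 0) ≡ true

  open Cycle

  rotate : ∀ {m} → 0 < m → Cycle m → Cycle m
  rotate {m} 0<m c = record { path = record { w = w′ ; inj = inj′ ; adj = adj′ } ; back = back′ }
    where
    p = path c
    w′ : ℕ → Fin n
    w′ k = if does (k ℕ.<? m) then w p (suc k) else w p 0
    below : ∀ {k} → k < m → w′ k ≡ w p (suc k)
    below {k} k<m = cong (if_then w p (suc k) else w p 0) (dec-true (k ℕ.<? m) k<m)
    top : ∀ {k} → ¬ (k < m) → w′ k ≡ w p 0
    top {k} k≮m = cong (if_then w p (suc k) else w p 0) (dec-false (k ℕ.<? m) k≮m)
    inj′ : InjectiveBelow (suc m) w′
    inj′ k l (s≤s k≤m) (s≤s l≤m) eq with k ℕ.<? m | l ℕ.<? m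
    ... | yes k<m | yes l<m = ℕP.suc-injective (inj p (suc k) (suc l) (s≤s k<m) (s≤s l<m) (trans (sym (below k<m)) (trans eq (below l<m))))
    ... | no k≮m  | no l≮m  = lia (k ∷ l ∷ m ∷ []) (λ k l m → k :≤ m :⇒ l :≤ m :⇒ m :≤ k :⇒ m :≤ l :⇒ k :≡ l) k≤m l≤m (ℕP.≮⇒≥ k≮m) (ℕP.≮⇒≥ l≮m)
    ... | yes k<m | no l≮m  with inj p (suc k) 0 (s≤s k<m) (s≤s z≤n) (trans (sym (below k<m)) (trans eq (top l≮m)))
    ...   | ()
    inj′ k l (s≤s k≤m) (s≤s l≤m) eq | no k≮m | yes l<m with inj p 0 (suc l) (s≤s z≤n) (s≤s l<m) (trans (sym (top k≮m)) (trans eq (below l<m)))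
    ...   | ()
    adj′ : ∀ k → k < m → G (w′ k) (w′ (suc k)) ≡ true
    adj′ k k<m with suc k ℕ.<? m
    ... | yes k+1<m = trans (cong₂ G (below k<m) (below k+1<m)) (adj p (suc k) k+1<m)
    ... | no k+1≮m  = trans (cong₂ G (trans (below k<m) (cong (w p) (ℕP.≤-antisym k<m (ℕP.≮⇒≥ k+1≮m)))) (top k+1≮m)) (back c)
    back′ : G (w′ m) (w′ 0) ≡ true
    back′ = trans (cong₂ G (top (ℕP.n≮n m)) (below 0<m)) (adj p 0 0<m)

  rotate-w : ∀ {m} (0<m : 0 < m) (c : Cycle m) k → k < m → w (path (rotate 0<m c)) k ≡ w (path c) (suc k)
  rotate-w {m} 0<m c k k<m = cong (if_then w (path c) (suc k) else w (path c) 0) (dec-true (k ℕ.<? m) k<m)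

  rotate-onPath : ∀ {m} (0<m : 0 < m) (c : Cycle m) {v} → OnPath (path (rotate 0<m c)) v → OnPath (path c) v
  rotate-onPath {m} 0<m c (k , k<m , eq) with k ℕ.<? m
  ... | yes k<m′ = suc k , s≤s k<m′ , trans (sym (rotate-w 0<m c k k<m′)) eq
  ... | no k≮m   = 0 , s≤s z≤n , trans (sym (cong (if_then w (path c) (suc k) else w (path c) 0) (dec-false (k ℕ.<? m) k≮m))) eq

  rotateBy : ∀ {m} → 0 < m → ℕ → Cycle m → Cycle m
  rotateBy 0<m zero    c = c
  rotateBy 0<m (suc k) c = rotateBy 0<m k (rotate 0<m c)

  rotateBy-w : ∀ {m} (0<m : 0 < m) k c l → k + l ≤ m → w (path (rotateBy 0<m k c)) l ≡ w (path c) (k + l)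
  rotateBy-w 0<m zero    c l h = refl
  rotateBy-w 0<m (suc k) c l h = trans (rotateBy-w 0<m k (rotate 0<m c) l (<⇒≤ h)) (rotate-w 0<m c (k + l) h)

  rotateBy-onPath : ∀ {m} (0<m : 0 < m) k c {v} → OnPath (path (rotateBy 0<m k c)) v → OnPath (path c) v
  rotateBy-onPath 0<m zero    c on = on
  rotateBy-onPath 0<m (suc k) c on = rotate-onPath 0<m c (rotateBy-onPath 0<m k (rotate 0<m c) on)

  LassoOf : ℕ → Set
  LassoOf m = Σ (Path m) Lasso

  Third : ∀ {m} → Cycle m → Fin n → Set
  Third {m} c u = G (w (path c) 0) u ≡ true × u ≢ w (path c) 1 × u ≢ w (path c) m

  third? : ∀ {m} (c : Cycle m) → Dec (∃ (Third c))
  third? {m} c = FP.any? (λ u → (G (w (path c) 0) u BP.≟ true)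
      ×-dec (¬? (u F.≟ w (path c) 1) ×-dec ¬? (u F.≟ w (path c) m)))

  use-third : ∀ {m} → 2 ≤ m → (c : Cycle m) → ∀ u → Third c u → Path (suc m) ⊎ LassoOf m
  use-third {m} 2≤m c u (e , u≢w₁ , u≢wₘ) with onPath? (path c) u
  ... | no off = inj₁ (extend (path c) u off e)
  ... | yes (zero , _ , eq) = ⊥-elim (irreflexive e eq)
  ... | yes (suc zero , _ , eq) = ⊥-elim (u≢w₁ (sym eq))
  ... | yes (suc (suc i) , s≤s i≤m , refl) = inj₂ (path c , record
    -- The edge that closes the cycle serves as the chord at the far end; the third neighbour is not
    -- `w m`, hence the two chords differ.
    { i = suc (suc i) ; j = 0 ; 2≤i = s≤s (s≤s z≤n) ; i≤m = i≤m ; j+2≤m = 2≤m ; startEdge = e ; endEdge = adj-sym (back c)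
    ; distinct = inj₁ (ℕP.≤∧≢⇒< i≤m (λ i≡m → u≢wₘ (cong (w (path c)) i≡m))) })

  -- The case in which both chords are the edge joining the two ends. A vertex of the cycle with a
  -- third neighbour is rotated to the front, where the extra edge either lengthens the path or is a
  -- second chord. Without such a vertex the cycle would be the whole graph and all degrees would be
  -- at most `2`, against the degree sum `2 (n + 1)`.
  cycle-step : ∀ {m} → 2 ≤ m → Cycle m → Path (suc m) ⊎ LassoOf m
  cycle-step {m} 2≤m c with ℕP.anyUpTo? (λ k → third? (rotateBy 0<m k c)) (suc m)
    where
    0<m : 0 < m
    0<m = ℕP.<-trans (s≤s z≤n) 2≤m
  ... | yes (k , _ , u , h) = use-third 2≤m (rotateBy (ℕP.<-trans (s≤s z≤n) 2≤m) k c) u h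
  ... | no none = ⊥-elim (ℕP.<⇒≱ (≤-trans (≤-reflexive (cong suc (lemma n))) (≤-trans (n≤1+n (suc (n + n)))
                    (≤-reflexive (trans (cong suc (sym (+-suc n n))) (sym (trans (sum-deg G simple) (cong₂ _+_ bicyclic bicyclic)))))))
                    (sum-mono small))
    where
    0<m : 0 < m
    0<m = ℕP.<-trans (s≤s z≤n) 2≤m
    lemma : ∀ n → sum {n} (λ _ → 2) ≡ n + n
    lemma n = trans (sum-const n 2) (trans (ℕP.*-comm n 2) (cong (n +_) (+-identityʳ n)))
    only : ∀ k → k ≤ m → ∀ u → G (w (path c) k) u ≡ true →
      u ≡ w (path (rotateBy 0<m k c)) 1 ⊎ u ≡ w (path (rotateBy 0<m k c)) m
    only k k≤m u e with u F.≟ w (path (rotateBy 0<m k c)) 1 | u F.≟ w (path (rotateBy 0<m k c)) m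
    ... | yes p | _     = inj₁ p
    ... | no _  | yes q = inj₂ q
    ... | no p  | no q  = ⊥-elim (none (k , s≤s k≤m , u , subst (λ x → G x u ≡ true) (sym (trans
            (rotateBy-w 0<m k c 0 (≤-trans (≤-reflexive (+-identityʳ k)) k≤m)) (cong (w (path c)) (+-identityʳ k)))) e , p , q))
    everywhere : ∀ v → OnPath (path c) v
    everywhere = closed (OnPath (path c)) step (0 , s≤s z≤n , refl)
      where
      step : ∀ u v → G u v ≡ true → OnPath (path c) u → OnPath (path c) v
      step u v e (k , s≤s k≤m , refl) with only k k≤m v e
      ... | inj₁ eq = rotateBy-onPath 0<m k c (1 , s≤s 0<m , sym eq)
      ... | inj₂ eq = rotateBy-onPath 0<m k c (m , ≤-refl , sym eq)
    small : ∀ v → deg G v ≤ 2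
    small v with everywhere v
    ... | k , s≤s k≤m , refl = deg≤2 G (w (path (rotateBy 0<m k c)) 1) (w (path (rotateBy 0<m k c)) m) (only k k≤m)

  path-step : ∀ {m} → Path m → Path (suc m) ⊎ LassoOf m
  path-step {m} p with front p | front (reverse p)
  ... | inj₁ longer | _  = inj₁ longer
  ... | inj₂ _      | inj₁ longer = inj₁ longer
  ... | inj₂ (i , 2≤i , i≤m , e) | inj₂ (j , 2≤j , j≤m , e′) with i ℕ.<? m | 0 ℕ.<? m ∸ j
  ...   | yes i<m | _ = inj₂ (p , record { i = i ; j = m ∸ j ; 2≤i = 2≤i ; i≤m = i≤m
            ; j+2≤m = lia (j ∷ m ∷ []) (λ j m → con 2 :≤ j :⇒ j :≤ m :⇒ con 2 :+ (m :∸ j) :≤ m) 2≤j j≤m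
            ; startEdge = e ; endEdge = adj-sym e′ ; distinct = inj₁ i<m })
  ...   | no _    | yes 0<j = inj₂ (p , record { i = i ; j = m ∸ j ; 2≤i = 2≤i ; i≤m = i≤m
            ; j+2≤m = lia (j ∷ m ∷ []) (λ j m → con 2 :≤ j :⇒ j :≤ m :⇒ con 2 :+ (m :∸ j) :≤ m) 2≤j j≤m
            ; startEdge = e ; endEdge = adj-sym e′ ; distinct = inj₂ 0<j })
  -- Here `i = m`, so the path closes up to a cycle.
  ...   | no i≮m  | no _ = cycle-step (≤-trans 2≤i i≤m)
            (record { path = p ; back = adj-sym (subst (λ x → G (w p 0) (w p x) ≡ true) (ℕP.≤-antisym i≤m (ℕP.≮⇒≥ i≮m)) e) })

  grow : ∀ fuel {m} → m + fuel ≡ n → Path m → ∃ LassoOf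
  grow zero  {m} eq p = ⊥-elim (ℕP.<-irrefl (trans (sym (+-identityʳ m)) eq) (path-length p))
  grow (suc fuel) {m} eq p with path-step p
  ... | inj₁ longer = grow fuel (trans (sym (+-suc m fuel)) eq) longer
  ... | inj₂ lasso  = m , lasso

  trivial : Fin n → Path 0
  trivial v = record { w = λ _ → v ; inj = λ { zero zero _ _ _ → refl ; (suc _) _ (s≤s ()) ; zero (suc _) _ (s≤s ()) } ; adj = λ _ () }

  spanning-lasso : Fin n → ∃ LassoOf
  spanning-lasso v = grow n refl (trivial v)

  module Spanning {m} {p : Path m} (lasso : Lasso p) where
    open Lasso lasso public
    open LassoEdges lasso public

    onPath : ∀ v → OnPath p v
    onPath = closed (OnPath p) (lasso-closed lasso) (0 , s≤s z≤n , refl)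

    ix : Fin n → ℕ
    ix v = proj₁ (onPath v)

    ix≤m : ∀ v → ix v ≤ m
    ix≤m v = ≤-pred (proj₁ (proj₂ (onPath v)))

    w-ix : ∀ v → w p (ix v) ≡ v
    w-ix v = proj₂ (proj₂ (onPath v))

    ix-w : ∀ k → k ≤ m → ix (w p k) ≡ k
    ix-w k k≤m = inj p (ix (w p k)) k (s≤s (ix≤m (w p k))) (s≤s k≤m) (w-ix (w p k))

    vertex-sum : ∀ f → sum f ≡ ∑< (suc m) (f ∘ w p)
    vertex-sum f = ℕP.≤-antisym
      (≤-trans (≤-reflexive (sum-cong-≗ (λ v → cong f (sym (w-ix v)))))
        (sum-injective-≤ (suc m) ix (λ v → s≤s (ix≤m v)) (λ u v eq → trans (sym (w-ix u)) (trans (cong (w p) eq) (w-ix v))) (f ∘ w p)))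
      (∑<-injective-≤ (suc m) (w p) (inj p) f)

    n≡1+m : n ≡ suc m
    n≡1+m = trans (trans (sym (*-identityʳ n)) (sym (sum-const n 1)))
      (trans (vertex-sum (λ _ → 1)) (trans (∑<-const (suc m) 1) (*-identityʳ (suc m))))

    edge-sum : ∀ F → (∀ u v → F u v ≡ F v u) →
      ∑< m (λ k → F (w p k) (w p (suc k))) + F (w p 0) (w p i) + F (w p j) (w p m) ≤ edgeSum G F
    edge-sum F F-sym = ℕP.≮⇒≥ λ lt → ℕP.<⇒≱ (ℕP.+-mono-< lt lt) (begin
      total + total  ≤⟨ double-total≤ ⟩
      ∑< (suc m) (λ k → ∑< (suc m) (λ l → e k l * φ k l))    ≡⟨ ∑<-cong (suc m) (λ k _ → vertex-sum (λ v → 𝟙 (G (w p k) v) * F (w p k) v)) ⟨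
      ∑< (suc m) (λ k → sum (λ v → 𝟙 (G (w p k) v) * F (w p k) v))  ≡⟨ vertex-sum (λ u → sum (λ v → 𝟙 (G u v) * F u v)) ⟨
      sum (λ u → sum (λ v → 𝟙 (G u v) * F u v))  ≡⟨ double-edgeSum G simple F F-sym ⟩
      edgeSum G F + edgeSum G F  ∎)
      where
      open Weighted F F-sym
      open ℕP.≤-Reasoning

    -- The listed edges number `n + 1`, as many as the graph has. A termwise inequality between
    -- double sums with the same total is an equality in every term, so the graph has no other
    -- edges.
    edges-exact : ∀ k l → k ≤ m → l ≤ m → ι k l + ι l k ≡ e k l
    edges-exact k l k≤m l≤m = ∑<-mono-≡ (suc m) (λ { l (s≤s l≤m) → ι-both k l k≤m l≤m })
      (≤-reflexive (sym (∑<-mono-≡ (suc m)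
        (λ { k (s≤s k≤m) → ∑<-mono (suc m) (λ { l (s≤s l≤m) → ι-both k l k≤m l≤m }) }) totals k (s≤s k≤m)))) l (s≤s l≤m)
      where
      open Weighted (λ _ _ → 1) (λ _ _ → refl)
      open ℕP.≤-Reasoning
      unit : ∀ (f : ℕ → ℕ → ℕ) → ∑< (suc m) (λ k → ∑< (suc m) (λ l → f k l * 1)) ≡ ∑< (suc m) (λ k → ∑< (suc m) (f k))
      unit f = ∑<-cong (suc m) (λ k _ → ∑<-cong (suc m) (λ l _ → *-identityʳ (f k l)))
      count-total : total ≡ suc n
      count-total = trans (cong (λ x → x + 1 + 1) (trans (∑<-const m 1) (*-identityʳ m)))
        (trans (lemma m) (cong suc (sym n≡1+m)))
        where
        lemma : ∀ m → m + 1 + 1 ≡ suc (suc m)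
        lemma = solve-∀
      totals : ∑< (suc m) (λ k → ∑< (suc m) (e k)) ≤ ∑< (suc m) (λ k → ∑< (suc m) (λ l → ι k l + ι l k))
      totals = begin
        ∑< (suc m) (λ k → ∑< (suc m) (e k))  ≡⟨ ∑<-cong (suc m) (λ k _ → vertex-sum (λ v → 𝟙 (G (w p k) v))) ⟨
        ∑< (suc m) (deg G ∘ w p)  ≡⟨ vertex-sum (deg G) ⟨
        sum (deg G)  ≡⟨ trans (sum-deg G simple) (cong₂ _+_ (trans bicyclic (sym count-total)) (trans bicyclic (sym count-total))) ⟩
        total + total  ≤⟨ +-mono-≤ total≤ total≤ ⟩
        ∑²< (suc m) (λ k l → ι k l * 1) + ∑²< (suc m) (λ k l → ι k l * 1)
          ≡⟨ cong₂ _+_ (unit ι) (trans (unit ι) (∑<-comm (suc m) (suc m) ι)) ⟩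
        ∑²< (suc m) ι + ∑²< (suc m) (λ k l → ι l k)      ≡⟨ ∑²<-+ (suc m) ι (λ k l → ι l k) ⟨
        ∑²< (suc m) (λ k l → ι k l + ι l k) ∎

    edge-elim : (R : Fin n → Fin n → Set) → (∀ {u v} → R u v → R v u) →
      (∀ k → k < m → R (w p k) (w p (suc k))) → R (w p 0) (w p i) → R (w p j) (w p m) →
      ∀ u v → G u v ≡ true → R u v
    edge-elim R R-sym steps starts ends u v uv = subst₂ R (w-ix u) (w-ix v)
      (cases (ix u) (ix v) (ix≤m u) (ix≤m v) (trans (cong₂ G (w-ix u) (w-ix v)) uv))
      where
      listed : ∀ k l → k ≤ m → l ≤ m → 0 < ι k l → R (w p k) (w p l)
      listed k l k≤m l≤m h with step? k l | start? k l | end? k l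
      ... | yes refl | _ | _ = steps k l≤m
      ... | no _ | yes (refl , refl) | _ = starts
      ... | no _ | no _ | yes (refl , refl) = ends
      cases : ∀ k l → k ≤ m → l ≤ m → G (w p k) (w p l) ≡ true → R (w p k) (w p l)
      cases k l k≤m l≤m kl = split (ι k l) (ι l k) (trans (edges-exact k l k≤m l≤m) (cong 𝟙 kl)) (listed k l k≤m l≤m) (R-sym ∘ listed l k l≤m k≤m)
        where
        split : ∀ x y {A : Set} → x + y ≡ 1 → (0 < x → A) → (0 < y → A) → A
        split zero    y refl _ f = f (s≤s z≤n)
        split (suc x) y _    f _ = f (s≤s z≤n)

-- Cycles joined by a path or sharing a vertex

-- The length of the shorter arc between two points at offset `x` on a cycle of length `g`; `cyc` is
-- then the metric of the cycle.
arc : ℕ → ℕ → ℕ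
arc g x = x ⊓ (g ∸ x)

cyc : ℕ → ℕ → ℕ → ℕ
cyc g k l = arc g ∣ k - l ∣

cyc-≤ : ∀ g {k l} → k ≤ l → cyc g k l ≡ arc g (l ∸ k)
cyc-≤ g k≤l = cong (arc g) (ℕP.m≤n⇒∣m-n∣≡n∸m k≤l)

cyc-≥ : ∀ g {k l} → l ≤ k → cyc g k l ≡ arc g (k ∸ l)
cyc-≥ g l≤k = cong (arc g) (ℕP.m≤n⇒∣n-m∣≡n∸m l≤k)

-- Increasing both positions by one does not change their difference, so the two sums share all
-- terms but one; the terms left over measure the same arc, once across the wrap.
∑<-cyc-suc : ∀ g k → suc k < g → ∑< g (cyc g (suc k)) ≡ ∑< g (cyc g k)
∑<-cyc-suc (suc g) k (s≤s k<g) = begin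
  cyc (suc g) (suc k) 0 + ∑< g (cyc (suc g) k)  ≡⟨ cong (_+ ∑< g (cyc (suc g) k)) ends ⟩
  cyc (suc g) k g + ∑< g (cyc (suc g) k)  ≡⟨ +-comm (cyc (suc g) k g) _ ⟩
  ∑< g (cyc (suc g) k) + cyc (suc g) k g  ≡⟨ ∑<-last g (cyc (suc g) k) ⟨
  ∑< (suc g) (cyc (suc g) k)  ∎
  where
  open ≡-Reasoning
  ends : cyc (suc g) (suc k) 0 ≡ cyc (suc g) k g
  ends = trans (lia (g ∷ k ∷ []) (λ g k → k :< g :⇒ (con 1 :+ k) :⊓ (g :∸ k) :≡ (g :∸ k) :⊓ (con 1 :+ g :∸ (g :∸ k))) k<g)
               (sym (cyc-≤ (suc g) (<⇒≤ k<g)))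

∑<-cyc : ∀ g k → k < g → ∑< g (cyc g k) ≡ ∑< g (cyc g 0)
∑<-cyc g zero    _   = refl
∑<-cyc g (suc k) k<g = trans (∑<-cyc-suc g k k<g) (∑<-cyc g k (ℕP.<-trans (ℕP.n<1+n k) k<g))

Near : ℕ → ℕ → Set
Near x y = x ≤ suc y × y ≤ suc x

near-sym : ∀ {x y} → Near x y → Near y x
near-sym (p , q) = q , p

arc-near : ∀ g x → Near (arc g x) (arc g (suc x))
arc-near g x =
  lia (g ∷ x ∷ []) (λ g x → x :⊓ (g :∸ x) :≤ con 1 :+ (con 1 :+ x) :⊓ (g :∸ (con 1 :+ x))) ,
  lia (g ∷ x ∷ []) (λ g x → (con 1 :+ x) :⊓ (g :∸ (con 1 :+ x)) :≤ con 1 :+ x :⊓ (g :∸ x))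

cyc-near : ∀ g s k → Near (cyc g s k) (cyc g s (suc k))
cyc-near g s k with compare s k
  where
  compare : ∀ s k → ∣ s - suc k ∣ ≡ suc ∣ s - k ∣ ⊎ ∣ s - k ∣ ≡ suc ∣ s - suc k ∣
  compare zero    zero    = inj₁ refl
  compare zero    (suc k) = inj₁ refl
  compare (suc s) zero    = inj₂ (cong suc (sym (ℕP.∣-∣-identityʳ s)))
  compare (suc s) (suc k) = compare s k
... | inj₁ eq = subst (λ x → Near (cyc g s k) (arc g x)) (sym eq) (arc-near g ∣ s - k ∣)
... | inj₂ eq = subst (λ x → Near (arc g x) (cyc g s (suc k))) (sym eq) (near-sym (arc-near g ∣ s - suc k ∣))

cyc-near-wrap : ∀ g s → s ≤ g → Near (cyc (suc g) s 0) (cyc (suc g) s g)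
cyc-near-wrap g s s≤g = subst₂ Near (sym (cyc-≥ (suc g) z≤n)) (sym (cyc-≤ (suc g) s≤g))
  (lia (g ∷ s ∷ []) (λ g s → s :≤ g :⇒ s :⊓ (con 1 :+ g :∸ s) :≤ con 1 :+ (g :∸ s) :⊓ (con 1 :+ g :∸ (g :∸ s))) s≤g ,
   lia (g ∷ s ∷ []) (λ g s → s :≤ g :⇒ (g :∸ s) :⊓ (con 1 :+ g :∸ (g :∸ s)) :≤ con 1 :+ s :⊓ (con 1 :+ g :∸ s)) s≤g)

cyc-refl : ∀ g s → cyc g s s ≡ 0
cyc-refl g s = cong (arc g) (ℕP.∣n-n∣≡0 s)

double-square : ∀ m x → 6 ≤ m → m ≤ x + x → 3 + m ≤ x * x + x * x
double-square m x 6≤m m≤2x = go x (lia (m ∷ x ∷ []) (λ m x → con 6 :≤ m :⇒ m :≤ x :+ x :⇒ con 3 :≤ x) 6≤m m≤2x) m≤2x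
  where
  lemma : ∀ k → 9 + 2 * k + (9 + 10 * k + 2 * (k * k)) ≡ (3 + k) * (3 + k) + (3 + k) * (3 + k)
  lemma = solve-∀
  go : ∀ x → 3 ≤ x → m ≤ x + x → 3 + m ≤ x * x + x * x
  go (suc (suc (suc k))) _ m≤2x = ≤-trans
    (lia (m ∷ k ∷ []) (λ m k → m :≤ con 3 :+ k :+ (con 3 :+ k) :⇒ con 3 :+ m :≤ con 9 :+ 2 :* k) m≤2x)
    (≤-trans (m≤m+n (9 + 2 * k) (9 + 10 * k + 2 * (k * k))) (≤-reflexive (lemma k)))
  go (suc zero)  (s≤s ())
  go (suc (suc zero)) (s≤s (s≤s ()))

module Gaps {n} (G : Graph n) (simple : IsSimple G) (conn : Connected G) where
  open Metric G simple conn

  gap² : Fin n → Fin n → ℕ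
  gap² u v = gap u v * gap u v

  gap²-sym : ∀ u v → gap² u v ≡ gap² v u
  gap²-sym u v = cong₂ _*_ (gap-sym u v) (gap-sym u v)

  gap-lower : ∀ u v {x} → D u + x ≤ D v → x ≤ gap u v
  gap-lower u v {x} h = ℕP.+-cancelˡ-≤ (D u) x (gap u v) (≤-trans h
    (≤-trans (ℕP.m≤n+∣m-n∣ (D v) (D u)) (≤-reflexive (cong (D u +_) (gap-sym v u)))))

module DumbbellBound {n} (G : Graph n) (simple : IsSimple G) (conn : Connected G)
                (bicyclic : numEdges G ≡ suc n) (min-deg : ∀ v → 2 ≤ deg G v) where
  open Metric G simple conn
  open Gaps G simple conn
  open Paths G simple
  open Bicyclic G simple conn bicyclic min-deg

  module _ {m} {p : Path m} (lasso : Lasso p) (i≤j : Lasso.i lasso ≤ Lasso.j lasso) where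
    open Spanning lasso

    -- The vertices `w 0`, ..., `w i` form a cycle attached to the rest at `w i`, and `s` is a
    -- neighbour of `i` on it. By rotation the cycle contributes equally to both transmissions,
    -- while each of the `m − i` vertices beyond `w i` is at least one farther from `w s`. The
    -- assumption `i ≤ j` keeps the second chord beyond `w i`.
    arm : ∀ s → s < i → cyc (suc i) s i ≡ 1 → D (w p i) + (m ∸ i) ≤ D (w p s)
    arm s s<i si≡1 = begin
      D (w p i) + (m ∸ i)
        ≤⟨ +-monoˡ-≤ (m ∸ i) (≤-trans (≤-reflexive (vertex-sum′ (d (w p i)))) (+-monoˡ-≤ Z (∑<-mono i upper))) ⟩
      ∑< i (cyc (suc i) i) + Z + (m ∸ i)
        ≡⟨ lia (∑< i (cyc (suc i) i) ∷ ∑< i (cyc (suc i) s) ∷ Z ∷ m ∸ i ∷ []) (λ x y b z → x :≡ y :+ con 1 :⇒ x :+ b :+ z :≡ y :+ (con 1 :+ z :+ b)) cycle-sums ⟩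
      ∑< i (cyc (suc i) s) + (suc (m ∸ i) + Z)
        ≡⟨ cong (∑< i (cyc (suc i) s) +_) (trans (∑<-+ (suc (m ∸ i)) (λ _ → 1) (λ k → d (w p i) (w p (i + k))))
             (cong (_+ Z) (trans (∑<-const (suc (m ∸ i)) 1) (*-identityʳ (suc (m ∸ i)))))) ⟨
      ∑< i (cyc (suc i) s) + ∑< (suc (m ∸ i)) (λ k → suc (d (w p i) (w p (i + k))))
        ≡⟨ cong₂ _+_ (∑<-cong i (λ k k<i → trans (f-w k (≤-trans (<⇒≤ k<i) i≤m)) (h-below k<i)))
             (∑<-cong (suc (m ∸ i)) (λ { k (s≤s k≤) → trans (f-w (i + k) (i+k≤m k k≤)) (h-above (m≤m+n i k)) })) ⟨
      ∑< i (λ k → f (w p k)) + ∑< (suc (m ∸ i)) (λ k → f (w p (i + k)))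
        ≡⟨ vertex-sum′ f ⟨
      sum f
        ≤⟨ sum-mono f≤d ⟩
      D (w p s) ∎
      where
      open ℕP.≤-Reasoning
      Z = ∑< (suc (m ∸ i)) (λ k → d (w p i) (w p (i + k)))
      i+k≤m : ∀ k → k ≤ m ∸ i → i + k ≤ m
      i+k≤m k h = lia (i ∷ k ∷ m ∷ []) (λ i k m → i :≤ m :⇒ k :≤ m :∸ i :⇒ i :+ k :≤ m) i≤m h
      vertex-sum′ : ∀ f → sum f ≡ ∑< i (λ k → f (w p k)) + ∑< (suc (m ∸ i)) (λ k → f (w p (i + k)))
      vertex-sum′ f = trans (vertex-sum f) (trans (cong (λ x → ∑< x (f ∘ w p))
        (lia (i ∷ m ∷ []) (λ i m → i :≤ m :⇒ con 1 :+ m :≡ i :+ (con 1 :+ (m :∸ i))) i≤m)) (∑<-split i (suc (m ∸ i)) (f ∘ w p)))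
      h : ℕ → ℕ
      h l = if does (l ℕ.<? i) then cyc (suc i) s l else suc (d (w p i) (w p l))
      h-below : ∀ {l} → l < i → h l ≡ cyc (suc i) s l
      h-below {l} l<i = cong (if_then cyc (suc i) s l else suc (d (w p i) (w p l))) (dec-true (l ℕ.<? i) l<i)
      h-above : ∀ {l} → i ≤ l → h l ≡ suc (d (w p i) (w p l))
      h-above {l} i≤l = cong (if_then cyc (suc i) s l else suc (d (w p i) (w p l))) (dec-false (l ℕ.<? i) (ℕP.≤⇒≯ i≤l))
      h-≤i : ∀ {l} → l ≤ i → h l ≡ cyc (suc i) s l
      h-≤i {l} l≤i with ℕP.m≤n⇒m<n∨m≡n l≤i
      ... | inj₁ l<i  = h-below l<i
      -- The two parts of `h` meet at the attaching vertex, where both equal `1` because `s` is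
      -- adjacent to `i` on the cycle.
      ... | inj₂ refl = trans (h-above ≤-refl) (trans (cong suc (d-refl (w p i))) (sym si≡1))
      f : Fin n → ℕ
      f v = h (ix v)
      f-w : ∀ k → k ≤ m → f (w p k) ≡ h k
      f-w k k≤m = cong h (ix-w k k≤m)
      on-path : ∀ {k l} → k ≤ m → l ≤ m → Near (h k) (h l) → Near (f (w p k)) (f (w p l))
      on-path k≤m l≤m = subst₂ Near (sym (f-w _ k≤m)) (sym (f-w _ l≤m))
      beyond : ∀ {k l} → i ≤ k → i ≤ l → G (w p k) (w p l) ≡ true → Near (h k) (h l)
      beyond {k} {l} i≤k i≤l kl = subst₂ Near (sym (h-above i≤k)) (sym (h-above i≤l))
        (s≤s (d-lipschitz (w p i) (w p l) (w p k) (G-sym kl)) , s≤s (d-lipschitz (w p i) (w p k) (w p l) kl))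
      f-near : ∀ u v → G u v ≡ true → Near (f u) (f v)
      f-near = edge-elim (λ u v → Near (f u) (f v)) near-sym steps starts ends
        where
        steps : ∀ k → k < m → Near (f (w p k)) (f (w p (suc k)))
        steps k k<m with ℕP.≤-<-connex i k
        ... | inj₁ i≤k = on-path (<⇒≤ k<m) k<m (beyond i≤k (m≤n⇒m≤1+n i≤k) (adj p k k<m))
        ... | inj₂ k<i = on-path (<⇒≤ k<m) k<m (subst₂ Near (sym (h-below k<i)) (sym (h-≤i k<i))
                           (cyc-near (suc i) s k))
        starts : Near (f (w p 0)) (f (w p i))
        starts = on-path z≤n i≤m (subst₂ Near (sym (h-≤i z≤n)) (sym (h-≤i ≤-refl)) (cyc-near-wrap i s (<⇒≤ s<i)))
        ends : Near (f (w p j)) (f (w p m))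
        ends = on-path (≤-trans (ℕP.m≤n+m j 2) j+2≤m) ≤-refl (beyond i≤j i≤m endEdge)
      f≤d : ∀ v → f v ≤ d (w p s) v
      f≤d v = ≤-trans (d-lower (λ a b ab → proj₂ (f-near a b ab)) (w p s) v)
        (≤-reflexive (trans (cong (d (w p s) v +_) (trans (f-w s (≤-trans (<⇒≤ s<i) i≤m)) (trans (h-below s<i) (cyc-refl (suc i) s)))) (+-identityʳ _)))
      -- The sums omit position `i`, whose term is `0` seen from `i` and `1` seen from `s`; the
      -- complete sums agree by rotation.
      cycle-sums : ∑< i (cyc (suc i) i) ≡ ∑< i (cyc (suc i) s) + 1
      cycle-sums = trans (sym (+-identityʳ _)) (trans (cong (∑< i (cyc (suc i) i) +_) (sym (cyc-refl (suc i) i)))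
        (trans (sym (∑<-last i (cyc (suc i) i))) (trans (∑<-cyc (suc i) i ≤-refl)
        (trans (sym (∑<-cyc (suc i) s (m≤n⇒m≤1+n s<i))) (trans (∑<-last i (cyc (suc i) s)) (cong (∑< i (cyc (suc i) s) +_) si≡1))))))
      upper : ∀ l → l < i → d (w p i) (w p l) ≤ cyc (suc i) i l
      upper l l<i = ≤-trans (lia (d (w p i) (w p l) ∷ i ∷ l ∷ []) (λ x i l → l :< i :⇒ x :≤ i :∸ l :⇒ x :≤ con 1 :+ l :⇒
          x :≤ (i :∸ l) :⊓ (con 1 :+ i :∸ (i :∸ l))) l<i along around) (≤-reflexive (sym (cyc-≥ (suc i) (<⇒≤ l<i))))
        where
        along : d (w p i) (w p l) ≤ i ∸ l
        along = subst (_≤ i ∸ l) (d-sym (w p l) (w p i)) (subst (λ x → d (w p l) (w p x) ≤ i ∸ l) (m+[n∸m]≡n (<⇒≤ l<i))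
          (d-walk (w p) (adj p) l (i ∸ l) (≤-trans (≤-reflexive (m+[n∸m]≡n (<⇒≤ l<i))) i≤m)))
        around : d (w p i) (w p l) ≤ suc l
        around = ≤-trans (d-prepend (w p i) (w p 0) (w p l) (G-sym startEdge)) (s≤s (d-walk (w p) (adj p) 0 l (≤-trans (<⇒≤ l<i) i≤m)))

    -- The two edges of the cycle at its attaching vertex, `(i − 1, i)` and `(0, i)`, each have gap
    -- at least `m − i`.
    small-cycle : (m ∸ i) * (m ∸ i) + (m ∸ i) * (m ∸ i) ≤ S
    small-cycle = ≤-trans (+-mono-≤ inner outer) (≤-trans
        (m≤m+n (∑< m (λ k → gap² (w p k) (w p (suc k))) + gap² (w p 0) (w p i)) (gap² (w p j) (w p m))) (edge-sum gap² gap²-sym))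
      where
      i-1<i : i ∸ 1 < i
      i-1<i = lia (i ∷ []) (λ i → con 2 :≤ i :⇒ i :∸ con 1 :< i) 2≤i
      close : cyc (suc i) (i ∸ 1) i ≡ 1
      close = trans (cyc-≤ (suc i) (m∸n≤m i 1)) (trans (cong (arc (suc i)) (ℕP.m∸[m∸n]≡n (≤-trans (s≤s z≤n) 2≤i)))
        (ℕP.m≤n⇒m⊓n≡m (≤-trans (s≤s z≤n) 2≤i)))
      close₀ : cyc (suc i) 0 i ≡ 1
      close₀ = lia (i ∷ []) (λ i → con 2 :≤ i :⇒ i :⊓ (con 1 :+ i :∸ i) :≡ con 1) 2≤i
      inner : (m ∸ i) * (m ∸ i) ≤ ∑< m (λ k → gap² (w p k) (w p (suc k)))
      inner = ≤-trans (ℕP.*-mono-≤ bound bound) (∑<-term m (λ k → gap² (w p k) (w p (suc k))) (i ∸ 1) (ℕP.<-≤-trans i-1<i i≤m))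
        where
        bound : m ∸ i ≤ gap (w p (i ∸ 1)) (w p (suc (i ∸ 1)))
        bound = subst (λ x → m ∸ i ≤ gap (w p (i ∸ 1)) (w p x)) (lia (i ∷ []) (λ i → con 2 :≤ i :⇒ i :≡ con 1 :+ (i :∸ con 1)) 2≤i)
          (subst (m ∸ i ≤_) (gap-sym (w p i) (w p (i ∸ 1))) (gap-lower (w p i) (w p (i ∸ 1)) (arm (i ∸ 1) i-1<i close)))
      outer : (m ∸ i) * (m ∸ i) ≤ gap² (w p 0) (w p i)
      outer = ℕP.*-mono-≤ bound bound
        where
        bound : m ∸ i ≤ gap (w p 0) (w p i)
        bound = subst (m ∸ i ≤_) (gap-sym (w p i) (w p 0)) (gap-lower (w p i) (w p 0) (arm 0 (ℕP.<-trans (s≤s z≤n) 2≤i) close₀))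

  reverse-lasso : ∀ {m} {p : Path m} → Lasso p → Lasso (reverse p)
  reverse-lasso {m} {p} lasso = record
    { i = m ∸ j ; j = m ∸ i
    ; 2≤i = lia (j ∷ m ∷ []) (λ j m → con 2 :+ j :≤ m :⇒ con 2 :≤ m :∸ j) j+2≤m
    ; i≤m = m∸n≤m m j
    ; j+2≤m = lia (i ∷ m ∷ []) (λ i m → con 2 :≤ i :⇒ i :≤ m :⇒ con 2 :+ (m :∸ i) :≤ m) 2≤i i≤m
    ; startEdge = subst (λ x → G (w p m) (w p x) ≡ true) (sym (ℕP.m∸[m∸n]≡n (≤-trans (ℕP.m≤n+m j 2) j+2≤m))) (adj-sym endEdge)
    ; endEdge = trans (cong₂ (λ x y → G (w p x) (w p y)) (ℕP.m∸[m∸n]≡n i≤m) (ℕP.n∸n≡0 m)) (adj-sym startEdge)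
    ; distinct = swap distinct
    }
    where
    open Lasso lasso
    swap : i < m ⊎ 0 < j → m ∸ j < m ⊎ 0 < m ∸ i
    swap (inj₁ i<m) = inj₂ (ℕP.m<n⇒0<n∸m i<m)
    swap (inj₂ 0<j) = inj₁ (lia (j ∷ m ∷ []) (λ j m → con 2 :+ j :≤ m :⇒ con 0 :< j :⇒ m :∸ j :< m) j+2≤m 0<j)

  -- The condition `i + j ≤ m` says that the first cycle is the smaller one. Then at least half of
  -- the remaining vertices lie beyond it: `m ≤ 2 (m − i)`. The other case is reduced to this one by
  -- reversing the path.
  smaller-first : ∀ {m} {p : Path m} (lasso : Lasso p) → Lasso.i lasso ≤ Lasso.j lasso → Lasso.i lasso + Lasso.j lasso ≤ m →
    6 < n → 2 + n ≤ S
  smaller-first {m} lasso i≤j i+j≤m 6<n = ≤-trans (≤-trans (≤-reflexive (cong (2 +_) n≡1+m)) (double-square m (m ∸ i)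
      (≤-pred (subst (6 <_) n≡1+m 6<n))
      (lia (i ∷ j ∷ m ∷ []) (λ i j m → i :≤ j :⇒ i :+ j :≤ m :⇒ m :≤ (m :∸ i) :+ (m :∸ i)) i≤j i+j≤m))) (small-cycle lasso i≤j)
    where open Spanning lasso

  dumbbell-bound : ∀ {m} {p : Path m} (lasso : Lasso p) → Lasso.i lasso ≤ Lasso.j lasso → 6 < n → 2 + n ≤ S
  dumbbell-bound {m} lasso i≤j 6<n with ℕP.≤-total (Lasso.i lasso + Lasso.j lasso) m
  ... | inj₁ i+j≤m = smaller-first lasso i≤j i+j≤m 6<n
  ... | inj₂ m≤i+j = smaller-first (reverse-lasso lasso) (ℕP.∸-monoʳ-≤ m i≤j)
      (lia (i ∷ j ∷ m ∷ []) (λ i j m → i :≤ m :⇒ con 2 :+ j :≤ m :⇒ m :≤ i :+ j :⇒ (m :∸ j) :+ (m :∸ i) :≤ m) i≤m j+2≤m m≤i+j) 6<n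
    where open Lasso lasso

-- Theta graphs

module Thetas {n} (G : Graph n) where

  -- Three internally disjoint paths p, q, r from p 0 to p (suc a), with a, b, c interior vertices.
  record Theta (a b c : ℕ) : Set₁ where
    field
      p q r  : ℕ → Fin n
      p₀≡q₀  : p 0 ≡ q 0
      p₀≡r₀  : p 0 ≡ r 0
      pₑ≡qₑ  : p (suc a) ≡ q (suc b)
      pₑ≡rₑ  : p (suc a) ≡ r (suc c)
      -- At most one of the three paths is a single edge, since the graph has no multiple edges.
      1≤a+b  : 1 ≤ a + b
      1≤a+c  : 1 ≤ a + c
      1≤b+c  : 1 ≤ b + c
      p-adj  : ∀ k → k ≤ a → G (p k) (p (suc k)) ≡ true
      q-adj  : ∀ k → k ≤ b → G (q k) (q (suc k)) ≡ true
      r-adj  : ∀ k → k ≤ c → G (r k) (r (suc k)) ≡ true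
      cover  : (P : Fin n → Set) → (∀ k → k ≤ suc a → P (p k)) → (∀ k → k ≤ suc b → P (q k)) →
                     (∀ k → k ≤ suc c → P (r k)) → ∀ v → P v
      edge-elim    : (R : Fin n → Fin n → Set) → (∀ {u v} → R u v → R v u) → (∀ k → k ≤ a → R (p k) (p (suc k))) →
                     (∀ k → k ≤ b → R (q k) (q (suc k))) → (∀ k → k ≤ c → R (r k) (r (suc k))) →
                     ∀ u v → G u v ≡ true → R u v
      -- Functions prescribed on the three paths need to agree only at the common ends. This
      -- principle stands in for injectivity and internal disjointness, and keeps the numbering of
      -- the spanning path out of the estimates and the symmetries below.
      glue  : (φ ψ χ : ℕ → ℕ) → φ 0 ≡ ψ 0 → φ 0 ≡ χ 0 → φ (suc a) ≡ ψ (suc b) → φ (suc a) ≡ χ (suc c) →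
                     ∃ λ (f : Fin n → ℕ) → (∀ k → k ≤ suc a → f (p k) ≡ φ k) × (∀ k → k ≤ suc b → f (q k) ≡ ψ k) ×
                                           (∀ k → k ≤ suc c → f (r k) ≡ χ k)
      vertex-sum   : ∀ f → sum f ≡ f (p 0) + f (p (suc a)) + ∑< a (f ∘ p ∘ suc) + ∑< b (f ∘ q ∘ suc) + ∑< c (f ∘ r ∘ suc)
      edge-sum     : ∀ F → (∀ u v → F u v ≡ F v u) → ∑< (suc a) (λ k → F (p k) (p (suc k))) +
                     ∑< (suc b) (λ k → F (q k) (q (suc k))) + ∑< (suc c) (λ k → F (r k) (r (suc k))) ≤ edgeSum G F

  swap-pq : ∀ {a b c} → Theta a b c → Theta b a c
  swap-pq {a} {b} {c} θ = record
    { p = q ; q = p ; r = r ; p₀≡q₀ = sym p₀≡q₀ ; p₀≡r₀ = trans (sym p₀≡q₀) p₀≡r₀ ; pₑ≡qₑ = sym pₑ≡qₑ ; pₑ≡rₑ = trans (sym pₑ≡qₑ) pₑ≡rₑ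
    ; 1≤a+b = subst (1 ≤_) (+-comm a b) 1≤a+b ; 1≤a+c = 1≤b+c ; 1≤b+c = 1≤a+c ; p-adj = q-adj ; q-adj = p-adj ; r-adj = r-adj
    ; cover = λ P hp hq hr → cover P hq hp hr
    ; edge-elim = λ R R-sym hp hq hr → edge-elim R R-sym hq hp hr
    ; glue = λ φ ψ χ e₁ e₂ e₃ e₄ → let (f , fp , fq , fr) = glue ψ φ χ (sym e₁) (trans (sym e₁) e₂) (sym e₃) (trans (sym e₃) e₄) in f , fq , fp , fr
    ; vertex-sum = λ f → trans (vertex-sum f) (trans (cong₂ (λ x y → f x + f y + ∑< a (f ∘ p ∘ suc) + ∑< b (f ∘ q ∘ suc) + ∑< c (f ∘ r ∘ suc)) p₀≡q₀ pₑ≡qₑ)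
        (lemma (f (q 0)) (f (q (suc b))) (∑< a (f ∘ p ∘ suc)) (∑< b (f ∘ q ∘ suc)) (∑< c (f ∘ r ∘ suc))))
    ; edge-sum = λ F F-sym → ≤-trans (≤-reflexive (cong (_+ ∑< (suc c) (λ k → F (r k) (r (suc k))))
        (+-comm (∑< (suc b) (λ k → F (q k) (q (suc k)))) (∑< (suc a) (λ k → F (p k) (p (suc k))))))) (edge-sum F F-sym)
    }
    where
    open Theta θ
    lemma : ∀ x y a b c → x + y + a + b + c ≡ x + y + b + a + c
    lemma = solve-∀

  swap-qr : ∀ {a b c} → Theta a b c → Theta a c b
  swap-qr {a} {b} {c} θ = record
    { p = p ; q = r ; r = q ; p₀≡q₀ = p₀≡r₀ ; p₀≡r₀ = p₀≡q₀ ; pₑ≡qₑ = pₑ≡rₑ ; pₑ≡rₑ = pₑ≡qₑ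
    ; 1≤a+b = 1≤a+c ; 1≤a+c = 1≤a+b ; 1≤b+c = subst (1 ≤_) (+-comm b c) 1≤b+c ; p-adj = p-adj ; q-adj = r-adj ; r-adj = q-adj
    ; cover = λ P hp hq hr → cover P hp hr hq
    ; edge-elim = λ R R-sym hp hq hr → edge-elim R R-sym hp hr hq
    ; glue = λ φ ψ χ e₁ e₂ e₃ e₄ → let (f , fp , fq , fr) = glue φ χ ψ e₂ e₁ e₄ e₃ in f , fp , fr , fq
    ; vertex-sum = λ f → trans (vertex-sum f)
        (lemma (f (p 0) + f (p (suc a)) + ∑< a (f ∘ p ∘ suc)) (∑< b (f ∘ q ∘ suc)) (∑< c (f ∘ r ∘ suc)))
    ; edge-sum = λ F F-sym → ≤-trans (≤-reflexive (lemma (∑< (suc a) (λ k → F (p k) (p (suc k))))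
        (∑< (suc c) (λ k → F (r k) (r (suc k)))) (∑< (suc b) (λ k → F (q k) (q (suc k)))))) (edge-sum F F-sym)
    }
    where
    open Theta θ
    lemma : ∀ x y z → x + y + z ≡ x + z + y
    lemma = solve-∀

  backwards : ℕ → (ℕ → Fin n) → ℕ → Fin n
  backwards a p k = p (suc a ∸ k)

  backwards-step : ∀ a (p : ℕ → Fin n) (R : Fin n → Fin n → Set) → (∀ {u v} → R u v → R v u) → (∀ k → k ≤ a → R (p k) (p (suc k))) →
    ∀ k → k ≤ a → R (backwards a p k) (backwards a p (suc k))
  backwards-step a p R R-sym h k k≤a = R-sym (subst (λ x → R (p (a ∸ k)) (p x)) (sym (ℕP.+-∸-assoc 1 k≤a)) (h (a ∸ k) (m∸n≤m a k)))

  unbackwards-step : ∀ a (p : ℕ → Fin n) (R : Fin n → Fin n → Set) → (∀ {u v} → R u v → R v u) →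
    (∀ k → k ≤ a → R (backwards a p k) (backwards a p (suc k))) → ∀ k → k ≤ a → R (p k) (p (suc k))
  unbackwards-step a p R R-sym h k k≤a = R-sym (subst₂ (λ x y → R (p x) (p y))
    (lia (a ∷ k ∷ []) (λ a k → k :≤ a :⇒ con 1 :+ a :∸ (a :∸ k) :≡ con 1 :+ k) k≤a) (ℕP.m∸[m∸n]≡n k≤a) (h (a ∸ k) (m∸n≤m a k)))

  -- Exchanges the two ends, so that an estimate for one half of `p` also serves for the other half.
  flip : (∀ u v → G u v ≡ G v u) → ∀ {a b c} → Theta a b c → Theta a b c
  flip G-sym {a} {b} {c} θ = record
    { p = backwards a p ; q = backwards b q ; r = backwards c r ; p₀≡q₀ = pₑ≡qₑ ; p₀≡r₀ = pₑ≡rₑ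
    ; pₑ≡qₑ = trans (cong p (ℕP.n∸n≡0 a)) (trans p₀≡q₀ (cong q (sym (ℕP.n∸n≡0 b))))
    ; pₑ≡rₑ = trans (cong p (ℕP.n∸n≡0 a)) (trans p₀≡r₀ (cong r (sym (ℕP.n∸n≡0 c))))
    ; 1≤a+b = 1≤a+b ; 1≤a+c = 1≤a+c ; 1≤b+c = 1≤b+c
    ; p-adj = backwards-step a p adjacent adjacent-sym p-adj
    ; q-adj = backwards-step b q adjacent adjacent-sym q-adj
    ; r-adj = backwards-step c r adjacent adjacent-sym r-adj
    ; cover = λ P hp hq hr → cover P (reflect a p P hp) (reflect b q P hq) (reflect c r P hr)
    ; edge-elim = λ R R-sym hp hq hr → edge-elim R R-sym (unbackwards-step a p R R-sym hp) (unbackwards-step b q R R-sym hq) (unbackwards-step c r R R-sym hr)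
    ; glue = λ φ ψ χ e₁ e₂ e₃ e₄ →
        let (f , fp , fq , fr) = glue (λ k → φ (suc a ∸ k)) (λ k → ψ (suc b ∸ k)) (λ k → χ (suc c ∸ k)) e₃ e₄
              (trans (cong φ (ℕP.n∸n≡0 a)) (trans e₁ (cong ψ (sym (ℕP.n∸n≡0 b)))))
              (trans (cong φ (ℕP.n∸n≡0 a)) (trans e₂ (cong χ (sym (ℕP.n∸n≡0 c)))))
        in f , reindex a p f φ fp , reindex b q f ψ fq , reindex c r f χ fr
    ; vertex-sum = λ f → trans (vertex-sum f) (trans
        (lemma (f (p 0)) (f (p (suc a))) (∑< a (f ∘ p ∘ suc)) (∑< b (f ∘ q ∘ suc)) (∑< c (f ∘ r ∘ suc)))
        (cong₂ _+_ (cong₂ _+_ (cong₂ _+_ (cong (λ x → f (p (suc a)) + f (p x)) (sym (ℕP.n∸n≡0 a))) (interior a p f)) (interior b q f)) (interior c r f)))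
    ; edge-sum = λ F F-sym → ≤-trans (≤-reflexive (cong₂ _+_ (cong₂ _+_ (steps a p F F-sym) (steps b q F F-sym)) (steps c r F F-sym))) (edge-sum F F-sym)
    }
    where
    open Theta θ
    adjacent : Fin n → Fin n → Set
    adjacent u v = G u v ≡ true
    adjacent-sym : ∀ {u v} → adjacent u v → adjacent v u
    adjacent-sym {u} {v} e = trans (G-sym v u) e
    lemma : ∀ x y a b c → x + y + a + b + c ≡ y + x + a + b + c
    lemma = solve-∀
    reflect : ∀ a p (P : Fin n → Set) → (∀ k → k ≤ suc a → P (backwards a p k)) → ∀ k → k ≤ suc a → P (p k)
    reflect a p P h k k≤ = subst (P ∘ p) (ℕP.m∸[m∸n]≡n k≤) (h (suc a ∸ k) (m∸n≤m (suc a) k))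
    reindex : ∀ a p (f : Fin n → ℕ) φ → (∀ k → k ≤ suc a → f (p k) ≡ φ (suc a ∸ k)) → ∀ k → k ≤ suc a → f (backwards a p k) ≡ φ k
    reindex a p f φ h k k≤ = trans (h (suc a ∸ k) (m∸n≤m (suc a) k)) (cong φ (ℕP.m∸[m∸n]≡n k≤))
    interior : ∀ a p (f : Fin n → ℕ) → ∑< a (f ∘ p ∘ suc) ≡ ∑< a (f ∘ backwards a p ∘ suc)
    interior a p f = trans (∑<-reverse a (f ∘ p ∘ suc)) (∑<-cong a (λ k k<a → cong (f ∘ p) (sym (ℕP.+-∸-assoc 1 k<a))))
    steps : ∀ a p (F : Fin n → Fin n → ℕ) → (∀ u v → F u v ≡ F v u) →
      ∑< (suc a) (λ k → F (backwards a p k) (backwards a p (suc k))) ≡ ∑< (suc a) (λ k → F (p k) (p (suc k)))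
    steps a p F F-sym = trans (∑<-cong (suc a) (λ { k (s≤s k≤a) → trans (F-sym (p (suc a ∸ k)) (p (a ∸ k)))
        (cong (λ x → F (p (a ∸ k)) (p x)) (ℕP.+-∸-assoc 1 k≤a)) }))
      (sym (∑<-reverse (suc a) (λ k → F (p k) (p (suc k)))))

module LassoTheta {n} (G : Graph n) (simple : IsSimple G) (conn : Connected G)
                (bicyclic : numEdges G ≡ suc n) (min-deg : ∀ v → 2 ≤ deg G v) where
  open Metric G simple conn using (G-sym)
  open Paths G simple
  open Bicyclic G simple conn bicyclic min-deg
  open Thetas G

  module _ {m} {path : Path m} (lasso : Lasso path) (b c : ℕ) where
    open Spanning lasso

    -- The branch vertices are `w i` and `w j`. From `w i`, the path `p` takes the first chord to
    -- `w 0` and climbs to `w j`, `q` descends directly to `w j`, and `r` climbs to `w m` and takes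
    -- the second chord.
    lasso-theta : suc j + b ≡ i → i + c ≡ m → Theta j b c
    lasso-theta i≡ m≡ = record
      { p = p ; q = q ; r = r ; p₀≡q₀ = refl
      ; p₀≡r₀ = trans (cong x (sym (+-identityʳ i))) (sym (r-inside 0 z≤n))
      ; pₑ≡qₑ = cong x (lia (i ∷ j ∷ b ∷ []) (λ i j b → con 1 :+ j :+ b :≡ i :⇒ j :≡ i :∸ (con 1 :+ b)) i≡)
      ; pₑ≡rₑ = sym (r-end (suc c) ≤-refl)
      ; 1≤a+b = lia (i ∷ j ∷ b ∷ []) (λ i j b → con 2 :≤ i :⇒ con 1 :+ j :+ b :≡ i :⇒ con 1 :≤ j :+ b) 2≤i i≡
      ; 1≤a+c = some distinct
      ; 1≤b+c = lia (i ∷ j ∷ b ∷ c ∷ m ∷ []) (λ i j b c m → con 2 :+ j :≤ m :⇒ con 1 :+ j :+ b :≡ i :⇒ i :+ c :≡ m :⇒ con 1 :≤ b :+ c) j+2≤m i≡ m≡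
      ; p-adj = p-adj ; q-adj = q-adj ; r-adj = r-adj
      ; cover = cover
      ; edge-elim = elim
      ; glue = glue
      ; vertex-sum = vsum
      ; edge-sum = λ F F-sym → ≤-trans (≤-reflexive (esum F F-sym)) (edge-sum F F-sym)
      }
      where
      x : ℕ → Fin n
      x = w path
      p q r : ℕ → Fin n
      p zero    = x i
      p (suc k) = x k
      q k = x (i ∸ k)
      r k = if does (k ℕ.≤? c) then x (i + k) else x j
      r-inside : ∀ k → k ≤ c → r k ≡ x (i + k)
      r-inside k k≤c = cong (if_then x (i + k) else x j) (dec-true (k ℕ.≤? c) k≤c)
      r-end : ∀ k → c < k → r k ≡ x j
      r-end k c<k = cong (if_then x (i + k) else x j) (dec-false (k ℕ.≤? c) (ℕP.<⇒≱ c<k))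
      i+k≤m : ∀ {k} → k ≤ c → i + k ≤ m
      i+k≤m {k} k≤c = ≤-trans (+-monoʳ-≤ i k≤c) (≤-reflexive m≡)
      j<i : j < i
      j<i = ≤-trans (m≤m+n (suc j) b) (≤-reflexive i≡)
      some : i < m ⊎ 0 < j → 1 ≤ j + c
      some (inj₁ i<m) = lia (i ∷ j ∷ c ∷ m ∷ []) (λ i j c m → i :< m :⇒ i :+ c :≡ m :⇒ con 1 :≤ j :+ c) i<m m≡
      some (inj₂ 0<j) = ≤-trans 0<j (m≤m+n j c)
      p-step : ∀ (R : Fin n → Fin n → Set) → R (x i) (x 0) → (∀ k → k < m → R (x k) (x (suc k))) → ∀ k → k ≤ j → R (p k) (p (suc k))
      p-step R s h zero    _   = s
      p-step R s h (suc k) k<j = h k (ℕP.<-≤-trans k<j (≤-trans (<⇒≤ j<i) i≤m))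
      q-index : ∀ k → k ≤ b → i ∸ k ≡ suc (i ∸ suc k)
      q-index k k≤b = lia (i ∷ j ∷ b ∷ k ∷ []) (λ i j b k → con 1 :+ j :+ b :≡ i :⇒ k :≤ b :⇒ i :∸ k :≡ con 1 :+ (i :∸ (con 1 :+ k))) i≡ k≤b
      q-step : ∀ (R : Fin n → Fin n → Set) → (∀ {u v} → R u v → R v u) → (∀ k → k < m → R (x k) (x (suc k))) → ∀ k → k ≤ b → R (q k) (q (suc k))
      q-step R R-sym h k k≤b = R-sym (subst (λ y → R (x (i ∸ suc k)) (x y)) (sym (q-index k k≤b)) (h (i ∸ suc k)
        (ℕP.<-≤-trans (≤-reflexive (sym (q-index k k≤b))) (≤-trans (m∸n≤m i k) i≤m))))
      r-step : ∀ (R : Fin n → Fin n → Set) → R (x m) (x j) → (∀ k → k < m → R (x k) (x (suc k))) → ∀ k → k ≤ c → R (r k) (r (suc k))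
      r-step R s h k k≤c with ℕP.m≤n⇒m<n∨m≡n k≤c
      ... | inj₁ k<c  = subst₂ R (sym (r-inside k k≤c)) (sym (trans (r-inside (suc k) k<c) (cong x (+-suc i k))))
                          (h (i + k) (≤-trans (≤-reflexive (sym (+-suc i k))) (i+k≤m k<c)))
      ... | inj₂ refl = subst₂ R (sym (trans (r-inside k k≤c) (cong x m≡))) (sym (r-end (suc k) ≤-refl)) s
      adjacent : Fin n → Fin n → Set
      adjacent u v = G u v ≡ true
      p-adj : ∀ k → k ≤ j → adjacent (p k) (p (suc k))
      p-adj = p-step adjacent (G-sym startEdge) (adj path)
      q-adj : ∀ k → k ≤ b → adjacent (q k) (q (suc k))
      q-adj = q-step adjacent G-sym (adj path)
      r-adj : ∀ k → k ≤ c → adjacent (r k) (r (suc k))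
      r-adj = r-step adjacent (G-sym endEdge) (adj path)
      data Place (k : ℕ) : Set where
        onP : k ≤ j → Place k
        onQ : ∀ t → t ≤ b → i ∸ t ≡ k → j < k → k ≤ i → Place k
        onR : ∀ t → t ≤ c → i + t ≡ k → i < k → Place k
      place : ∀ k → k ≤ m → Place k
      place k k≤m with k ℕ.≤? j
      ... | yes k≤j = onP k≤j
      ... | no k≰j with k ℕ.≤? i
      ...   | yes k≤i = onQ (i ∸ k) (lia (i ∷ j ∷ b ∷ k ∷ []) (λ i j b k → con 1 :+ j :+ b :≡ i :⇒ j :< k :⇒ i :∸ k :≤ b) i≡ (ℕP.≰⇒> k≰j))
                      (ℕP.m∸[m∸n]≡n k≤i) (ℕP.≰⇒> k≰j) k≤i
      ...   | no k≰i = onR (k ∸ i) (lia (i ∷ c ∷ m ∷ k ∷ []) (λ i c m k → i :+ c :≡ m :⇒ k :≤ m :⇒ k :∸ i :≤ c) m≡ k≤m)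
                      (m+[n∸m]≡n (<⇒≤ (ℕP.≰⇒> k≰i))) (ℕP.≰⇒> k≰i)
      cover : (P : Fin n → Set) → (∀ k → k ≤ suc j → P (p k)) → (∀ k → k ≤ suc b → P (q k)) → (∀ k → k ≤ suc c → P (r k)) → ∀ v → P v
      cover P hp hq hr v = subst P (w-ix v) (at (place (ix v) (ix≤m v)))
        where
        at : ∀ {k} → Place k → P (x k)
        at (onP k≤j)  = hp (suc _) (s≤s k≤j)
        at (onQ t t≤ refl _ _) = hq t (m≤n⇒m≤1+n t≤)
        at (onR t t≤ refl _)   = subst P (r-inside t t≤) (hr t (m≤n⇒m≤1+n t≤))
      elim : (R : Fin n → Fin n → Set) → (∀ {u v} → R u v → R v u) → (∀ k → k ≤ j → R (p k) (p (suc k))) →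
        (∀ k → k ≤ b → R (q k) (q (suc k))) → (∀ k → k ≤ c → R (r k) (r (suc k))) → ∀ u v → G u v ≡ true → R u v
      elim R R-sym hp hq hr = edge-elim R R-sym steps (R-sym (hp 0 z≤n))
          (R-sym (subst₂ R (trans (r-inside c ≤-refl) (cong x m≡)) (r-end (suc c) ≤-refl) (hr c ≤-refl)))
        where
        steps : ∀ k → k < m → R (x k) (x (suc k))
        steps k k<m with place (suc k) k<m
        ... | onP k<j = hp (suc k) k<j
        ... | onQ t t≤b eq j<k k≤i = R-sym (subst₂ (λ y z → R (x y) (x z)) eq
                (lia (i ∷ t ∷ k ∷ []) (λ i t k → i :∸ t :≡ con 1 :+ k :⇒ i :∸ (con 1 :+ t) :≡ k) eq) (hq t t≤b))
        ... | onR zero t≤c eq i<k = ⊥-elim (ℕP.<⇒≢ i<k (trans (sym (+-identityʳ i)) eq))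
        ... | onR (suc t) t≤c eq i<k = subst₂ R (trans (r-inside t (<⇒≤ t≤c)) (cong x (ℕP.suc-injective (trans (sym (+-suc i t)) eq))))
                (trans (r-inside (suc t) t≤c) (cong x eq)) (hr t (<⇒≤ t≤c))
      glue : (φ ψ χ : ℕ → ℕ) → φ 0 ≡ ψ 0 → φ 0 ≡ χ 0 → φ (suc j) ≡ ψ (suc b) → φ (suc j) ≡ χ (suc c) →
        ∃ λ (f : Fin n → ℕ) → (∀ k → k ≤ suc j → f (p k) ≡ φ k) × (∀ k → k ≤ suc b → f (q k) ≡ ψ k) × (∀ k → k ≤ suc c → f (r k) ≡ χ k)
      glue φ ψ χ e₁ e₂ e₃ e₄ = f , f-p , f-q , f-r
        where
        h : ℕ → ℕ
        h k = if does (k ℕ.≤? j) then φ (suc k) else (if does (k ℕ.≤? i) then ψ (i ∸ k) else χ (k ∸ i))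
        h-p : ∀ {k} → k ≤ j → h k ≡ φ (suc k)
        h-p {k} k≤j rewrite dec-true (k ℕ.≤? j) k≤j = refl
        h-q : ∀ {k} → j < k → k ≤ i → h k ≡ ψ (i ∸ k)
        h-q {k} j<k k≤i rewrite dec-false (k ℕ.≤? j) (ℕP.<⇒≱ j<k) | dec-true (k ℕ.≤? i) k≤i = refl
        h-r : ∀ {k} → i < k → h k ≡ χ (k ∸ i)
        h-r {k} i<k rewrite dec-false (k ℕ.≤? j) (ℕP.<⇒≱ (ℕP.<-trans j<i i<k)) | dec-false (k ℕ.≤? i) (ℕP.<⇒≱ i<k) = refl
        f : Fin n → ℕ
        f v = h (ix v)
        f-x : ∀ k → k ≤ m → f (x k) ≡ h k
        f-x k k≤m = cong h (ix-w k k≤m)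
        f-xi : f (x i) ≡ ψ 0
        f-xi = trans (f-x i i≤m) (trans (h-q j<i ≤-refl) (cong ψ (ℕP.n∸n≡0 i)))
        f-xj : f (x j) ≡ φ (suc j)
        f-xj = trans (f-x j (≤-trans (<⇒≤ j<i) i≤m)) (h-p ≤-refl)
        f-p : ∀ k → k ≤ suc j → f (p k) ≡ φ k
        f-p zero    _  = trans f-xi (sym e₁)
        f-p (suc k) (s≤s k≤j) = trans (f-x k (≤-trans k≤j (≤-trans (<⇒≤ j<i) i≤m))) (h-p k≤j)
        f-q : ∀ k → k ≤ suc b → f (q k) ≡ ψ k
        f-q k k≤ with ℕP.m≤n⇒m<n∨m≡n k≤
        ... | inj₁ (s≤s k≤b) = trans (f-x (i ∸ k) (≤-trans (m∸n≤m i k) i≤m))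
                (trans (h-q (lia (i ∷ j ∷ b ∷ k ∷ []) (λ i j b k → con 1 :+ j :+ b :≡ i :⇒ k :≤ b :⇒ j :< i :∸ k) i≡ k≤b) (m∸n≤m i k))
                  (cong ψ (ℕP.m∸[m∸n]≡n (≤-trans k≤b (≤-trans (ℕP.m≤n+m b (suc j)) (≤-reflexive i≡))))))
        ... | inj₂ refl = trans (cong (λ y → f (x y)) (lia (i ∷ j ∷ b ∷ []) (λ i j b → con 1 :+ j :+ b :≡ i :⇒ i :∸ (con 1 :+ b) :≡ j) i≡))
                (trans f-xj e₃)
        f-r : ∀ k → k ≤ suc c → f (r k) ≡ χ k
        f-r zero    _ = trans (cong f (trans (r-inside 0 z≤n) (cong x (+-identityʳ i)))) (trans f-xi (trans (sym e₁) e₂))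
        f-r (suc k) (s≤s k≤c) with ℕP.m≤n⇒m<n∨m≡n k≤c
        ... | inj₁ k<c  = trans (cong f (r-inside (suc k) k<c)) (trans (f-x (i + suc k) (i+k≤m k<c))
                (trans (h-r (lia (i ∷ k ∷ []) (λ i k → i :< i :+ (con 1 :+ k)))) (cong χ (ℕP.m+n∸m≡n i (suc k)))))
        ... | inj₂ refl = trans (cong f (r-end (suc k) ≤-refl)) (trans f-xj e₄)
      vsum : ∀ f → sum f ≡ f (p 0) + f (p (suc j)) + ∑< j (f ∘ p ∘ suc) + ∑< b (f ∘ q ∘ suc) + ∑< c (f ∘ r ∘ suc)
      vsum f = begin
        sum f  ≡⟨ vertex-sum f ⟩
        ∑< (suc m) y  ≡⟨ cong (λ z → ∑< z y) (lia (i ∷ j ∷ b ∷ c ∷ m ∷ []) (λ i j b c m →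
                                                                          con 1 :+ j :+ b :≡ i :⇒ i :+ c :≡ m :⇒ con 1 :+ m :≡ j :+ (con 1 :+ (b :+ (con 1 :+ c)))) i≡ m≡) ⟩
        ∑< (j + (1 + (b + (1 + c)))) y  ≡⟨ ∑<-split j (1 + (b + (1 + c))) y ⟩
        ∑< j y + ∑< (1 + (b + (1 + c))) (λ k → y (j + k))
          ≡⟨ cong (λ z → ∑< j y + (y (j + 0) + z)) (∑<-split b (1 + c) (λ k → y (j + suc k))) ⟩
        ∑< j y + (y (j + 0) + (∑< b (λ k → y (j + suc k)) + (y (j + suc (b + 0)) + ∑< c (λ k → y (j + suc (b + suc k))))))
          ≡⟨ cong₂ (λ z z′ → ∑< j y + (y z + (∑< b (λ k → y (j + suc k)) + (y z′ + ∑< c (λ k → y (j + suc (b + suc k)))))))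
               (+-identityʳ j) (lia (i ∷ j ∷ b ∷ []) (λ i j b → con 1 :+ j :+ b :≡ i :⇒ j :+ (con 1 :+ (b :+ con 0)) :≡ i) i≡) ⟩
        ∑< j y + (y j + (∑< b (λ k → y (j + suc k)) + (y i + ∑< c (λ k → y (j + suc (b + suc k))))))
          ≡⟨ cong₂ (λ z z′ → ∑< j y + (y j + (z + (y i + z′)))) middle last ⟩
        ∑< j y + (y j + (∑< b (f ∘ q ∘ suc) + (y i + ∑< c (f ∘ r ∘ suc))))
          ≡⟨ lemma (y i) (y j) (∑< j y) (∑< b (f ∘ q ∘ suc)) (∑< c (f ∘ r ∘ suc)) ⟩
        y i + y j + ∑< j y + ∑< b (f ∘ q ∘ suc) + ∑< c (f ∘ r ∘ suc) ∎
        where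
        open ≡-Reasoning
        y : ℕ → ℕ
        y = f ∘ x
        lemma : ∀ s t u v z → u + (t + (v + (s + z))) ≡ s + t + u + v + z
        lemma = solve-∀
        middle : ∑< b (λ k → y (j + suc k)) ≡ ∑< b (f ∘ q ∘ suc)
        middle = trans (∑<-reverse b (λ k → y (j + suc k))) (∑<-cong b (λ k k<b → cong y
          (lia (i ∷ j ∷ b ∷ k ∷ []) (λ i j b k → con 1 :+ j :+ b :≡ i :⇒ k :< b :⇒ j :+ (con 1 :+ (b :∸ (con 1 :+ k))) :≡ i :∸ (con 1 :+ k)) i≡ k<b)))
        last : ∑< c (λ k → y (j + suc (b + suc k))) ≡ ∑< c (f ∘ r ∘ suc)
        last = ∑<-cong c (λ k k<c → trans (cong y (lia (i ∷ j ∷ b ∷ k ∷ []) (λ i j b k → con 1 :+ j :+ b :≡ i :⇒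
          j :+ (con 1 :+ (b :+ (con 1 :+ k))) :≡ i :+ (con 1 :+ k)) i≡)) (cong f (sym (r-inside (suc k) k<c))))
      esum : ∀ F → (∀ u v → F u v ≡ F v u) →
        ∑< (suc j) (λ k → F (p k) (p (suc k))) + ∑< (suc b) (λ k → F (q k) (q (suc k))) + ∑< (suc c) (λ k → F (r k) (r (suc k)))
          ≡ ∑< m (λ k → F (x k) (x (suc k))) + F (x 0) (x i) + F (x j) (x m)
      esum F F-sym = sym (begin
        ∑< m y + F (x 0) (x i) + F (x j) (x m)
          ≡⟨ cong (λ z → ∑< z y + F (x 0) (x i) + F (x j) (x m)) (lia (i ∷ j ∷ b ∷ c ∷ m ∷ []) (λ i j b c m →
               con 1 :+ j :+ b :≡ i :⇒ i :+ c :≡ m :⇒ m :≡ j :+ (con 1 :+ b :+ c)) i≡ m≡) ⟩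
        ∑< (j + (suc b + c)) y + F (x 0) (x i) + F (x j) (x m)
          ≡⟨ cong (λ z → z + F (x 0) (x i) + F (x j) (x m)) (trans (∑<-split j (suc b + c) y)
               (cong (∑< j y +_) (∑<-split (suc b) c (λ k → y (j + k))))) ⟩
        ∑< j y + (∑< (suc b) (λ k → y (j + k)) + ∑< c (λ k → y (j + (suc b + k)))) + F (x 0) (x i) + F (x j) (x m)
          ≡⟨ cong₂ (λ z z′ → ∑< j y + (z + z′) + F (x 0) (x i) + F (x j) (x m)) middle last ⟩
        ∑< j y + (∑< (suc b) (λ k → F (q k) (q (suc k))) + ∑< c (λ k → F (r k) (r (suc k)))) + F (x 0) (x i) + F (x j) (x m)
          ≡⟨ cong₂ (λ z z′ → ∑< j y + (∑< (suc b) (λ k → F (q k) (q (suc k))) + ∑< c (λ k → F (r k) (r (suc k)))) + z + z′)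
               (F-sym (x 0) (x i)) (trans (F-sym (x j) (x m)) (cong₂ F (sym (trans (r-inside c ≤-refl) (cong x m≡))) (sym (r-end (suc c) ≤-refl)))) ⟩
        ∑< j y + (∑< (suc b) (λ k → F (q k) (q (suc k))) + ∑< c (λ k → F (r k) (r (suc k)))) + F (x i) (x 0) + F (r c) (r (suc c))
          ≡⟨ lemma (∑< j y) (∑< (suc b) (λ k → F (q k) (q (suc k)))) (∑< c (λ k → F (r k) (r (suc k)))) (F (x i) (x 0)) (F (r c) (r (suc c))) ⟩
        F (x i) (x 0) + ∑< j y + ∑< (suc b) (λ k → F (q k) (q (suc k))) + (∑< c (λ k → F (r k) (r (suc k))) + F (r c) (r (suc c)))
          ≡⟨ cong (F (x i) (x 0) + ∑< j y + ∑< (suc b) (λ k → F (q k) (q (suc k))) +_) (∑<-last c (λ k → F (r k) (r (suc k)))) ⟨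
        F (x i) (x 0) + ∑< j y + ∑< (suc b) (λ k → F (q k) (q (suc k))) + ∑< (suc c) (λ k → F (r k) (r (suc k))) ∎)
        where
        open ≡-Reasoning
        y : ℕ → ℕ
        y k = F (x k) (x (suc k))
        lemma : ∀ s t u v z → s + (t + u) + v + z ≡ v + s + t + (u + z)
        lemma = solve-∀
        middle : ∑< (suc b) (λ k → y (j + k)) ≡ ∑< (suc b) (λ k → F (q k) (q (suc k)))
        middle = trans (∑<-reverse (suc b) (λ k → y (j + k))) (∑<-cong (suc b) (λ { k (s≤s k≤b) →
          trans (F-sym (x (j + (b ∸ k))) (x (suc (j + (b ∸ k))))) (cong₂ (λ s t → F (x s) (x t))
            (lia (i ∷ j ∷ b ∷ k ∷ []) (λ i j b k → con 1 :+ j :+ b :≡ i :⇒ k :≤ b :⇒ con 1 :+ (j :+ (b :∸ k)) :≡ i :∸ k) i≡ k≤b)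
            (lia (i ∷ j ∷ b ∷ k ∷ []) (λ i j b k → con 1 :+ j :+ b :≡ i :⇒ k :≤ b :⇒ j :+ (b :∸ k) :≡ i :∸ (con 1 :+ k)) i≡ k≤b)) }))
        last : ∑< c (λ k → y (j + (suc b + k))) ≡ ∑< c (λ k → F (r k) (r (suc k)))
        last = ∑<-cong c (λ k k<c → cong₂ F
          (trans (cong x (lia (i ∷ j ∷ b ∷ k ∷ []) (λ i j b k → con 1 :+ j :+ b :≡ i :⇒ j :+ (con 1 :+ b :+ k) :≡ i :+ k) i≡)) (sym (r-inside k (<⇒≤ k<c))))
          (trans (cong x (lia (i ∷ j ∷ b ∷ k ∷ []) (λ i j b k → con 1 :+ j :+ b :≡ i :⇒ con 1 :+ (j :+ (con 1 :+ b :+ k)) :≡ i :+ (con 1 :+ k)) i≡)) (sym (r-inside (suc k) k<c))))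

-- The vertex `r (t + 1)` is `t + 1` steps from one end of `r` and `c − t` from the other. `M c e`
-- sums the shorter approach over the interior of `r` when the far end is reached at an extra cost
-- of `e`.
M : ℕ → ℕ → ℕ
M c e = ∑< c (λ t → suc t ⊓ (c ∸ t + e))

-- Removing the two outermost vertices shortens the approach to each of the `c` inner ones by one;
-- the removed terms are `1` and `(2 + c) ⊓ (1 + e)`.
M-step : ∀ c e → M (2 + c) e ≡ 1 + c + M c e + (2 + c) ⊓ (1 + e)
M-step c e = begin
  1 + ∑< (suc c) (λ t → suc (suc t) ⊓ (suc c ∸ t + e))
    ≡⟨ cong suc (∑<-last c (λ t → suc (suc t) ⊓ (suc c ∸ t + e))) ⟩
  1 + (∑< c (λ t → suc (suc t) ⊓ (suc c ∸ t + e)) + suc (suc c) ⊓ (suc c ∸ c + e))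
    ≡⟨ cong₂ (λ x y → 1 + (x + suc (suc c) ⊓ (y + e))) shift (ℕP.m+n∸n≡m 1 c) ⟩
  1 + (c + M c e + (2 + c) ⊓ (1 + e)) ∎
  where
  open ≡-Reasoning
  shift : ∑< c (λ t → suc (suc t) ⊓ (suc c ∸ t + e)) ≡ c + M c e
  shift = trans (∑<-cong c (λ t t<c → lia (c ∷ t ∷ e ∷ []) (λ c t e → t :< c :⇒
      (con 2 :+ t) :⊓ (con 1 :+ c :∸ t :+ e) :≡ con 1 :+ (con 1 :+ t) :⊓ (c :∸ t :+ e)) t<c))
    (trans (∑<-+ c (λ _ → 1) (λ t → suc t ⊓ (c ∸ t + e))) (cong (_+ M c e) (trans (∑<-const c 1) (*-identityʳ c))))

-- The gain in D of the midpoint of p over its end, once the vertices of p and q, which form a cycle, have cancelled.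
gain-bound : ∀ {a b h ε} → suc a ≡ h + h + ε → ε ≤ 1 → b ≤ a → 1 ≤ h → ∀ c → M (2 + c) (suc b) + a ≤ (2 + c) * h + M (2 + c) ε
gain-bound {a} {b} {h} {ε} a≡ ε≤1 b≤a 1≤h zero = lia (a ∷ b ∷ h ∷ ε ∷ M 2 (suc b) ∷ M 2 ε ∷ []) (λ a b h e x y →
  con 1 :+ a :≡ h :+ h :+ e :⇒ e :≤ con 1 :⇒ b :≤ a :⇒ con 1 :≤ h :⇒ x :≡ con 1 :+ (con 2 :⊓ (con 2 :+ b)) :⇒ y :≡ con 1 :+ (con 2 :⊓ (con 1 :+ e)) :⇒
  x :+ a :≤ 2 :* h :+ y) a≡ ε≤1 b≤a 1≤h (M-step 0 (suc b)) (M-step 0 ε)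
gain-bound {a} {b} {h} {ε} a≡ ε≤1 b≤a 1≤h (suc zero) = lia (a ∷ b ∷ h ∷ ε ∷ M 3 (suc b) ∷ M 3 ε ∷ []) (λ a b h e x y →
  con 1 :+ a :≡ h :+ h :+ e :⇒ e :≤ con 1 :⇒ b :≤ a :⇒ con 1 :≤ h :⇒ x :≡ con 3 :+ (con 3 :⊓ (con 2 :+ b)) :⇒ y :≡ con 3 :+ (con 3 :⊓ (con 1 :+ e)) :⇒
  x :+ a :≤ 3 :* h :+ y) a≡ ε≤1 b≤a 1≤h (M-step 1 (suc b)) (M-step 1 ε)
-- By `M-step` two more vertices increase the sides by at most `2 + b` and by exactly `2h + 1 + ε`;
-- the latter is `a + 2`, so `b ≤ a` is enough.
gain-bound {a} {b} {h} {ε} a≡ ε≤1 b≤a 1≤h (suc (suc c)) =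
  lia (a ∷ b ∷ h ∷ ε ∷ c ∷ M (4 + c) (suc b) ∷ M (4 + c) ε ∷ M (2 + c) (suc b) ∷ M (2 + c) ε ∷ (2 + c) * h ∷ []) (λ a b h e c x y x′ y′ k →
  con 1 :+ a :≡ h :+ h :+ e :⇒ e :≤ con 1 :⇒ b :≤ a :⇒ x :≡ con 3 :+ c :+ x′ :+ (con 4 :+ c) :⊓ (con 2 :+ b) :⇒
  y :≡ con 3 :+ c :+ y′ :+ (con 4 :+ c) :⊓ (con 1 :+ e) :⇒ x′ :+ a :≤ k :+ y′ :⇒
  x :+ a :≤ h :+ (h :+ k) :+ y) a≡ ε≤1 b≤a (M-step (2 + c) (suc b)) (M-step (2 + c) ε) (gain-bound {a} {b} {h} {ε} a≡ ε≤1 b≤a 1≤h c)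

-- For `a = 1` and `b = 0` the estimate of `gain-bound` gives a gain of `1`. Three interior vertices
-- on the third path raise it to `2`.
gain-triangle : ∀ c → M (3 + c) 1 + 2 ≤ (3 + c) * 1 + M (3 + c) 0
gain-triangle zero    = ℕP.≤ᵇ⇒≤ _ _ tt
gain-triangle (suc zero) = ℕP.≤ᵇ⇒≤ _ _ tt
gain-triangle (suc (suc c)) =
  lia (c ∷ M (5 + c) 1 ∷ M (5 + c) 0 ∷ M (3 + c) 1 ∷ M (3 + c) 0 ∷ (3 + c) * 1 ∷ []) (λ c x y x′ y′ k →
  x :≡ con 4 :+ c :+ x′ :+ (con 5 :+ c) :⊓ con 2 :⇒ y :≡ con 4 :+ c :+ y′ :+ (con 5 :+ c) :⊓ con 1 :⇒ x′ :+ con 2 :≤ k :+ y′ :⇒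
  x :+ con 2 :≤ con 2 :+ k :+ y) (M-step (3 + c) 1) (M-step (3 + c) 0) (gain-triangle c)

halve : ∀ a → ∃ λ h → ∃ λ ε → a ≡ h + h + ε × ε ≤ 1
halve zero = 0 , 0 , refl , z≤n
halve (suc zero) = 0 , 1 , refl , s≤s z≤n
halve (suc (suc a)) with halve a
... | h , ε , eq , ε≤1 = suc h , ε , trans (cong (2 +_) eq) (lia (h ∷ ε ∷ []) (λ h e → con 2 :+ (h :+ h :+ e) :≡ con 1 :+ h :+ (con 1 :+ h) :+ e)) , ε≤1

-- Lower bounds for `S` in theta graphs

module ThetaBounds {n} (G : Graph n) (simple : IsSimple G) (conn : Connected G) where
  open Metric G simple conn
  open Gaps G simple conn
  open Thetas G

  d-forth : ∀ a (p : ℕ → Fin n) → (∀ k → k ≤ a → G (p k) (p (suc k)) ≡ true) → ∀ k → k ≤ suc a → d (p 0) (p k) ≤ k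
  d-forth a p adj k k≤ = d-walk p (λ k k< → adj k (≤-pred k<)) 0 k k≤

  d-back : ∀ a (p : ℕ → Fin n) → (∀ k → k ≤ a → G (p k) (p (suc k)) ≡ true) → ∀ k → k ≤ suc a → d (p (suc a)) (p k) ≤ suc a ∸ k
  d-back a p adj k k≤ = subst (_≤ suc a ∸ k) (d-sym (p k) (p (suc a))) (subst (λ x → d (p k) (p x) ≤ suc a ∸ k) (m+[n∸m]≡n k≤)
    (d-walk p (λ k k< → adj k (≤-pred k<)) k (suc a ∸ k) (≤-reflexive (m+[n∸m]≡n k≤))))

  module Midpoint {a b c} (θ : Theta a b c) (h ε : ℕ) (a≡ : suc a ≡ h + h + ε) (ε≤1 : ε ≤ 1) where
    open Theta θ

    g : ℕ
    g = suc (suc a) + b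

    -- Position of `q k` on the cycle formed by `p` and `q`: `p` occupies `0`, ..., `a + 1` and `q`
    -- is run through backwards from there. The vertex `q 0` receives position `g`, which `cyc` does
    -- not distinguish from `0`.
    around : ℕ → ℕ → ℕ
    around s k = cyc g s (suc a + (suc b ∸ k))

    -- The length of the best route from the midpoint into `r`, entering at `p 0` after `h` steps or
    -- at `p (a + 1)` after `h + ε`.
    χ : ℕ → ℕ
    χ t = (h + t) ⊓ (h + ε + (suc c ∸ t))

    cycle-sum : ∀ s → cyc g s 0 + cyc g s (suc a) + ∑< a (cyc g s ∘ suc) + ∑< b (around s ∘ suc) ≡ ∑< g (cyc g s)
    cycle-sum s = sym (begin
      ∑< g (cyc g s)
        ≡⟨ ∑<-split (suc (suc a)) b (cyc g s) ⟩
      cyc g s 0 + ∑< (suc a) (cyc g s ∘ suc) + ∑< b (λ k → cyc g s (suc (suc a) + k))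
        ≡⟨ cong₂ (λ x y → cyc g s 0 + x + y) (∑<-last a (cyc g s ∘ suc)) reversed ⟩
      cyc g s 0 + (∑< a (cyc g s ∘ suc) + cyc g s (suc a)) + ∑< b (around s ∘ suc)
        ≡⟨ lemma (cyc g s 0) (∑< a (cyc g s ∘ suc)) (cyc g s (suc a)) (∑< b (around s ∘ suc)) ⟩
      cyc g s 0 + cyc g s (suc a) + ∑< a (cyc g s ∘ suc) + ∑< b (around s ∘ suc) ∎)
      where
      open ≡-Reasoning
      lemma : ∀ x y z w → x + (y + z) + w ≡ x + z + y + w
      lemma = solve-∀
      reversed : ∑< b (λ k → cyc g s (suc (suc a) + k)) ≡ ∑< b (around s ∘ suc)
      reversed = trans (∑<-reverse b (λ k → cyc g s (suc (suc a) + k))) (∑<-cong b (λ k k<b → cong (cyc g s)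
        (lia (a ∷ b ∷ k ∷ []) (λ a b k → k :< b :⇒ con 2 :+ a :+ (b :∸ (con 1 :+ k)) :≡ con 1 :+ a :+ (b :∸ k)) k<b)))

    h≤g : h + h ≤ suc a
    h≤g = lia (a ∷ h ∷ ε ∷ []) (λ a h e → con 1 :+ a :≡ h :+ h :+ e :⇒ h :+ h :≤ con 1 :+ a) a≡

    -- The three prescriptions agree at the ends because these lie at `h` and `h + ε` from the
    -- midpoint with `ε ≤ 1`: whatever the length of `r`, passing through it from one end to the
    -- other is no shortcut. The values on the cycle are therefore its own cyclic distances.
    potential : ∃ λ (f : Fin n → ℕ) → (∀ k → k ≤ suc a → f (p k) ≡ cyc g h k) × (∀ k → k ≤ suc b → f (q k) ≡ around h k) ×
                                      (∀ k → k ≤ suc c → f (r k) ≡ χ k)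
    potential = glue (cyc g h) (around h) χ
      (trans from-h (sym (trans (cyc-≤ g (lia (a ∷ b ∷ h ∷ []) (λ a b h → h :+ h :≤ con 1 :+ a :⇒ h :≤ con 1 :+ a :+ (con 1 :+ b)) h≤g))
        (lia (a ∷ b ∷ h ∷ con′ ∷ []) (λ a b h x → h :+ h :≤ con 1 :+ a :⇒ x :≡ con 1 :+ a :+ (con 1 :+ b) :∸ h :⇒
          x :⊓ (con 2 :+ a :+ b :∸ x) :≡ h) h≤g refl))))
      (trans from-h (sym (lia (h ∷ ε ∷ c ∷ []) (λ h e c → (h :+ con 0) :⊓ (h :+ e :+ (con 1 :+ c)) :≡ h))))
      (cong (cyc g h) (sym (trans (cong (suc a +_) (ℕP.n∸n≡0 b)) (+-identityʳ (suc a)))))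
      (trans (cyc-≤ g (≤-trans (m≤m+n h h) h≤g)) (trans (cong (arc g) (lia (a ∷ h ∷ ε ∷ []) (λ a h e → con 1 :+ a :≡ h :+ h :+ e :⇒ con 1 :+ a :∸ h :≡ h :+ e) a≡))
        (lia (a ∷ b ∷ c ∷ h ∷ ε ∷ []) (λ a b c h e → con 1 :+ a :≡ h :+ h :+ e :⇒ e :≤ con 1 :⇒
          (h :+ e) :⊓ (con 2 :+ a :+ b :∸ (h :+ e)) :≡ (h :+ (con 1 :+ c)) :⊓ (h :+ e :+ (c :∸ c))) a≡ ε≤1)))
      where
      con′ = suc a + suc b ∸ h
      from-h : cyc g h 0 ≡ h
      from-h = trans (cyc-≥ g z≤n) (lia (a ∷ b ∷ h ∷ []) (λ a b h → h :+ h :≤ con 1 :+ a :⇒ h :⊓ (con 2 :+ a :+ b :∸ h) :≡ h) h≤g)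

    f : Fin n → ℕ
    f = proj₁ potential
    f-p = proj₁ (proj₂ potential)
    f-q = proj₁ (proj₂ (proj₂ potential))
    f-r = proj₂ (proj₂ (proj₂ potential))

    f-near : ∀ u v → G u v ≡ true → Near (f u) (f v)
    f-near = edge-elim (λ u v → Near (f u) (f v)) near-sym
      (λ k k≤a → subst₂ Near (sym (f-p k (m≤n⇒m≤1+n k≤a))) (sym (f-p (suc k) (s≤s k≤a))) (cyc-near g h k))
      (λ k k≤b → subst₂ Near (sym (f-q k (m≤n⇒m≤1+n k≤b))) (sym (f-q (suc k) (s≤s k≤b)))
        (near-sym (subst (λ x → Near (around h (suc k)) (cyc g h x))
          (lia (a ∷ b ∷ k ∷ []) (λ a b k → k :≤ b :⇒ con 1 :+ (con 1 :+ a :+ (b :∸ k)) :≡ con 1 :+ a :+ (con 1 :+ b :∸ k)) k≤b)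
          (cyc-near g h (suc a + (b ∸ k))))))
      (λ k k≤c → subst₂ Near (sym (f-r k (m≤n⇒m≤1+n k≤c))) (sym (f-r (suc k) (s≤s k≤c)))
        (lia (h ∷ ε ∷ c ∷ k ∷ []) (λ h e c k → k :≤ c :⇒ (h :+ k) :⊓ (h :+ e :+ (con 1 :+ c :∸ k)) :≤ con 1 :+ (h :+ (con 1 :+ k)) :⊓ (h :+ e :+ (c :∸ k))) k≤c ,
         lia (h ∷ ε ∷ c ∷ k ∷ []) (λ h e c k → k :≤ c :⇒ (h :+ (con 1 :+ k)) :⊓ (h :+ e :+ (c :∸ k)) :≤ con 1 :+ (h :+ k) :⊓ (h :+ e :+ (con 1 :+ c :∸ k))) k≤c))

    f≤d : ∀ v → f v ≤ d (p h) v
    f≤d v = ≤-trans (d-lower (λ x y e → proj₂ (f-near x y e)) (p h) v)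
      (≤-reflexive (trans (cong (d (p h) v +_) (trans (f-p h (≤-trans (m≤m+n h h) h≤g)) (cyc-refl g h))) (+-identityʳ _)))

    from-end-p : ∀ k → k ≤ suc a → d (p 0) (p k) ≤ cyc g 0 k
    from-end-p k k≤ = ℕP.⊓-glb (d-forth a p p-adj k k≤) (begin
      d (p 0) (p k)  ≤⟨ d-triangle (p 0) (p (suc a)) (p k) ⟩
      d (p 0) (p (suc a)) + d (p (suc a)) (p k)    ≤⟨ +-mono-≤ (subst₂ (λ x y → d x y ≤ suc b) (sym p₀≡q₀) (sym pₑ≡qₑ) (d-forth b q q-adj (suc b) ≤-refl)) (d-back a p p-adj k k≤) ⟩
      suc b + (suc a ∸ k)  ≡⟨ lia (a ∷ b ∷ k ∷ []) (λ a b k → k :≤ con 1 :+ a :⇒ con 1 :+ b :+ (con 1 :+ a :∸ k) :≡ con 2 :+ a :+ b :∸ k) k≤ ⟩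
      g ∸ k  ∎)
      where open ℕP.≤-Reasoning

    from-end-q : ∀ k → k ≤ suc b → d (p 0) (q k) ≤ around 0 k
    from-end-q k k≤ = ℕP.⊓-glb (begin
      d (p 0) (q k)  ≤⟨ d-triangle (p 0) (p (suc a)) (q k) ⟩
      d (p 0) (p (suc a)) + d (p (suc a)) (q k)    ≤⟨ +-mono-≤ (d-forth a p p-adj (suc a) ≤-refl) (subst (λ x → d x (q k) ≤ suc b ∸ k) (sym pₑ≡qₑ) (d-back b q q-adj k k≤)) ⟩
      suc a + (suc b ∸ k)  ∎)
      (≤-trans (subst (λ x → d x (q k) ≤ k) (sym p₀≡q₀) (d-forth b q q-adj k k≤))
        (lia (a ∷ b ∷ k ∷ []) (λ a b k → k :≤ con 1 :+ b :⇒ k :≤ con 2 :+ a :+ b :∸ (con 1 :+ a :+ (con 1 :+ b :∸ k))) k≤))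
      where open ℕP.≤-Reasoning

    from-end-r : ∀ t → t < c → d (p 0) (r (suc t)) ≤ suc t ⊓ (c ∸ t + suc b)
    from-end-r t t<c = ℕP.⊓-glb (subst (λ x → d x (r (suc t)) ≤ suc t) (sym p₀≡r₀) (d-forth c r r-adj (suc t) (m≤n⇒m≤1+n t<c))) (begin
      d (p 0) (r (suc t))  ≤⟨ d-triangle (p 0) (p (suc a)) (r (suc t)) ⟩
      d (p 0) (p (suc a)) + d (p (suc a)) (r (suc t))    ≤⟨ +-mono-≤ (subst₂ (λ x y → d x y ≤ suc b) (sym p₀≡q₀) (sym pₑ≡qₑ) (d-forth b q q-adj (suc b) ≤-refl))
                                                              (subst (λ x → d x (r (suc t)) ≤ c ∸ t) (sym pₑ≡rₑ) (d-back c r r-adj (suc t) (m≤n⇒m≤1+n t<c))) ⟩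
      suc b + (c ∸ t)  ≡⟨ +-comm (suc b) (c ∸ t) ⟩
      c ∸ t + suc b  ∎)
      where open ℕP.≤-Reasoning

    -- On the cycle of `p` and `q` the upper bound for `p 0` and the lower bound for `p h` are the
    -- same sum, by rotation. On `r` the upper bound from `p 0` reaches the far end along `q`, which
    -- costs `b + 1`; the lower bound from `p h` spends `h` on leaving `p` and then differs between
    -- the ends by `ε`.
    midpoint-gain : D (p 0) + (c * h + M c ε) ≤ D (p h) + M c (suc b)
    midpoint-gain = begin
      D (p 0) + (c * h + M c ε)  ≤⟨ +-monoˡ-≤ (c * h + M c ε) upper ⟩
      ∑< g (cyc g 0) + M c (suc b) + (c * h + M c ε)  ≡⟨ lemma (∑< g (cyc g 0)) (M c (suc b)) (c * h + M c ε) ⟩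
      ∑< g (cyc g 0) + (c * h + M c ε) + M c (suc b)  ≡⟨ cong (λ x → x + (c * h + M c ε) + M c (suc b)) (∑<-cyc g h h<g) ⟨
      ∑< g (cyc g h) + (c * h + M c ε) + M c (suc b)  ≤⟨ +-monoˡ-≤ (M c (suc b)) lower ⟩
      D (p h) + M c (suc b)  ∎
      where
      open ℕP.≤-Reasoning
      lemma : ∀ x y z → x + y + z ≡ x + z + y
      lemma = solve-∀
      h<g : h < g
      h<g = lia (a ∷ b ∷ h ∷ []) (λ a b h → h :+ h :≤ con 1 :+ a :⇒ h :< con 2 :+ a :+ b) h≤g
      upper : D (p 0) ≤ ∑< g (cyc g 0) + M c (suc b)
      upper = ≤-trans (≤-reflexive (vertex-sum (d (p 0)))) (+-mono-≤ (≤-trans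
        (+-mono-≤ (+-mono-≤ (+-mono-≤ (from-end-p 0 z≤n) (from-end-p (suc a) ≤-refl))
          (∑<-mono a (λ k k<a → from-end-p (suc k) (m≤n⇒m≤1+n k<a))))
          (∑<-mono b (λ k k<b → from-end-q (suc k) (m≤n⇒m≤1+n k<b))))
        (≤-reflexive (cycle-sum 0)))
        (∑<-mono c from-end-r))
      lower : ∑< g (cyc g h) + (c * h + M c ε) ≤ D (p h)
      lower = ≤-trans (≤-reflexive (sym (trans (vertex-sum f) (cong₂ _+_ (trans
        (cong₂ _+_ (cong₂ _+_ (cong₂ _+_ (f-p 0 z≤n) (f-p (suc a) ≤-refl))
          (∑<-cong a (λ k k<a → f-p (suc k) (m≤n⇒m≤1+n k<a))))
          (∑<-cong b (λ k k<b → f-q (suc k) (m≤n⇒m≤1+n k<b))))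
        (cycle-sum h))
        (trans (∑<-cong c (λ t t<c → trans (f-r (suc t) (m≤n⇒m≤1+n t<c))
          (lia (h ∷ ε ∷ c ∷ t ∷ []) (λ h e c t → (h :+ (con 1 :+ t)) :⊓ (h :+ e :+ (c :∸ t)) :≡ h :+ (con 1 :+ t) :⊓ (c :∸ t :+ e)))))
          (trans (∑<-+ c (λ _ → h) (λ t → suc t ⊓ (c ∸ t + ε))) (cong (_+ M c ε) (∑<-const c h))))))))
        (sum-mono f≤d)

  -- The gaps along the path add up to at least `D (p h) − D (p 0)`, and `lin` turns each into a
  -- square. In use `α = 2κ` and `β = κ²`.
  telescope : ∀ α β → (∀ x → α * x ≤ x * x + β) → ∀ (p : ℕ → Fin n) h →
    α * D (p h) ≤ α * D (p 0) + ∑< h (λ k → gap² (p k) (p (suc k))) + β * h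
  telescope α β lin p zero = ≤-trans (m≤m+n _ 0) (m≤m+n _ (β * 0))
  telescope α β lin p (suc h) = begin
    α * D (p (suc h))  ≤⟨ telescope α β lin (p ∘ suc) h ⟩
    α * D (p 1) + σ + β * h  ≤⟨ +-monoˡ-≤ (β * h) (+-monoˡ-≤ σ (≤-trans (ℕP.*-monoʳ-≤ α (ℕP.m≤n+∣m-n∣ (D (p 1)) (D (p 0))))
                                                                  (≤-trans (≤-reflexive (ℕP.*-distribˡ-+ α (D (p 0)) (gap (p 1) (p 0)))) (+-monoʳ-≤ (α * D (p 0)) (lin (gap (p 1) (p 0))))))) ⟩
    α * D (p 0) + (gap² (p 1) (p 0) + β) + σ + β * h  ≡⟨ cong (λ x → α * D (p 0) + (x + β) + σ + β * h) (gap²-sym (p 1) (p 0)) ⟩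
    α * D (p 0) + (gap² (p 0) (p 1) + β) + σ + β * h  ≡⟨ lemma (α * D (p 0)) (gap² (p 0) (p 1)) β σ h ⟩
    α * D (p 0) + (gap² (p 0) (p 1) + σ) + β * suc h  ∎
    where
    open ℕP.≤-Reasoning
    σ = ∑< h (λ k → gap² (p (suc k)) (p (suc (suc k))))
    lemma : ∀ x y β s h → x + (y + β) + s + β * h ≡ x + (y + s) + β * suc h
    lemma = solve-∀

  pathSum : ℕ → (ℕ → Fin n) → ℕ
  pathSum a p = ∑< (suc a) (λ k → gap² (p k) (p (suc k)))

  half-sum : ∀ α β → (∀ x → α * x ≤ x * x + β) → ∀ (p : ℕ → Fin n) h X → D (p 0) + X ≤ D (p h) →
    α * X ≤ ∑< h (λ k → gap² (p k) (p (suc k))) + β * h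
  half-sum α β lin p h X le = ℕP.+-cancelˡ-≤ (α * D (p 0)) _ _ (begin
    α * D (p 0) + α * X      ≡⟨ ℕP.*-distribˡ-+ α (D (p 0)) X ⟨
    α * (D (p 0) + X)  ≤⟨ ℕP.*-monoʳ-≤ α le ⟩
    α * D (p h)  ≤⟨ telescope α β lin p h ⟩
    α * D (p 0) + σ + β * h  ≡⟨ +-assoc (α * D (p 0)) σ (β * h) ⟩
    α * D (p 0) + (σ + β * h) ∎)
    where
    open ℕP.≤-Reasoning
    σ = ∑< h (λ k → gap² (p k) (p (suc k)))

  -- The halves of `p` next to its two ends share no edge, and `flip` carries one to the other; for
  -- this reason `gain` is assumed of every theta of the given shape. For `ε = 1` the middle edge is
  -- left out.
  path-bound : ∀ α β → (∀ x → α * x ≤ x * x + β) → ∀ {a b c} h ε → suc a ≡ h + h + ε → ∀ X →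
    (∀ (θ : Theta a b c) → D (Theta.p θ 0) + X ≤ D (Theta.p θ h)) →
    ∀ (θ : Theta a b c) → α * X + α * X ≤ pathSum a (Theta.p θ) + (β * h + β * h)
  path-bound α β lin {a} {b} {c} h ε a≡ X gain θ = begin
    α * X + α * X
      ≤⟨ +-mono-≤ (half-sum α β lin p h X (gain θ)) (half-sum α β lin (Theta.p θ′) h X (gain θ′)) ⟩
    (Σ₁ + β * h) + (Σ₂ + β * h)
      ≡⟨ lemma Σ₁ Σ₂ (β * h) ⟩
    (Σ₁ + Σ₂) + (β * h + β * h)
      ≤⟨ +-monoˡ-≤ (β * h + β * h) both ⟩
    pathSum a p + (β * h + β * h) ∎
    where
    open ℕP.≤-Reasoning
    open Theta θ
    θ′ = flip (proj₁ simple) θ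
    y : ℕ → ℕ
    y k = gap² (p k) (p (suc k))
    Σ₁ = ∑< h y
    Σ₂ = ∑< h (λ k → gap² (backwards a p k) (backwards a p (suc k)))
    lemma : ∀ x y z → (x + z) + (y + z) ≡ (x + y) + (z + z)
    lemma = solve-∀
    flipped : Σ₂ ≡ ∑< h (λ k → y (h + ε + k))
    flipped = trans (∑<-cong h (λ k k<h → trans (gap²-sym (p (suc a ∸ k)) (p (a ∸ k))) (cong₂ (λ s t → gap² (p s) (p t))
        (lia (a ∷ h ∷ ε ∷ k ∷ []) (λ a h e k → con 1 :+ a :≡ h :+ h :+ e :⇒ k :< h :⇒ a :∸ k :≡ h :+ e :+ (h :∸ (con 1 :+ k))) a≡ k<h)
        (lia (a ∷ h ∷ ε ∷ k ∷ []) (λ a h e k → con 1 :+ a :≡ h :+ h :+ e :⇒ k :< h :⇒ con 1 :+ a :∸ k :≡ con 1 :+ (h :+ e :+ (h :∸ (con 1 :+ k)))) a≡ k<h))))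
      (sym (∑<-reverse h (λ k → y (h + ε + k))))
    both : Σ₁ + Σ₂ ≤ pathSum a p
    both = begin
      Σ₁ + Σ₂  ≡⟨ cong (Σ₁ +_) flipped ⟩
      Σ₁ + ∑< h (λ k → y (h + ε + k))  ≤⟨ +-monoˡ-≤ _ (≤-trans (m≤m+n Σ₁ (∑< ε (λ k → y (h + k)))) (≤-reflexive (sym (∑<-split h ε y)))) ⟩
      ∑< (h + ε) y + ∑< h (λ k → y (h + ε + k))      ≡⟨ ∑<-split (h + ε) h y ⟨
      ∑< (h + ε + h) y  ≡⟨ cong (λ x → ∑< x y) (lia (a ∷ h ∷ ε ∷ []) (λ a h e → con 1 :+ a :≡ h :+ h :+ e :⇒ h :+ e :+ h :≡ con 1 :+ a) a≡) ⟩
      pathSum a p  ∎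

  2x≤x²+1 : ∀ x → 2 * x ≤ x * x + 1
  2x≤x²+1 zero    = z≤n
  2x≤x²+1 (suc x) = ≤-trans (m≤m+n (2 * suc x) (x * x)) (≤-reflexive (lemma x))
    where
    lemma : ∀ x → 2 * suc x + x * x ≡ suc x * suc x + 1
    lemma = solve-∀

  4x≤x²+4 : ∀ x → 4 * x ≤ x * x + 4
  4x≤x²+4 zero  = z≤n
  4x≤x²+4 (suc zero)    = n≤1+n 4
  4x≤x²+4 (suc (suc x)) = ≤-trans (m≤m+n (4 * suc (suc x)) (x * x)) (≤-reflexive (lemma x))
    where
    lemma : ∀ x → 4 * suc (suc x) + x * x ≡ suc (suc x) * suc (suc x) + 4
    lemma = solve-∀

  swap-pr : ∀ {a b c} → Theta a b c → Theta c b a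
  swap-pr θ = swap-pq (swap-qr (swap-pq θ))

  order : ∀ {a b c} → Theta a b c → n ≡ 2 + a + b + c
  order {a} {b} {c} θ = trans (sym (trans (sum-const n 1) (*-identityʳ n))) (trans (Theta.vertex-sum θ (λ _ → 1))
    (cong₂ _+_ (cong₂ _+_ (cong (2 +_) (ones a)) (ones b)) (ones c)))
    where
    ones : ∀ a → ∑< a (λ _ → 1) ≡ a
    ones a = trans (∑<-const a 1) (*-identityʳ a)

  two-paths : ∀ {a b c} (θ : Theta a b c) → pathSum a (Theta.p θ) + pathSum c (Theta.r θ) ≤ S
  two-paths {a} {b} {c} θ = ≤-trans (+-monoˡ-≤ (pathSum c r) (m≤m+n (pathSum a p) (pathSum b q))) (edge-sum gap² gap²-sym)
    where open Theta θ

  -- The gain `a` is spread over `h`, about `a / 2`, edges. The mean gap is near `2`, where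
  -- `4x ≤ x² + 4` is sharp.
  long-path : ∀ {a b c} (θ : Theta a b c) → 2 ≤ a → 2 ≤ c → b ≤ a → ∀ h ε → suc a ≡ h + h + ε → ε ≤ 1 → 1 ≤ h →
    4 * a + 4 * a ≤ pathSum a (Theta.p θ) + (4 * h + 4 * h)
  long-path {a} {b} {suc (suc c)} θ 2≤a _ b≤a h ε a≡ ε≤1 1≤h = path-bound 4 4 4x≤x²+4 h ε a≡ a
    (λ θ → ℕP.+-cancelʳ-≤ (M (2 + c) (suc b)) _ _ (≤-trans (≤-reflexive (lemma (D (Theta.p θ 0)) a (M (2 + c) (suc b))))
      (≤-trans (+-monoʳ-≤ (D (Theta.p θ 0)) (gain-bound {a} {b} {h} {ε} a≡ ε≤1 b≤a 1≤h c)) (Midpoint.midpoint-gain θ h ε a≡ ε≤1)))) θ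
    where
    lemma : ∀ x y z → x + y + z ≡ x + (z + y)
    lemma = solve-∀
  long-path {c = suc zero} θ _ (s≤s ())

  half-size : ∀ {a h ε} → 2 ≤ a → suc a ≡ h + h + ε → ε ≤ 1 → 2 ≤ h + ε × 1 ≤ h
  half-size {a} {zero} {ε} 2≤a eq ε≤1 =
    ⊥-elim (lia (a ∷ ε ∷ []) (λ a e → con 2 :≤ a :⇒ con 1 :+ a :≡ e :⇒ e :≤ con 1 :⇒ :⊥) 2≤a eq ε≤1)
  half-size {a} {suc zero} {ε} 2≤a eq ε≤1 = lia (a ∷ ε ∷ []) (λ a e → con 2 :≤ a :⇒ con 1 :+ a :≡ con 2 :+ e :⇒ con 2 :≤ con 1 :+ e) 2≤a eq , s≤s z≤n
  half-size {a} {suc (suc h)} {ε} 2≤a eq ε≤1 = s≤s (s≤s z≤n) , s≤s z≤n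

  -- With `b` the smallest size the other two paths suffice: they contribute at least
  -- `4 (a − 1 + ε)` and `4 (c − 1 + ε′)`, to be compared with `2 + n = 4 + a + b + c`. The bound
  -- `2 ≤ h + ε` supplies the margin for small sizes.
  theta-long : ∀ {a b c} → Theta a b c → 2 ≤ a → 2 ≤ c → b ≤ a → b ≤ c → 2 + n ≤ S
  theta-long {a} {b} {c} θ 2≤a 2≤c b≤a b≤c with halve (suc a) | halve (suc c)
  ... | h , ε , a≡ , ε≤1 | h′ , ε′ , c≡ , ε′≤1 with half-size {a} {h} {ε} 2≤a a≡ ε≤1 | half-size {c} {h′} {ε′} 2≤c c≡ ε′≤1
  ... | 2≤h+ε , 1≤h | 2≤h′+ε′ , 1≤h′ = ≤-trans
    (lia (n ∷ a ∷ b ∷ c ∷ h ∷ ε ∷ h′ ∷ ε′ ∷ pathSum a (Theta.p θ) ∷ pathSum c (Theta.r θ) ∷ [])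
      (λ n a b c h e h′ e′ x y → n :≡ con 2 :+ a :+ b :+ c :⇒ con 1 :+ a :≡ h :+ h :+ e :⇒ con 1 :+ c :≡ h′ :+ h′ :+ e′ :⇒
        con 2 :≤ h :+ e :⇒ con 2 :≤ h′ :+ e′ :⇒ b :≤ a :⇒ 4 :* a :+ 4 :* a :≤ x :+ (4 :* h :+ 4 :* h) :⇒
        4 :* c :+ 4 :* c :≤ y :+ (4 :* h′ :+ 4 :* h′) :⇒ con 2 :+ n :≤ x :+ y)
      (order θ) a≡ c≡ 2≤h+ε 2≤h′+ε′ b≤a (long-path θ 2≤a 2≤c b≤a h ε a≡ ε≤1 1≤h) (long-path (swap-pr θ) 2≤c 2≤a b≤c h′ ε′ c≡ ε′≤1 1≤h′))
    (two-paths θ)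

  -- A triangle sharing an edge with a cycle. The two edges of the triangle off the common edge give
  -- `8`, the long path at least `2h` with `2h + ε = c + 1`, and `2 + n = 5 + c`.
  theta-triangle : ∀ {c} → Theta 1 0 c → 6 < n → 2 + n ≤ S
  theta-triangle {c} θ 6<n = go c θ (lia (n ∷ c ∷ []) (λ n c → con 6 :< n :⇒ n :≡ con 3 :+ c :⇒ con 3 :≤ c) 6<n (order θ)) (halve (suc c))
    where
    lemma : ∀ x y z → x + y + z ≡ x + (z + y)
    lemma = solve-∀
    -- A gain of `2` over the single edge of each half, so `κ = 2`.
    short : ∀ {k} (θ : Theta 1 0 (3 + k)) → 16 ≤ pathSum 1 (Theta.p θ) + 8
    short {k} = path-bound 4 4 4x≤x²+4 1 0 refl 2 (λ θ → ℕP.+-cancelʳ-≤ (M (3 + k) 1) _ _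
      (≤-trans (≤-reflexive (lemma (D (Theta.p θ 0)) 2 (M (3 + k) 1)))
        (≤-trans (+-monoʳ-≤ (D (Theta.p θ 0)) (gain-triangle k)) (Midpoint.midpoint-gain θ 1 0 refl z≤n))))
    -- The only vertex off the cycle is the apex of the triangle. It is adjacent to both ends and
    -- contributes `1` to both bounds apart from the distance `h`; the gain is `h` over `h` edges,
    -- so `κ = 1`.
    long : ∀ {c} h ε → suc c ≡ h + h + ε → ε ≤ 1 → (θ : Theta c 0 1) → 2 * h + 2 * h ≤ pathSum c (Theta.p θ) + (1 * h + 1 * h)
    long h ε c≡ ε≤1 = path-bound 2 1 2x≤x²+1 h ε c≡ h (λ θ → ℕP.+-cancelʳ-≤ 1 _ _
      (≤-trans (≤-reflexive (trans (+-assoc (D (Theta.p θ 0)) h 1) (cong (λ x → D (Theta.p θ 0) + (x + 1)) (sym (+-identityʳ h)))))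
        (Midpoint.midpoint-gain θ h ε c≡ ε≤1)))
    go : ∀ c (θ : Theta 1 0 c) → 3 ≤ c → (∃ λ h → ∃ λ ε → suc c ≡ h + h + ε × ε ≤ 1) → 2 + n ≤ S
    go (suc zero) θ (s≤s ())
    go (suc (suc zero)) θ (s≤s (s≤s ()))
    go (suc (suc (suc k))) θ _ (h , ε , c≡ , ε≤1) = ≤-trans
      (lia (n ∷ k ∷ h ∷ ε ∷ pathSum 1 (Theta.p θ) ∷ pathSum (3 + k) (Theta.r θ) ∷ [])
        (λ n k h e x y → n :≡ con 6 :+ k :⇒ con 4 :+ k :≡ h :+ h :+ e :⇒ e :≤ con 1 :⇒ con 16 :≤ x :+ con 8 :⇒
          2 :* h :+ 2 :* h :≤ y :+ (1 :* h :+ 1 :* h) :⇒ con 2 :+ n :≤ x :+ y)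
        (order θ) c≡ ε≤1 (short θ) (long h ε c≡ ε≤1 (swap-pr θ)))
      (two-paths θ)

-- The extremal graph

-- Total on the natural numbers, with indices past the end sent to the last element, so that it can
-- serve as the vertex function of a `Path`.
at : ∀ {n} → ℕ → Fin (suc n)
at zero  = zero
at {zero}  (suc k) = zero
at {suc n} (suc k) = suc (at k)

toℕ-at : ∀ {n} k → k ≤ n → toℕ (at {n} k) ≡ k
toℕ-at zero  _  = refl
toℕ-at {suc n} (suc k) (s≤s k≤n) = cong suc (toℕ-at k k≤n)

at-toℕ : ∀ {n} (i : Fin (suc n)) → at (toℕ i) ≡ i
at-toℕ zero  = refl
at-toℕ {suc n} (suc i) = cong suc (at-toℕ i)

sum-at : ∀ n (f : Fin (suc n) → ℕ) → sum f ≡ ∑< (suc n) (f ∘ at)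
sum-at n f = trans (sum-cong-≗ (λ i → cong f (sym (at-toℕ i)))) (sum-toℕ (suc n) (f ∘ at))

module _ (c : ℕ) where

  -- The Boolean test `Bdir` as an inductive family, for order `4 + c`: the cycle has length
  -- `3 + c`, and `3 + c` is the duplicate of `0`.
  data BEdge : ℕ → ℕ → Set where
    step  : ∀ {a} → suc a < 3 + c → BEdge a (suc a)
    wrap  : BEdge 0 (2 + c)
    twin  : BEdge 1 (3 + c)
    twin′ : BEdge (2 + c) (3 + c)

  private
    ∧⁻ : ∀ {x y} → T (x ∧ y) → T x × T y
    ∧⁻ = Equivalence.to BP.T-∧
    ∧⁺ : ∀ {x y} → T x → T y → T (x ∧ y)
    ∧⁺ tx ty = Equivalence.from BP.T-∧ (tx , ty)
    ∨⁻ : ∀ {x y} → T (x ∨ y) → T x ⊎ T y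
    ∨⁻ = Equivalence.to BP.T-∨
    ∨⁺ : ∀ {x y} → T x ⊎ T y → T (x ∨ y)
    ∨⁺ = Equivalence.from BP.T-∨

  Bdir⁻ : ∀ a b → T (Bdir (4 + c) a b) → BEdge a b
  Bdir⁻ a b t with ∨⁻ {(suc a ℕ.≡ᵇ b) ∧ (b ℕ.<ᵇ 3 + c)} t
  ... | inj₁ u with ∧⁻ {suc a ℕ.≡ᵇ b} u
  ...   | u₁ , u₂ with ℕP.≡ᵇ⇒≡ (suc a) b u₁
  ...     | refl = step (ℕP.<ᵇ⇒< (suc a) (3 + c) u₂)
  Bdir⁻ a b t | inj₂ u with ∨⁻ {(a ℕ.≡ᵇ 0) ∧ (b ℕ.≡ᵇ 2 + c)} u
  ... | inj₁ v with ∧⁻ {a ℕ.≡ᵇ 0} v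
  ...   | v₁ , v₂ with ℕP.≡ᵇ⇒≡ a 0 v₁ | ℕP.≡ᵇ⇒≡ b (2 + c) v₂
  ...     | refl | refl = wrap
  Bdir⁻ a b t | inj₂ u | inj₂ v with ∧⁻ {b ℕ.≡ᵇ 3 + c} v
  ... | v₁ , v₂ with ℕP.≡ᵇ⇒≡ b (3 + c) v₁ | ∨⁻ {a ℕ.≡ᵇ 1} v₂
  ...   | refl | inj₁ x with ℕP.≡ᵇ⇒≡ a 1 x
  ...     | refl = twin
  Bdir⁻ a b t | inj₂ u | inj₂ v | v₁ , v₂ | refl | inj₂ x with ℕP.≡ᵇ⇒≡ a (2 + c) x
  ...     | refl = twin′

  Bdir⁺ : ∀ {a b} → BEdge a b → T (Bdir (4 + c) a b)
  Bdir⁺ {a} (step lt) = ∨⁺ {(suc a ℕ.≡ᵇ suc a) ∧ (suc a ℕ.<ᵇ 3 + c)}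
    (inj₁ (∧⁺ {suc a ℕ.≡ᵇ suc a} (ℕP.≡⇒≡ᵇ (suc a) (suc a) refl) (ℕP.<⇒<ᵇ lt)))
  Bdir⁺ wrap  = ∨⁺ {(1 ℕ.≡ᵇ 2 + c) ∧ (2 + c ℕ.<ᵇ 3 + c)} (inj₂ (∨⁺ {(0 ℕ.≡ᵇ 0) ∧ (2 + c ℕ.≡ᵇ 2 + c)} (inj₁ (ℕP.≡⇒≡ᵇ (2 + c) (2 + c) refl))))
  Bdir⁺ twin  = ∨⁺ {(2 ℕ.≡ᵇ 3 + c) ∧ (3 + c ℕ.<ᵇ 3 + c)} (inj₂ (∨⁺ {(1 ℕ.≡ᵇ 0) ∧ (3 + c ℕ.≡ᵇ 2 + c)}
    (inj₂ (∧⁺ {3 + c ℕ.≡ᵇ 3 + c} (ℕP.≡⇒≡ᵇ (3 + c) (3 + c) refl) tt))))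
  Bdir⁺ twin′ = ∨⁺ {(3 + c ℕ.≡ᵇ 3 + c) ∧ (3 + c ℕ.<ᵇ 3 + c)} (inj₂ (∨⁺ {(2 + c ℕ.≡ᵇ 0) ∧ (3 + c ℕ.≡ᵇ 2 + c)}
    (inj₂ (∧⁺ {3 + c ℕ.≡ᵇ 3 + c} (ℕP.≡⇒≡ᵇ (3 + c) (3 + c) refl) (∨⁺ {2 + c ℕ.≡ᵇ 1} (inj₂ (ℕP.≡⇒≡ᵇ (2 + c) (2 + c) refl)))))))

  BEdge-< : ∀ {a b} → BEdge a b → a < b
  BEdge-< {a} (step _) = ℕP.n<1+n a
  BEdge-< wrap  = s≤s z≤n
  BEdge-< twin  = s≤s (s≤s z≤n)
  BEdge-< twin′  = ≤-refl

  BEdge-≤ : ∀ {a b} → BEdge a b → b ≤ 3 + c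
  BEdge-≤ (step lt) = <⇒≤ lt
  BEdge-≤ wrap      = n≤1+n (2 + c)
  BEdge-≤ twin      = ≤-refl
  BEdge-≤ twin′     = ≤-refl

  H : Graph (4 + c)
  H = B (4 + c)

  B⁻ : ∀ i j → H i j ≡ true → BEdge (toℕ i) (toℕ j) ⊎ BEdge (toℕ j) (toℕ i)
  B⁻ i j e with ∨⁻ {Bdir (4 + c) (toℕ i) (toℕ j)} (Equivalence.from BP.T-≡ e)
  ... | inj₁ t = inj₁ (Bdir⁻ (toℕ i) (toℕ j) t)
  ... | inj₂ t = inj₂ (Bdir⁻ (toℕ j) (toℕ i) t)

  B-simple : IsSimple H
  B-simple = (λ i j → BP.∨-comm (Bdir (4 + c) (toℕ i) (toℕ j)) (Bdir (4 + c) (toℕ j) (toℕ i))) ,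
    λ i → BP.¬-not (λ e → irr i (B⁻ i i e))
    where
    irr : ∀ i → BEdge (toℕ i) (toℕ i) ⊎ BEdge (toℕ i) (toℕ i) → ⊥
    irr i (inj₁ e) = ℕP.n≮n (toℕ i) (BEdge-< e)
    irr i (inj₂ e) = ℕP.n≮n (toℕ i) (BEdge-< e)

  B⁺ : ∀ {a b} → BEdge a b → H (at a) (at b) ≡ true
  B⁺ {a} {b} e = Equivalence.to BP.T-≡ (∨⁺ {Bdir (4 + c) (toℕ (at {3 + c} a)) (toℕ (at {3 + c} b))}
    (inj₁ (subst₂ (λ x y → T (Bdir (4 + c) x y)) (sym (toℕ-at a (<⇒≤ (ℕP.<-≤-trans (BEdge-< e) (BEdge-≤ e))))) (sym (toℕ-at b (BEdge-≤ e))) (Bdir⁺ e))))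

  B⁺-sym : ∀ {a b} → BEdge a b → H (at b) (at a) ≡ true
  B⁺-sym {a} {b} e = trans (proj₁ B-simple (at b) (at a)) (B⁺ e)

  B-elim : (R : Fin (4 + c) → Fin (4 + c) → Set) → (∀ {u v} → R u v → R v u) →
    (∀ {a b} → BEdge a b → R (at a) (at b)) → ∀ u v → H u v ≡ true → R u v
  B-elim R R-sym h u v e with B⁻ u v e
  ... | inj₁ uv = subst₂ R (at-toℕ u) (at-toℕ v) (h uv)
  ... | inj₂ vu = R-sym (subst₂ R (at-toℕ v) (at-toℕ u) (h vu))

  B-step : ∀ k → k ≤ 2 + c → BEdge k (suc k)
  B-step k k≤ with ℕP.m≤n⇒m<n∨m≡n k≤
  ... | inj₁ k<   = step (s≤s k<)
  ... | inj₂ refl = twin′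

  B-connected : Connected H
  B-connected i j with ℕP.≤-total (toℕ i) (toℕ j)
  ... | inj₁ i≤j = toℕ j ∸ toℕ i , subst₂ (λ x y → reachIn H (toℕ j ∸ toℕ i) x y ≡ true) (at-toℕ i)
          (trans (cong at (m+[n∸m]≡n i≤j)) (at-toℕ j)) (forth (toℕ j ∸ toℕ i) (toℕ i)
            (≤-trans (≤-reflexive (m+[n∸m]≡n i≤j)) (FP.toℕ≤pred[n] j)))
    where
    forth : ∀ t k → k + t ≤ 3 + c → reachIn H t (at k) (at (k + t)) ≡ true
    forth zero    k _ = subst (λ x → reachIn H 0 (at k) (at x) ≡ true) (sym (+-identityʳ k)) (reach-refl H (at k))
    forth (suc t) k h = subst (λ x → reachIn H (suc t) (at k) (at x) ≡ true) (sym (+-suc k t))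
      (reach-step H t {at k} (at (k + t)) {at (suc (k + t))} (forth t k (≤-trans (n≤1+n (k + t)) le)) (B⁺ (B-step (k + t) (≤-pred le))))
      where
      le : suc (k + t) ≤ 3 + c
      le = ≤-trans (≤-reflexive (sym (+-suc k t))) h
  ... | inj₂ j≤i = toℕ i ∸ toℕ j , subst₂ (λ x y → reachIn H (toℕ i ∸ toℕ j) x y ≡ true)
          (trans (cong at (m+[n∸m]≡n j≤i)) (at-toℕ i)) (at-toℕ j) (back (toℕ i ∸ toℕ j) (toℕ j)
            (≤-trans (≤-reflexive (m+[n∸m]≡n j≤i)) (FP.toℕ≤pred[n] i)))
    where
    back : ∀ t k → k + t ≤ 3 + c → reachIn H t (at (k + t)) (at k) ≡ true
    back zero    k _ = subst (λ x → reachIn H 0 (at x) (at k) ≡ true) (sym (+-identityʳ k)) (reach-refl H (at k))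
    back (suc t) k h = subst (λ x → reachIn H (suc t) (at x) (at k) ≡ true) (sym (+-suc k t))
      (reach-prepend H t {at (suc (k + t))} (at (k + t)) {at k} (trans (proj₁ B-simple (at (suc (k + t))) (at (k + t))) (B⁺ (B-step (k + t) (≤-pred le))))
        (back t k (≤-trans (n≤1+n (k + t)) le)))
      where
      le : suc (k + t) ≤ 3 + c
      le = ≤-trans (≤-reflexive (sym (+-suc k t))) h

  open Metric H B-simple B-connected
  open Paths H B-simple

  B-path : Path (3 + c)
  B-path = record
    { w   = at
    ; inj = λ { k l (s≤s k≤) (s≤s l≤) eq → trans (sym (toℕ-at k k≤)) (trans (cong toℕ eq) (toℕ-at l l≤)) }
    ; adj = λ { k (s≤s k≤) → B⁺ (B-step k k≤) }
    }

  B-lasso : Lasso B-path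
  B-lasso = record
    { i = 2 + c ; j = 1 ; 2≤i = s≤s (s≤s z≤n) ; i≤m = n≤1+n (2 + c) ; j+2≤m = s≤s (s≤s (s≤s z≤n))
    ; startEdge = B⁺ wrap ; endEdge = B⁺ twin ; distinct = inj₁ ≤-refl }

  -- The numbering `0`, ..., `3 + c` is itself a spanning lasso, whose edges are counted. `B-szTerm`
  -- requires only this direction.
  B-numEdges : 5 + c ≤ numEdges H
  B-numEdges = ℕP.≮⇒≥ λ lt → ℕP.<⇒≱ (ℕP.+-mono-< lt lt) (begin
    5 + c + (5 + c)  ≡⟨ cong₂ _+_ count-total count-total ⟨
    total + total  ≤⟨ double-total≤ ⟩
    ∑²< (4 + c) (λ k l → e k l * 1)  ≡⟨ ∑²<-cong (4 + c) (λ k l → *-identityʳ (e k l)) ⟩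
    ∑²< (4 + c) e  ≡⟨ ∑<-cong (4 + c) (λ k _ → sum-at (3 + c) (λ v → 𝟙 (H (at k) v))) ⟨
    ∑< (4 + c) (deg H ∘ at)  ≡⟨ sum-at (3 + c) (deg H) ⟨
    sum (deg H)  ≡⟨ sum-deg H B-simple ⟩
    numEdges H + numEdges H  ∎)
    where
    open LassoEdges B-lasso
    open Weighted (λ _ _ → 1) (λ _ _ → refl)
    open ℕP.≤-Reasoning
    count-total : total ≡ 5 + c
    count-total = trans (cong (λ x → x + 1 + 1) (trans (∑<-const (3 + c) 1) (*-identityʳ (3 + c)))) (lemma c)
      where
      lemma : ∀ c → 3 + c + 1 + 1 ≡ 5 + c
      lemma = solve-∀

  private
    g : ℕ
    g = 3 + c

    ρ : ℕ → ℕ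
    ρ l = if does (l ℕ.<? g) then l else 0

    ρ-below : ∀ {l} → l < g → ρ l ≡ l
    ρ-below {l} l<g = cong (if_then l else 0) (dec-true (l ℕ.<? g) l<g)

    ρ-top : ρ g ≡ 0
    ρ-top = cong (if_then g else 0) (dec-false (g ℕ.<? g) (ℕP.n≮n g))

    B-adj : ∀ k → k < g → H (at k) (at (suc k)) ≡ true
    B-adj k k<g = B⁺ (B-step k (≤-pred k<g))

  -- Folding the duplicated vertex onto its twin is a retraction onto the cycle, which is therefore isometric.
  d-lower-B : ∀ s → s < g → ∀ l → l ≤ g → cyc g s (ρ l) ≤ d (at s) (at l)
  d-lower-B s s<g l l≤g = begin
    cyc g s (ρ l)  ≡⟨ cong (λ x → cyc g s (ρ x)) (toℕ-at {g} l l≤g) ⟨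
    f (at l)  ≤⟨ d-lower (λ u v e → proj₂ (f-near u v e)) (at s) (at l) ⟩
    d (at s) (at l) + f (at s)  ≡⟨ cong (d (at s) (at l) +_) f-source ⟩
    d (at s) (at l) + 0  ≡⟨ +-identityʳ _ ⟩
    d (at s) (at l)  ∎
    where
    open ℕP.≤-Reasoning
    f : Fin (4 + c) → ℕ
    f v = cyc g s (ρ (toℕ v))
    f-source : f (at s) ≡ 0
    f-source = trans (cong (λ x → cyc g s (ρ x)) (toℕ-at {g} s (<⇒≤ s<g))) (trans (cong (cyc g s) (ρ-below s<g)) (cyc-refl g s))
    near-edge : ∀ {a b} → BEdge a b → Near (cyc g s (ρ a)) (cyc g s (ρ b))
    near-edge {a} (step lt) = subst₂ (λ x y → Near (cyc g s x) (cyc g s y)) (sym (ρ-below (ℕP.<-trans (ℕP.n<1+n a) lt))) (sym (ρ-below lt)) (cyc-near g s a)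
    near-edge wrap  = subst (λ x → Near (cyc g s 0) (cyc g s x)) (sym (ρ-below ≤-refl)) (cyc-near-wrap (2 + c) s (≤-pred s<g))
    near-edge twin  = subst (λ x → Near (cyc g s 1) (cyc g s x)) (sym ρ-top) (near-sym (cyc-near g s 0))
    near-edge twin′ = subst₂ (λ x y → Near (cyc g s x) (cyc g s y)) (sym (ρ-below ≤-refl)) (sym ρ-top) (near-sym (cyc-near-wrap (2 + c) s (≤-pred s<g)))
    f-near : ∀ u v → H u v ≡ true → Near (f u) (f v)
    f-near = B-elim (λ u v → Near (f u) (f v)) near-sym λ {a} {b} e →
      subst₂ (λ x y → Near (cyc g s (ρ x)) (cyc g s (ρ y))) (sym (toℕ-at {g} a (<⇒≤ (ℕP.<-≤-trans (BEdge-< e) (BEdge-≤ e))))) (sym (toℕ-at {g} b (BEdge-≤ e))) (near-edge e)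

  private
    d-along : ∀ {k l} → k ≤ l → l ≤ g → d (at k) (at l) ≤ l ∸ k
    d-along {k} {l} k≤l l≤g = subst (λ x → d (at k) (at x) ≤ l ∸ k) (m+[n∸m]≡n k≤l)
      (d-walk at B-adj k (l ∸ k) (≤-trans (≤-reflexive (m+[n∸m]≡n k≤l)) l≤g))

    d-around : ∀ {k l} → k ≤ l → l < g → d (at k) (at l) ≤ g ∸ (l ∸ k)
    d-around {k} {l} k≤l l<g = begin
      d (at k) (at l)  ≤⟨ d-triangle (at k) (at 0) (at l) ⟩
      d (at k) (at 0) + d (at 0) (at l)  ≤⟨ +-mono-≤ (subst (_≤ k) (d-sym (at 0) (at k)) (d-along z≤n (≤-trans k≤l (<⇒≤ l<g))))
                                                    (≤-trans (d-prepend (at 0) (at (2 + c)) (at l) (B⁺ wrap))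
                                                      (s≤s (subst (_≤ 2 + c ∸ l) (d-sym (at l) (at (2 + c))) (d-along (≤-pred l<g) (n≤1+n (2 + c)))))) ⟩
      k + suc (2 + c ∸ l)  ≡⟨ lia (k ∷ l ∷ c ∷ []) (λ k l c → k :≤ l :⇒ l :< con 3 :+ c :⇒ k :+ (con 1 :+ (con 2 :+ c :∸ l)) :≡ con 3 :+ c :∸ (l :∸ k)) k≤l l<g ⟩
      g ∸ (l ∸ k)  ∎
      where open ℕP.≤-Reasoning

  d-B : ∀ k l → k < g → l < g → d (at k) (at l) ≡ cyc g k l
  d-B k l k<g l<g = ℕP.≤-antisym upper (≤-trans (≤-reflexive (cong (cyc g k) (sym (ρ-below l<g)))) (d-lower-B k k<g l (<⇒≤ l<g)))
    where
    upper : d (at k) (at l) ≤ cyc g k l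
    upper with ℕP.≤-total k l
    ... | inj₁ k≤l = ≤-trans (ℕP.⊓-glb (d-along k≤l (<⇒≤ l<g)) (d-around k≤l l<g)) (≤-reflexive (sym (cyc-≤ g k≤l)))
    ... | inj₂ l≤k = ≤-trans (≤-reflexive (d-sym (at k) (at l)))
          (≤-trans (ℕP.⊓-glb (d-along l≤k (<⇒≤ k<g)) (d-around l≤k k<g)) (≤-reflexive (sym (cyc-≥ g l≤k))))

  d-twin : ∀ l → suc l < g → d (at g) (at (suc l)) ≡ cyc g 0 (suc l)
  d-twin l l<g = ℕP.≤-antisym (ℕP.⊓-glb left right) (begin
    cyc g 0 (suc l)  ≡⟨ cong (arc g) (ℕP.∣-∣-comm 0 (suc l)) ⟩
    cyc g (suc l) 0  ≡⟨ cong (cyc g (suc l)) ρ-top ⟨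
    cyc g (suc l) (ρ g)  ≤⟨ d-lower-B (suc l) l<g g ≤-refl ⟩
    d (at (suc l)) (at g)  ≡⟨ d-sym (at (suc l)) (at g) ⟩
    d (at g) (at (suc l))  ∎)
    where
    open ℕP.≤-Reasoning
    left : d (at g) (at (suc l)) ≤ suc l
    left = ≤-trans (d-prepend (at g) (at 1) (at (suc l)) (B⁺-sym twin)) (s≤s (d-along (s≤s z≤n) (<⇒≤ l<g)))
    right : d (at g) (at (suc l)) ≤ g ∸ suc l
    right = ≤-trans (d-prepend (at g) (at (2 + c)) (at (suc l)) (B⁺-sym twin′))
      (≤-trans (s≤s (subst (_≤ 2 + c ∸ suc l) (d-sym (at (suc l)) (at (2 + c))) (d-along (≤-pred l<g) (n≤1+n (2 + c)))))
        (lia (l ∷ c ∷ []) (λ l c → con 1 :+ l :< con 3 :+ c :⇒ con 1 :+ (con 2 :+ c :∸ (con 1 :+ l)) :≤ con 3 :+ c :∸ (con 1 :+ l)) l<g))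

  C : ℕ
  C = ∑< g (cyc g 0)

  D-cycle : ∀ k → k < g → D (at k) ≡ C + d (at k) (at g)
  D-cycle k k<g = begin
    D (at k)  ≡⟨ sum-at (3 + c) (d (at k)) ⟩
    ∑< (suc g) (d (at k) ∘ at)  ≡⟨ ∑<-last g (d (at k) ∘ at) ⟩
    ∑< g (d (at k) ∘ at) + d (at k) (at g)  ≡⟨ cong (_+ d (at k) (at g)) (trans (∑<-cong g (λ l l<g → d-B k l k<g l<g)) (∑<-cyc g k k<g)) ⟩
    C + d (at k) (at g)  ∎
    where open ≡-Reasoning

  -- The duplicate sees the remaining vertices as `0` does, so its sum is that of the cycle from
  -- `0`, plus its distance to `0`.
  D-twin : D (at g) ≡ C + d (at 0) (at g)
  D-twin = begin
    D (at g)  ≡⟨ sum-at (3 + c) (d (at g)) ⟩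
    d (at g) (at 0) + ∑< g (d (at g) ∘ at ∘ suc)  ≡⟨ cong (d (at g) (at 0) +_) (∑<-last (2 + c) (d (at g) ∘ at ∘ suc)) ⟩
    d (at g) (at 0) + (∑< (2 + c) (d (at g) ∘ at ∘ suc) + d (at g) (at g))  ≡⟨ cong₂ (λ x y → x + (∑< (2 + c) (d (at g) ∘ at ∘ suc) + y)) (d-sym (at g) (at 0)) (d-refl (at g)) ⟩
    d (at 0) (at g) + (∑< (2 + c) (d (at g) ∘ at ∘ suc) + 0)  ≡⟨ cong (λ x → d (at 0) (at g) + (x + 0)) (∑<-cong (2 + c) (λ l l< → d-twin l (s≤s l<))) ⟩
    d (at 0) (at g) + (C + 0)  ≡⟨ lemma (d (at 0) (at g)) C ⟩
    C + d (at 0) (at g)  ∎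
    where
    open ≡-Reasoning
    lemma : ∀ x y → x + (y + 0) ≡ y + x
    lemma = solve-∀

  -- Apart from the constant `C`, the transmission of a vertex of the cycle is its distance to the
  -- duplicate, which changes by at most one along an edge. At the duplicate the value is that of
  -- `0`, so its edges behave like edges at `0`.
  D-near : ∀ u v → H u v ≡ true → Near (D u) (D v)
  D-near = B-elim (λ u v → Near (D u) (D v)) near-sym edge
    where
    shift : ∀ {x y} → Near x y → Near (C + x) (C + y)
    shift {x} {y} (p , q) = ≤-trans (+-monoʳ-≤ C p) (≤-reflexive (+-suc C y)) , ≤-trans (+-monoʳ-≤ C q) (≤-reflexive (+-suc C x))
    neighbours : ∀ u v → H u v ≡ true → Near (d u (at g)) (d v (at g))
    neighbours u v e = d-prepend u v (at g) e , d-prepend v u (at g) (G-sym {u} {v} e)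
    cyclic : ∀ {a b} → a < g → b < g → H (at a) (at b) ≡ true → Near (D (at a)) (D (at b))
    cyclic {a} {b} a<g b<g e = subst₂ Near (sym (D-cycle a a<g)) (sym (D-cycle b b<g)) (shift (neighbours (at a) (at b) e))
    twinned : ∀ {a} → a < g → H (at a) (at 0) ≡ true → Near (D (at a)) (D (at g))
    twinned {a} a<g e = subst₂ Near (sym (D-cycle a a<g)) (sym D-twin) (shift (neighbours (at a) (at 0) e))
    edge : ∀ {a b} → BEdge a b → Near (D (at a)) (D (at b))
    edge {a} (step lt) = cyclic (ℕP.<-trans (ℕP.n<1+n a) lt) lt (B⁺ (step lt))
    edge wrap  = cyclic (s≤s z≤n) ≤-refl (B⁺ wrap)
    edge twin  = twinned (s≤s (s≤s z≤n)) (B⁺-sym (step (s≤s (s≤s z≤n))))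
    edge twin′ = twinned ≤-refl (B⁺-sym wrap)

  B-S : S ≤ numEdges H
  B-S = ≤-trans (edgeSum-mono H {λ u v → gap u v * gap u v} {λ _ _ → 1} (λ u v e → small (D u) (D v) (D-near u v e)))
    (≤-reflexive (sym (numEdges-edgeSum H)))
    where
    small : ∀ x y → Near x y → ∣ x - y ∣ * ∣ x - y ∣ ≤ 1
    small zero  zero  _ = z≤n
    small zero  (suc zero)    _ = ≤-refl
    small zero  (suc (suc y)) (_ , s≤s ())
    small (suc zero)    zero  _ = ≤-refl
    small (suc (suc x)) zero  (s≤s () , _)
    small (suc x)  (suc y)  (s≤s p , s≤s q) = small x y (p , q)

  -- With `N` edges, `S ≤ N` makes the scaled index at least `N (n² − 1)`. This increases with `N`,
  -- so a lower bound on the number of edges suffices.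
  B-szTerm : (5 + c) * ((4 + c) * (4 + c)) ≤ edgeSum H (szTerm H) + (5 + c)
  B-szTerm = enlarge (5 + c) (edgeSum H (szTerm H)) ((4 + c) * (4 + c)) (numEdges H) (s≤s z≤n) B-numEdges
      (≤-trans (≤-reflexive (sym szTerm-S)) (+-monoʳ-≤ (edgeSum H (szTerm H)) B-S))
    where
    enlarge : ∀ m t q N → 1 ≤ q → m ≤ N → N * q ≤ t + N → m * q ≤ t + m
    enlarge m t q N 1≤q m≤N h with ℕP.m≤n⇒∃[o]m+o≡n m≤N
    ... | o , refl = ℕP.+-cancelʳ-≤ o (m * q) (t + m) (begin
      m * q + o  ≤⟨ +-monoʳ-≤ (m * q) (≤-trans (≤-reflexive (sym (*-identityʳ o))) (ℕP.*-monoʳ-≤ o 1≤q)) ⟩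
      m * q + o * q      ≡⟨ ℕP.*-distribʳ-+ q m o ⟨
      (m + o) * q  ≤⟨ h ⟩
      t + (m + o)  ≡⟨ +-assoc t m o ⟨
      t + m + o  ∎)
      where open ℕP.≤-Reasoning

  module _ {G : Graph (4 + c)} (simple : IsSimple G) where
    open Thetas G

    -- The path `r` becomes the stretch `1`, ..., `c + 2` of the cycle, and the single interior
    -- vertices of `p` and `q` become `0` and its duplicate. The labelling `f` comes from `glue` and
    -- `W` is its inverse.
    theta-B : Theta 1 1 c → Isomorphic G H
    theta-B θ = permutation to from to-from from-to , λ u v → BP.⇔→≡ {z = true} (mk⇔ (forwards u v) (backwards′ u v))
      where
      open Theta θ
      φ ψ : ℕ → ℕ
      φ 0 = 1
      φ 1 = 0
      -- Index `2` is the common end; larger indices do not occur.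
      φ _ = 2 + c
      ψ 0 = 1
      ψ 1 = 3 + c
      ψ _ = 2 + c
      labelling : ∃ λ (f : Fin (4 + c) → ℕ) → (∀ k → k ≤ 2 → f (p k) ≡ φ k) × (∀ k → k ≤ 2 → f (q k) ≡ ψ k) × (∀ k → k ≤ suc c → f (r k) ≡ suc k)
      labelling = glue φ ψ suc refl refl refl refl
      f = proj₁ labelling
      f-p = proj₁ (proj₂ labelling)
      f-q = proj₁ (proj₂ (proj₂ labelling))
      f-r = proj₂ (proj₂ (proj₂ labelling))
      W : ℕ → Fin (4 + c)
      W zero    = p 1
      W (suc k) = if does (k ℕ.≤? suc c) then r k else q 1
      W-r : ∀ k → k ≤ suc c → W (suc k) ≡ r k
      W-r k k≤ = cong (if_then r k else q 1) (dec-true (k ℕ.≤? suc c) k≤)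
      W-q : W (3 + c) ≡ q 1
      W-q = cong (if_then r (2 + c) else q 1) (dec-false (2 + c ℕ.≤? suc c) (ℕP.n≮n (suc c)))
      f-W : ∀ k → k ≤ 3 + c → f (W k) ≡ k
      f-W zero    _ = f-p 1 (s≤s z≤n)
      f-W (suc k) (s≤s k≤) with ℕP.m≤n⇒m<n∨m≡n k≤
      ... | inj₁ (s≤s k≤1+c) = trans (cong f (W-r k k≤1+c)) (f-r k k≤1+c)
      ... | inj₂ refl  = trans (cong f W-q) (f-q 1 (s≤s z≤n))
      on-r : ∀ k → k ≤ suc c → f (r k) ≤ 3 + c × W (f (r k)) ≡ r k
      on-r k k≤ = ≤-trans (≤-reflexive (f-r k k≤)) (s≤s (m≤n⇒m≤1+n k≤)) , trans (cong W (f-r k k≤)) (W-r k k≤)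
      labelled : ∀ v → f v ≤ 3 + c × W (f v) ≡ v
      labelled = cover (λ v → f v ≤ 3 + c × W (f v) ≡ v) on-p on-q on-r
        where
        Good : Fin (4 + c) → Set
        Good v = f v ≤ 3 + c × W (f v) ≡ v
        on-p : ∀ k → k ≤ 2 → Good (p k)
        on-p 0 _ = subst Good (sym p₀≡r₀) (on-r 0 z≤n)
        on-p 1 _ = ≤-trans (≤-reflexive (f-p 1 (s≤s z≤n))) z≤n , cong W (f-p 1 (s≤s z≤n))
        on-p 2 _ = subst Good (sym pₑ≡rₑ) (on-r (suc c) ≤-refl)
        on-p (suc (suc (suc _))) (s≤s (s≤s ()))
        on-q : ∀ k → k ≤ 2 → Good (q k)
        on-q 0 _ = subst Good (trans (sym p₀≡r₀) p₀≡q₀) (on-r 0 z≤n)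
        on-q 1 _ = ≤-reflexive (f-q 1 (s≤s z≤n)) , trans (cong W (f-q 1 (s≤s z≤n))) W-q
        on-q 2 _ = subst Good (trans (sym pₑ≡rₑ) pₑ≡qₑ) (on-r (suc c) ≤-refl)
        on-q (suc (suc (suc _))) (s≤s (s≤s ()))
      to : Fin (4 + c) → Fin (4 + c)
      to v = at (f v)
      from : Fin (4 + c) → Fin (4 + c)
      from k = W (toℕ k)
      to-from : ∀ k → to (from k) ≡ k
      to-from k = trans (cong at (f-W (toℕ k) (FP.toℕ≤pred[n] k))) (at-toℕ k)
      from-to : ∀ v → from (to v) ≡ v
      from-to v = trans (cong W (toℕ-at (f v) (proj₁ (labelled v)))) (proj₂ (labelled v))
      edge : ∀ {u v a b} → f u ≡ a → f v ≡ b → BEdge a b → H (to u) (to v) ≡ true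
      edge refl refl e = B⁺ e
      H-sym : ∀ {u v} → H u v ≡ true → H v u ≡ true
      H-sym {u} {v} e = trans (proj₁ B-simple v u) e
      forwards : ∀ u v → G u v ≡ true → H (to u) (to v) ≡ true
      forwards = edge-elim (λ u v → H (to u) (to v) ≡ true) (λ {u} {v} → H-sym {to u} {to v}) on-p on-q on-r′
        where
        on-p : ∀ k → k ≤ 1 → H (to (p k)) (to (p (suc k))) ≡ true
        on-p 0 _ = H-sym {to (p 1)} {to (p 0)} (edge (f-p 1 (s≤s z≤n)) (f-p 0 z≤n) (step (s≤s (s≤s z≤n))))
        on-p 1 _ = edge (f-p 1 (s≤s z≤n)) (f-p 2 (s≤s (s≤s z≤n))) wrap
        on-p (suc (suc _)) (s≤s ())
        on-q : ∀ k → k ≤ 1 → H (to (q k)) (to (q (suc k))) ≡ true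
        on-q 0 _ = edge (f-q 0 z≤n) (f-q 1 (s≤s z≤n)) twin
        on-q 1 _ = H-sym {to (q 2)} {to (q 1)} (edge (f-q 2 (s≤s (s≤s z≤n))) (f-q 1 (s≤s z≤n)) twin′)
        on-q (suc (suc _)) (s≤s ())
        on-r′ : ∀ k → k ≤ c → H (to (r k)) (to (r (suc k))) ≡ true
        on-r′ k k≤c = edge (f-r k (m≤n⇒m≤1+n k≤c)) (f-r (suc k) (s≤s k≤c)) (step (s≤s (s≤s (s≤s k≤c))))
      G-sym′ : ∀ {u v} → G u v ≡ true → G v u ≡ true
      G-sym′ {u} {v} e = trans (proj₁ simple v u) e
      W-edge : ∀ {a b} → BEdge a b → G (W a) (W b) ≡ true
      W-edge {zero}  (step _) = trans (cong₂ G refl (trans (W-r 0 z≤n) (sym p₀≡r₀))) (G-sym′ (p-adj 0 z≤n))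
      W-edge {suc a} (step (s≤s (s≤s (s≤s a≤c)))) = trans (cong₂ G (W-r a (m≤n⇒m≤1+n a≤c)) (W-r (suc a) (s≤s a≤c))) (r-adj a a≤c)
      W-edge wrap  = trans (cong₂ G refl (trans (W-r (suc c) ≤-refl) (sym pₑ≡rₑ))) (p-adj 1 ≤-refl)
      W-edge twin  = trans (cong₂ G (trans (W-r 0 z≤n) (trans (sym p₀≡r₀) p₀≡q₀)) W-q) (q-adj 0 z≤n)
      W-edge twin′ = trans (cong₂ G (trans (W-r (suc c) ≤-refl) (trans (sym pₑ≡rₑ) pₑ≡qₑ)) W-q) (G-sym′ (q-adj 1 ≤-refl))
      backwards′ : ∀ u v → H (to u) (to v) ≡ true → G u v ≡ true
      backwards′ u v e = subst₂ (λ x y → G x y ≡ true) (from-to u) (from-to v)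
        (B-elim (λ x y → G (from x) (from y) ≡ true) G-sym′ (λ {a} {b} ab → subst₂ (λ x y → G (W x) (W y) ≡ true)
          (sym (toℕ-at a (<⇒≤ (ℕP.<-≤-trans (BEdge-< ab) (BEdge-≤ ab))))) (sym (toℕ-at b (BEdge-≤ ab))) (W-edge ab)) (to u) (to v) e)

-- Case distinction over all bicyclic graphs

module Classification {n} (G : Graph n) (simple : IsSimple G) (conn : Connected G) (6<n : 6 < n) where
  open Metric G simple conn using (S)
  open Thetas G
  open ThetaBounds G simple conn

  -- Sizes `1, 0, c` are the triangle case, and sizes `1, 1, c` are the extremal graph itself.
  thin-theta : ∀ {b c} → Theta 1 b c → b ≤ 1 → 2 + n ≤ S ⊎ ∃ (Theta 1 1)
  thin-theta {zero}  θ _ = inj₁ (theta-triangle θ 6<n)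
  thin-theta {suc zero}    θ _ = inj₂ (_ , θ)
  thin-theta {suc (suc _)} θ (s≤s ())

  sorted-theta : ∀ {a b c} → Theta a b c → b ≤ a → b ≤ c → 2 + n ≤ S ⊎ ∃ (Theta 1 1)
  sorted-theta {suc (suc a)} {b} {suc (suc c)} θ b≤a b≤c = inj₁ (theta-long θ (s≤s (s≤s z≤n)) (s≤s (s≤s z≤n)) b≤a b≤c)
  sorted-theta {suc zero}  θ b≤a b≤c = thin-theta θ b≤a
  sorted-theta {suc (suc a)} {b} {suc zero}    θ b≤a b≤c = thin-theta (swap-pr θ) b≤c
  sorted-theta {zero} {zero}  θ _   _   = ⊥-elim (ℕP.n≮0 (Theta.1≤a+b θ))
  sorted-theta {suc (suc a)} {zero} {zero}     θ _   _   = ⊥-elim (ℕP.n≮0 (Theta.1≤b+c θ))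

  -- The symmetries move a shortest path into the position of `q`.
  theta-cases : ∀ {a b c} → Theta a b c → 2 + n ≤ S ⊎ ∃ (Theta 1 1)
  theta-cases {a} {b} {c} θ with ℕP.≤-total a b | ℕP.≤-total b c | ℕP.≤-total a c
  ... | inj₂ b≤a | inj₁ b≤c | _  = sorted-theta θ b≤a b≤c
  ... | inj₁ a≤b | _  | inj₁ a≤c = sorted-theta (swap-pq θ) a≤b a≤c
  ... | inj₂ b≤a | inj₂ c≤b | _  = sorted-theta (swap-qr θ) (≤-trans c≤b b≤a) c≤b
  ... | inj₁ a≤b | _  | inj₂ c≤a = sorted-theta (swap-qr θ) c≤a (≤-trans c≤a a≤b)

  S-bound : numEdges G ≡ suc n → 2 + n ≤ S ⊎ ∃ (Theta 1 1)
  S-bound bicyclic with FP.any? (λ v → deg G v ℕ.≤? 1)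
  ... | yes (v , deg≤1) = inj₁ (Leaf.leaf-bound G simple conn 6<n v deg≤1)
  ... | no none  = cyclic (spanning-lasso (F.fromℕ< (ℕP.<-trans (s≤s z≤n) 6<n)))
    where
    min-deg : ∀ v → 2 ≤ deg G v
    min-deg v = ℕP.≰⇒> (λ deg≤1 → none (v , deg≤1))
    open Paths G simple
    open Bicyclic G simple conn bicyclic min-deg
    cyclic : ∃ LassoOf → 2 + n ≤ S ⊎ ∃ (Theta 1 1)
    cyclic (m , p , lasso) with ℕP.≤-<-connex (Lasso.i lasso) (Lasso.j lasso)
    ... | inj₁ i≤j = inj₁ (DumbbellBound.dumbbell-bound G simple conn bicyclic min-deg lasso i≤j 6<n)
    ... | inj₂ j<i = theta-cases (LassoTheta.lasso-theta G simple conn bicyclic min-deg lasso (i ∸ suc j) (m ∸ i)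
                       (m+[n∸m]≡n j<i) (m+[n∸m]≡n i≤m))
      where open Lasso lasso

theorem2p4 : (n : ℕ) → 6 < n → (G : Graph n) → IsSimple G → Connected G →
    numEdges G ≡ suc n → ¬ Isomorphic G (B n) → SzStar G <ℚ SzStar (B n)
theorem2p4 (suc (suc (suc (suc c)))) 6<n G simple conn bicyclic G≇B = compare (S-bound bicyclic)
  where
  open Classification G simple conn 6<n
  open Metric G simple conn using (S; szTerm-S)
  open ThetaBounds G simple conn using (order)
  open Thetas G
  compare : 6 + c ≤ S ⊎ ∃ (Theta 1 1) → SzStar G <ℚ SzStar (B (4 + c))
  -- Both graphs are measured against `(n + 1) n²` with `n = 4 + c`: the scaled index of `G` falls
  -- short of it by at least `n + 2`, that of the extremal graph by at most `n + 1`.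
  compare (inj₁ bound) = SzStar-< {G = G} {B (4 + c)} (ℕP.+-cancelʳ-≤ (5 + c) (suc t) (edgeSum (B (4 + c)) (szTerm (B (4 + c)))) (begin
    suc t + (5 + c)  ≡⟨ +-suc t (5 + c) ⟨
    t + (6 + c)  ≤⟨ +-monoʳ-≤ t bound ⟩
    t + S  ≡⟨ szTerm-S ⟩
    numEdges G * ((4 + c) * (4 + c)) ≡⟨ cong (_* ((4 + c) * (4 + c))) bicyclic ⟩
    (5 + c) * ((4 + c) * (4 + c))    ≤⟨ B-szTerm c ⟩
    edgeSum (B (4 + c)) (szTerm (B (4 + c))) + (5 + c) ∎))
    where
    open ℕP.≤-Reasoning
    t = edgeSum G (szTerm G)
  -- Counting vertices gives `4 + c′ = 4 + c`, so the third path has the length that `theta-B`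
  -- expects.
  compare (inj₂ (c′ , θ)) = ⊥-elim (G≇B (theta-B c simple (subst (Theta 1 1) (sym (ℕP.+-cancelˡ-≡ 4 c c′ (order θ))) θ)))
theorem2p4 (suc zero)  (s≤s ())
theorem2p4 (suc (suc zero))  (s≤s (s≤s ()))
theorem2p4 (suc (suc (suc zero))) (s≤s (s≤s (s≤s ())))
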